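{- Let $q$ be a prime power with $q\equiv1\pmod 6$, let $\eta$ be a primitive character of order $3$ of $\mathbb{F}_q^\times$, and let $A,B$ be characters such that $A^3,\ B,\ A^3\overline{B}^2,\ A^6\overline{B}^3,\ \phi A^3\overline{B},\ \phi A^3\overline{B}^3$ are all nontrivial. Then for $x\in\mathbb{F}_q$, \begin{multline*}\overline{A}^3(1-x)\,{}_3\mathbb{F}_2\!\left(A,A\eta,A\overline{\eta};\phi B,A^3\overline{B};\tfrac{27x^2}{4(1-x)^3}\right)={}_3\mathbb{F}_2\!\left(A^3,B,\phi A^3\overline{B};B^2,A^6\overline{B}^2;4x\right)\\-\delta(x+2)\frac{g(\phi)g(\overline{A}^3)}{g(\phi\overline{B})g(\overline{A}^3B)}-\delta(1-x)\sum_{\chi^3=\overline{A}^3}\frac{g(\overline{\chi})g(\phi\overline{B\chi})g(B\overline{A^3\chi})}{g(\phi\overline{B})g(\overline{A}^3B)g(A^3)}\overline{\chi}(-4),\end{multline*} where the last sum runs over the characters $\chi$ of $\mathbb{F}_q^\times$ with $\chi^3=\overline{A}^3$.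
   Context: $q$ is a power of the prime $p$. Multiplicative characters of $\mathbb{F}_q^\times$ are extended to $\mathbb{F}_q$ by $\chi(0)=0$, including the trivial character. $\phi$ is the quadratic character, $\overline{A}=A^{ -1}$, products of characters are pointwise. $\delta(y)=1$ if $y=0$ and $0$ otherwise. $J(A,B)=\sum_{t\in\mathbb{F}_q}A(t)B(1-t)$; $g(A)=\sum_{x\in\mathbb{F}_q^\times}A(x)\zeta_p^{\mathrm{Tr}(x)}$ with $\zeta_p$ a fixed primitive $p$th root of unity and $\mathrm{Tr}$ the absolute trace to $\mathbb{F}_p$. For characters $A_1,A_2,A_3,B_1,B_2$ and $\lambda\in\mathbb{F}_q$, ${}_3\mathbb{P}_2(A_1,A_2,A_3;B_1,B_2;\lambda)=\sum_{x,y\in\mathbb{F}_q}A_3(x)\,\overline{A_3}B_2(1-x)\,A_2(y)\,\overline{A_2}B_1(1-y)\,\overline{A_1}(1-\lambda xy)$ and ${}_3\mathbb{F}_2={}_3\mathbb{P}_2\big/\big(J(A_2,B_1\overline{A_2})J(A_3,B_2\overline{A_3})\big)$. At $x=1$ the argument on the left is undefined but its prefactor is $\overline{A}^3(0)=0$; the left side is then taken to be $0$. -}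

module Defs where

open import Level using (0ℓ)
open import Data.Nat as ℕ using (ℕ; zero; suc)
open import Data.Bool using (Bool; true; false; if_then_else_)
open import Data.Product using (_×_)
open import Data.List using (List; []; _∷_; length; foldr; upTo)
open import Data.List.Relation.Unary.Any using (Any; any?)
open import Data.List.Relation.Unary.AllPairs using (AllPairs)
open import Relation.Binary.PropositionalEquality using (_≡_; _≢_)
open import Relation.Binary.Definitions using (DecidableEquality)
open import Relation.Nullary using (¬_; does)
open import Algebra.Structures using (IsCommutativeRing)
open import Algebra.Bundles using (CommutativeRing)

record FiniteField : Set₁ where
  infixl 7 _*F_
  infixl 6 _+F_
  infix  8 -F_
  field
    CarrierF : Set
    _+F_ _*F_ : CarrierF → CarrierF → CarrierF
    -F_ : CarrierF → CarrierF
    0F 1F : CarrierF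
    isCommutativeRingF : IsCommutativeRing _≡_ _+F_ _*F_ -F_ 0F 1F
    invF : CarrierF → CarrierF
    0≢1F : 0F ≢ 1F
    invF-inverse : ∀ x → x ≢ 0F → x *F invF x ≡ 1F
    invF-zero : invF 0F ≡ 0F
    _≟F_ : DecidableEquality CarrierF
    elements : List CarrierF
    complete : ∀ x → Any (x ≡_) elements
    distinct : AllPairs _≢_ elements

  order : ℕ
  order = length elements

-- The coefficient field (playing the role of ℂ): a commutative ring
-- (with setoid equality ≈) which is a field of characteristic zero,
-- given with a total inverse map (inverse of nonzero elements).

natR : (R : CommutativeRing 0ℓ 0ℓ) → ℕ → CommutativeRing.Carrier R
natR R zero    = CommutativeRing.0# R
natR R (suc n) = CommutativeRing._+_ R (CommutativeRing.1# R) (natR R n)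

record CoeffField : Set₁ where
  field
    coeffRing : CommutativeRing 0ℓ 0ℓ
  open CommutativeRing coeffRing public
  field
    inv : Carrier → Carrier
    inv-inverse : ∀ x → ¬ (x ≈ 0#) → x * inv x ≈ 1#
    charZero : ∀ n → ¬ (natR coeffRing (suc n) ≈ 0#)

module Ops (𝔽 : FiniteField) (𝕂 : CoeffField) where
  open FiniteField 𝔽 public
  open CoeffField 𝕂 public

  F = CarrierF
  K = Carrier

  natF : ℕ → F
  natF zero    = 0F
  natF (suc n) = 1F +F natF n

  _-F_ : F → F → F
  x -F y = x +F (-F y)

  _/F_ : F → F → F
  x /F y = x *F invF y

  powF : F → ℕ → F
  powF x zero    = 1F
  powF x (suc n) = x *F powF x n

  powK : K → ℕ → K
  powK z zero    = 1#
  powK z (suc n) = z * powK z n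

  _/_ : K → K → K
  a / b = a * inv b

  sumF : (F → K) → K
  sumF f = foldr (λ a s → f a + s) 0# elements

  IsCharacter : (F → K) → Set
  IsCharacter χ = (χ 0F ≈ 0#) × (χ 1F ≈ 1#) × (∀ x y → χ (x *F y) ≈ χ x * χ y)

  IsTrivial : (F → K) → Set
  IsTrivial χ = ∀ x → x ≢ 0F → χ x ≈ 1#

  Nontrivial : (F → K) → Set
  Nontrivial χ = ¬ IsTrivial χ

  _≐_ : (F → K) → (F → K) → Set
  χ ≐ ψ = ∀ x → χ x ≈ ψ x

  infixl 7 _·_
  _·_ : (F → K) → (F → K) → (F → K)
  (χ · ψ) x = χ x * ψ x

  conj : (F → K) → (F → K)
  conj χ x = χ (invF x)

  cube : (F → K) → (F → K)
  cube χ = χ · χ · χ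

  isSquare : F → Bool
  isSquare x = does (any? (λ y → (y *F y) ≟F x) elements)

  φ : F → K
  φ x = if does (x ≟F 0F) then 0# else (if isSquare x then 1# else (- 1#))

  δ : F → K
  δ y = if does (y ≟F 0F) then 1# else 0#

  trace : ℕ → ℕ → F → F
  trace p r x = foldr (λ i s → powF x (p ℕ.^ i) +F s) 0F (upTo r)

  -- the integer k ∈ {0,…,p-1} with t = k·1 (first match; 0 if none)
  firstIndex : F → List ℕ → ℕ
  firstIndex t []       = 0
  firstIndex t (k ∷ ks) = if does (natF k ≟F t) then k else firstIndex t ks

  -- additive character x ↦ ζ^(Tr x), ζ a primitive p-th root of unity in K
  addChar : K → ℕ → ℕ → F → K
  addChar ζ p r x = powK ζ (firstIndex (trace p r x) (upTo p))

  gauss : K → ℕ → ℕ → (F → K) → K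
  gauss ζ p r A = sumF (λ x → A x * addChar ζ p r x)

  J : (F → K) → (F → K) → K
  J A B = sumF (λ t → A t * B (1F -F t))

  ₃P₂ : (A₁ A₂ A₃ B₁ B₂ : F → K) → F → K
  ₃P₂ A₁ A₂ A₃ B₁ B₂ λ′ =
    sumF (λ x → sumF (λ y →
      A₃ x * (conj A₃ · B₂) (1F -F x) * A₂ y * (conj A₂ · B₁) (1F -F y)
        * conj A₁ (1F -F (λ′ *F x *F y))))

  ₃F₂ : (A₁ A₂ A₃ B₁ B₂ : F → K) → F → K
  ₃F₂ A₁ A₂ A₃ B₁ B₂ λ′ =
    ₃P₂ A₁ A₂ A₃ B₁ B₂ λ′ / (J A₂ (B₁ · conj A₂) * J A₃ (B₂ · conj A₃))

  sumList : List (F → K) → ((F → K) → K) → K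
  sumList L f = foldr (λ χ s → f χ + s) 0# L

module Submission where

-- Gauss sums for the additive character ψ turn both sides into the same sum
--   H(x) = Σ_{v,w} C̄(v) B̄(w) φ(x² + 4wv(x - 1 + w + v)),   C = φA³B̄.
-- On the left, the Hasse-Davenport relation for cubes merges A, Aη, Aη̄ into a
-- single sum over u with a term ψ(3u - cu³); rescaling leaves a quadratic Gauss
-- sum.  On the right, B² and A⁶B̄² are removed by the Hasse-Davenport relation
-- for squares, and the sum over the two variables of ₃P₂ becomes the Gauss sum of
-- a binary quadratic form.  The δ(x+2) term comes from the degenerate forms, and
-- the δ(1-x) term is the value of H(1), where the left side is 0 by convention.
-- The cubic relation follows from Cardano's formula, which writes the number of
-- roots of y³ - 3βy = c as 1 + Σ η(w) over the w with w + β³/w = c.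
-- Since K may lack roots of unity, sums over all characters are avoided.

-- The two sides meet because A³ = φBC. On either side A³, B and C are turned into sums against ψ,
-- and rescaling v and w by the variable that belongs to A³ removes B and C from it. That variable
-- then carries only φ, and its sum is a quadratic Gauss sum. Up to squares the value is φ(D) with D
-- = x² + 4wv(x - 1 + w + v): on the right D is -4 times the determinant of a ternary quadratic
-- form, on the left it is 4vw times the coefficient of the variable. The argument 27x²/(4(1 - x)³)
-- comes from the substitution u = -(1 - x)k/3, which turns 3u into (x - 1)k and clears 27 and (1 -
-- x)³ from the cubic term. All denominators are cleared by the single factor q g(A³) g(φB̄) g(Ā³B),
-- which leaves an identity between multiples of H(x), H(1) and δ(x + 2). Equality in K is not
-- decidable, so arguments of the kind "each term is 0 or 1" are run on idempotents: the
-- multiplicativity of φ, the number of cube roots and the fibres of the cubic all follow by showing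
-- that the defect is a constant times an idempotent with total 0.

open import Defs
open import Level using (0ℓ)
open import Algebra.Bundles using (CommutativeMonoid; CommutativeRing; RawRing)
open import Algebra.Solver.Ring.AlmostCommutativeRing
  using (fromCommutativeRing; _-Raw-AlmostCommutative⟶_; Induced-equivalence)
open import Data.Bool using (if_then_else_)
open import Data.Empty using (⊥; ⊥-elim)
open import Data.Fin as Fin using (Fin; toℕ; fromℕ; inject₁)
import Data.Fin.Properties as Finₚ
open import Data.Integer as ℤ using (ℤ; +_; -[1+_])
import Data.Integer.Properties as ℤₚ
open import Data.List using (List; []; _∷_; foldr; length; upTo; applyUpTo)
import Data.List.Properties as Listₚ
open import Data.List.Relation.Unary.All as All using (All; []; _∷_)
import Data.List.Relation.Unary.All.Properties as Allₚ
open import Data.List.Relation.Unary.AllPairs using (AllPairs; []; _∷_)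
import Data.List.Relation.Unary.AllPairs.Properties as AllPairsₚ
open import Data.List.Relation.Unary.Any as Any using (Any; here; there; any?)
import Data.List.Relation.Unary.Any.Properties as Anyₚ
open import Data.Maybe using (just; nothing)
open import Data.Nat as ℕ using (ℕ; zero; suc; _^_; _%_; _<_; _≤_; z≤n; s≤s; _∸_)
open import Data.Nat.Coprimality using (coprime-Bézout)
open import Data.Nat.Divisibility using (_∣_; _∣?_; divides; ∣⇒≤; ∣1⇒≡1; m∣m*n)
open import Data.Nat.DivMod using (m≡m%n+[m/n]*n; m/n*n≡m)
open import Data.Nat.GCD using (module Bézout)
open import Data.Nat.Primality using (Prime; prime⇒irreducible; euclidsLemma; prime⇒nonTrivial)
import Data.Nat.Properties as ℕₚ
open import Data.Product using (Σ; ∃; _,_; _×_; proj₁; proj₂)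
open import Data.Sum using (_⊎_; inj₁; inj₂)
open import Data.Vec as Vec using (Vec; []; _∷_)
open import Relation.Binary.Definitions using (WeaklyDecidable)
open import Relation.Binary.PropositionalEquality as ≡ using (_≡_; _≢_; module ≡-Reasoning)
open import Relation.Nullary using (¬_; ¬?; Dec; yes; no; does; _×-dec_)

-- Ring solver with integer coefficients

-- Integer coefficients let the solver handle numerals and cancellation in an
-- arbitrary commutative ring.
module IntegerSolver (R : CommutativeRing 0ℓ 0ℓ) where
  open CommutativeRing R
  open import Data.Integer using (_⊖_)
  open import Algebra.Properties.Ring ring
    using (-‿distribˡ-*; -‿involutive; -0#≈0#)
  open import Algebra.Properties.AbelianGroup +-abelianGroup using (⁻¹-∙-comm)
  open import Algebra.Properties.CommutativeSemigroup +-commutativeSemigroup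
    using (interchange)
  open import Relation.Binary.Reasoning.Setoid setoid

  natR-+ : ∀ m n → natR R (m ℕ.+ n) ≈ natR R m + natR R n
  natR-+ zero    n = sym (+-identityˡ _)
  natR-+ (suc m) n = trans (+-congˡ (natR-+ m n)) (sym (+-assoc _ _ _))

  natR-* : ∀ m n → natR R (m ℕ.* n) ≈ natR R m * natR R n
  natR-* zero    n = sym (zeroˡ _)
  natR-* (suc m) n = begin
    natR R (n ℕ.+ m ℕ.* n)                   ≈⟨ natR-+ n _ ⟩
    natR R n + natR R (m ℕ.* n)              ≈⟨ +-cong (sym (*-identityˡ _)) (natR-* m n) ⟩
    1# * natR R n + natR R m * natR R n      ≈⟨ sym (distribʳ _ _ _) ⟩
    (1# + natR R m) * natR R n               ∎

  -- ⟦ + 1 ⟧ is 1# itself and not 1# + 0#, so that 1# can be written con (+ 1).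
  ⟦_⟧ℤ : ℤ → Carrier
  ⟦ + 1 ⟧ℤ        = 1#
  ⟦ + n ⟧ℤ        = natR R n
  ⟦ -[1+ 0 ] ⟧ℤ   = - 1#
  ⟦ -[1+ n ] ⟧ℤ   = - natR R (suc n)

  ⟦+⟧ : ∀ n → ⟦ + n ⟧ℤ ≈ natR R n
  ⟦+⟧ 0             = refl
  ⟦+⟧ 1             = sym (+-identityʳ _)
  ⟦+⟧ (suc (suc n)) = refl

  ⟦-⟧ : ∀ n → ⟦ -[1+ n ] ⟧ℤ ≈ - natR R (suc n)
  ⟦-⟧ 0       = -‿cong (sym (+-identityʳ _))
  ⟦-⟧ (suc n) = refl

  ⟦neg⟧ : ∀ i → ⟦ ℤ.- i ⟧ℤ ≈ - ⟦ i ⟧ℤ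
  ⟦neg⟧ (+ 0)            = sym -0#≈0#
  ⟦neg⟧ (+ 1)            = refl
  ⟦neg⟧ (+ suc (suc n))  = refl
  ⟦neg⟧ -[1+ 0 ]         = sym (-‿involutive _)
  ⟦neg⟧ -[1+ suc n ]     = sym (-‿involutive _)

  ⟦⊖⟧ : ∀ m n → ⟦ m ⊖ n ⟧ℤ ≈ natR R m - natR R n
  ⟦⊖⟧ m zero = trans (⟦+⟧ m) (trans (sym (+-identityʳ _)) (+-congˡ (sym -0#≈0#)))
  ⟦⊖⟧ zero (suc n) = trans (⟦-⟧ n) (sym (+-identityˡ _))
  ⟦⊖⟧ (suc m) (suc n) rewrite ℤₚ.[1+m]⊖[1+n]≡m⊖n m n = begin
    ⟦ m ⊖ n ⟧ℤ                                   ≈⟨ ⟦⊖⟧ m n ⟩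
    natR R m - natR R n                          ≈⟨ sym (+-identityˡ _) ⟩
    0# + (natR R m - natR R n)                   ≈⟨ +-congʳ (sym (-‿inverseʳ 1#)) ⟩
    (1# - 1#) + (natR R m - natR R n)            ≈⟨ interchange _ _ _ _ ⟩
    (1# + natR R m) + (- 1# - natR R n)          ≈⟨ +-congˡ (⁻¹-∙-comm _ _) ⟩
    (1# + natR R m) - (1# + natR R n)            ∎

  ⟦+⟧-homo : ∀ i j → ⟦ i ℤ.+ j ⟧ℤ ≈ ⟦ i ⟧ℤ + ⟦ j ⟧ℤ
  ⟦+⟧-homo (+ m) (+ n) =
    trans (⟦+⟧ (m ℕ.+ n)) (trans (natR-+ m n) (+-cong (sym (⟦+⟧ m)) (sym (⟦+⟧ n))))
  ⟦+⟧-homo (+ m) -[1+ n ] =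
    trans (⟦⊖⟧ m (suc n)) (+-cong (sym (⟦+⟧ m)) (sym (⟦-⟧ n)))
  ⟦+⟧-homo -[1+ m ] (+ n) =
    trans (⟦⊖⟧ n (suc m)) (trans (+-comm _ _) (+-cong (sym (⟦-⟧ m)) (sym (⟦+⟧ n))))
  ⟦+⟧-homo -[1+ m ] -[1+ n ] = begin
    - natR R (suc (suc (m ℕ.+ n)))          ≡⟨ ≡.cong (λ k → - natR R (suc k)) (≡.sym (ℕₚ.+-suc m n)) ⟩
    - natR R (suc m ℕ.+ suc n)              ≈⟨ -‿cong (natR-+ (suc m) (suc n)) ⟩
    - (natR R (suc m) + natR R (suc n))     ≈⟨ sym (⁻¹-∙-comm _ _) ⟩
    - natR R (suc m) - natR R (suc n)       ≈⟨ +-cong (sym (⟦-⟧ m)) (sym (⟦-⟧ n)) ⟩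
    ⟦ -[1+ m ] ⟧ℤ + ⟦ -[1+ n ] ⟧ℤ           ∎

  ⟦*⟧-nat : ∀ m j → ⟦ (+ m) ℤ.* j ⟧ℤ ≈ natR R m * ⟦ j ⟧ℤ
  ⟦*⟧-nat zero    j rewrite ℤₚ.*-zeroˡ j = sym (zeroˡ _)
  ⟦*⟧-nat (suc m) j = begin
    ⟦ (+ suc m) ℤ.* j ⟧ℤ                 ≡⟨ ≡.cong ⟦_⟧ℤ (ℤₚ.suc-* (+ m) j) ⟩
    ⟦ j ℤ.+ (+ m) ℤ.* j ⟧ℤ               ≈⟨ ⟦+⟧-homo j _ ⟩
    ⟦ j ⟧ℤ + ⟦ (+ m) ℤ.* j ⟧ℤ            ≈⟨ +-cong (sym (*-identityˡ _)) (⟦*⟧-nat m j) ⟩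
    1# * ⟦ j ⟧ℤ + natR R m * ⟦ j ⟧ℤ      ≈⟨ sym (distribʳ _ _ _) ⟩
    (1# + natR R m) * ⟦ j ⟧ℤ             ∎

  ⟦*⟧-homo : ∀ i j → ⟦ i ℤ.* j ⟧ℤ ≈ ⟦ i ⟧ℤ * ⟦ j ⟧ℤ
  ⟦*⟧-homo (+ m) j = trans (⟦*⟧-nat m j) (*-congʳ (sym (⟦+⟧ m)))
  ⟦*⟧-homo -[1+ m ] j = begin
    ⟦ -[1+ m ] ℤ.* j ⟧ℤ             ≡⟨ ≡.cong ⟦_⟧ℤ (≡.sym (ℤₚ.neg-distribˡ-* (+ suc m) j)) ⟩
    ⟦ ℤ.- ((+ suc m) ℤ.* j) ⟧ℤ      ≈⟨ ⟦neg⟧ ((+ suc m) ℤ.* j) ⟩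
    - ⟦ (+ suc m) ℤ.* j ⟧ℤ          ≈⟨ -‿cong (⟦*⟧-nat (suc m) j) ⟩
    - (natR R (suc m) * ⟦ j ⟧ℤ)     ≈⟨ -‿distribˡ-* _ _ ⟩
    - natR R (suc m) * ⟦ j ⟧ℤ       ≈⟨ *-congʳ (sym (⟦-⟧ m)) ⟩
    ⟦ -[1+ m ] ⟧ℤ * ⟦ j ⟧ℤ          ∎

  private
    ℤ-raw : RawRing 0ℓ 0ℓ
    ℤ-raw = record { Carrier = ℤ ; _≈_ = ≡._≡_ ; _+_ = ℤ._+_ ; _*_ = ℤ._*_
                   ; -_ = ℤ.-_ ; 0# = + 0 ; 1# = + 1 }

    morphism : ℤ-raw -Raw-AlmostCommutative⟶ fromCommutativeRing R
    morphism = record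
      { ⟦_⟧ = ⟦_⟧ℤ ; +-homo = ⟦+⟧-homo ; *-homo = ⟦*⟧-homo
      ; -‿homo = ⟦neg⟧ ; 0-homo = refl ; 1-homo = refl }

    _coeff≟_ : WeaklyDecidable (Induced-equivalence morphism)
    i coeff≟ j with i ℤ.≟ j
    ... | yes ≡.refl = just refl
    ... | no _       = nothing

  open import Algebra.Solver.Ring ℤ-raw (fromCommutativeRing R) morphism _coeff≟_ public
    using (solve; _:=_; con; _:+_; _:*_; _:-_; :-_)

-- Finite sums over the field with values in a commutative monoid

module FiniteSums (𝔽 : FiniteField) (M : CommutativeMonoid 0ℓ 0ℓ) where
  open FiniteField 𝔽
  open CommutativeMonoid M
  open import Algebra.Properties.CommutativeSemigroup commutativeSemigroup using (interchange)

  private F = CarrierF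

  -- Stated for a monoid because the sums in F and K and the product behind `fermat` all use it; in
  -- the additive monoid of K it unfolds to `sumF`.
  ⨁L : List F → (F → Carrier) → Carrier
  ⨁L l f = foldr (λ a s → f a ∙ s) ε l

  ⨁ : (F → Carrier) → Carrier
  ⨁ = ⨁L elements

  ⨁L-cong : ∀ l {f g} → (∀ x → f x ≈ g x) → ⨁L l f ≈ ⨁L l g
  ⨁L-cong []      e = refl
  ⨁L-cong (a ∷ l) e = ∙-cong (e a) (⨁L-cong l e)

  ⨁-cong : ∀ {f g} → (∀ x → f x ≈ g x) → ⨁ f ≈ ⨁ g
  ⨁-cong = ⨁L-cong elements

  ⨁L-ε : ∀ l → ⨁L l (λ _ → ε) ≈ ε
  ⨁L-ε []      = refl
  ⨁L-ε (a ∷ l) = trans (identityˡ _) (⨁L-ε l)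

  ⨁L-∙ : ∀ l f g → ⨁L l (λ x → f x ∙ g x) ≈ ⨁L l f ∙ ⨁L l g
  ⨁L-∙ []      f g = sym (identityˡ _)
  ⨁L-∙ (a ∷ l) f g = trans (∙-congˡ (⨁L-∙ l f g)) (interchange _ _ _ _)

  ⨁-∙ : ∀ f g → ⨁ (λ x → f x ∙ g x) ≈ ⨁ f ∙ ⨁ g
  ⨁-∙ = ⨁L-∙ elements

  ⨁L-swap : ∀ l m (f : F → F → Carrier) →
            ⨁L l (λ x → ⨁L m (f x)) ≈ ⨁L m (λ y → ⨁L l (λ x → f x y))
  ⨁L-swap []      m f = sym (⨁L-ε m)
  ⨁L-swap (a ∷ l) m f = trans (∙-congˡ (⨁L-swap l m f)) (sym (⨁L-∙ m _ _))

  ⨁-swap : ∀ (f : F → F → Carrier) → ⨁ (λ x → ⨁ (f x)) ≈ ⨁ (λ y → ⨁ (λ x → f x y))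
  ⨁-swap = ⨁L-swap elements elements

  ⨁L-outside : ∀ l {a} f → (∀ x → x ≢ a → f x ≈ ε) → All (a ≢_) l → ⨁L l f ≈ ε
  ⨁L-outside []      f z []       = refl
  ⨁L-outside (b ∷ l) f z (n ∷ ns) =
    trans (∙-cong (z b (λ e → n (≡.sym e))) (⨁L-outside l f z ns)) (identityˡ _)

  ⨁L-single : ∀ l a f → (∀ x → x ≢ a → f x ≈ ε) →
              Any (a ≡_) l → AllPairs _≢_ l → ⨁L l f ≈ f a
  ⨁L-single (b ∷ l) a f z (here ≡.refl) (n ∷ d) =
    trans (∙-congˡ (⨁L-outside l f z n)) (identityʳ _)
  ⨁L-single (b ∷ l) a f z (there p) (n ∷ d) =
    trans (∙-cong (z b b≢a) (⨁L-single l a f z p d)) (identityˡ _)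
    where
    b≢a : b ≢ a
    b≢a ≡.refl with All.lookupAny n p
    ... | b≢b , b≡b = b≢b b≡b

  ⨁-single : ∀ a f → (∀ x → x ≢ a → f x ≈ ε) → ⨁ f ≈ f a
  ⨁-single a f z = ⨁L-single elements a f z (complete a) distinct

  ⨁-split : ∀ a f → ⨁ f ≈ f a ∙ ⨁ (λ x → if does (x ≟F a) then ε else f x)
  ⨁-split a f = trans (⨁-cong pointwise)
                (trans (⨁-∙ at off) (∙-congʳ (trans (⨁-single a at at-off) at-on)))
    where
    at off : F → Carrier
    at  x = if does (x ≟F a) then f x else ε
    off x = if does (x ≟F a) then ε else f x
    pointwise : ∀ x → f x ≈ at x ∙ off x
    pointwise x with x ≟F a
    ... | yes _ = sym (identityʳ _)
    ... | no _  = sym (identityˡ _)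
    at-off : ∀ x → x ≢ a → at x ≈ ε
    at-off x x≢a with x ≟F a
    ... | yes e = ⊥-elim (x≢a e)
    ... | no _  = refl
    at-on : at a ≈ f a
    at-on with a ≟F a
    ... | yes _ = refl
    ... | no n  = ⊥-elim (n ≡.refl)

  ⨁-fibre : ∀ (π : F → F) (f : F → F → Carrier) →
            ⨁ (λ x → f x (π x)) ≈ ⨁ (λ y → ⨁ (λ x → if does (π x ≟F y) then f x y else ε))
  ⨁-fibre π f = trans (⨁-cong λ x → sym (pick x)) (⨁-swap _)
    where
    pick : ∀ x → ⨁ (λ y → if does (π x ≟F y) then f x y else ε) ≈ f x (π x)
    pick x = trans (⨁-single (π x) _ off) on
      where
      off : ∀ y → y ≢ π x → (if does (π x ≟F y) then f x y else ε) ≈ ε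
      off y n with π x ≟F y
      ... | yes e = ⊥-elim (n (≡.sym e))
      ... | no _  = refl
      on : (if does (π x ≟F π x) then f x (π x) else ε) ≈ f x (π x)
      on with π x ≟F π x
      ... | yes _ = refl
      ... | no n  = ⊥-elim (n ≡.refl)

  -- Sorted by the value of σ, every fibre is the single point `τ y`.
  ⨁-reindex : ∀ (σ τ : F → F) → (∀ x → τ (σ x) ≡ x) → (∀ y → σ (τ y) ≡ y) →
              ∀ f → ⨁ (λ x → f (σ x)) ≈ ⨁ f
  ⨁-reindex σ τ τσ στ f = trans (⨁-fibre σ (λ _ y → f y)) (⨁-cong count)
    where
    count : ∀ y → ⨁ (λ x → if does (σ x ≟F y) then f y else ε) ≈ f y
    count y = trans (⨁-single (τ y) _ off) on
      where
      off : ∀ x → x ≢ τ y → (if does (σ x ≟F y) then f y else ε) ≈ ε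
      off x n with σ x ≟F y
      ... | yes e = ⊥-elim (n (≡.trans (≡.sym (τσ x)) (≡.cong τ e)))
      ... | no _  = refl
      on : (if does (σ (τ y) ≟F y) then f y else ε) ≈ f y
      on with σ (τ y) ≟F y
      ... | yes _ = refl
      ... | no n  = ⊥-elim (n (στ y))

-- Arithmetic of the finite field

module FieldFacts (𝔽 : FiniteField) (𝕂 : CoeffField) where
  open Ops 𝔽 𝕂
  open ≡-Reasoning

  ringF : CommutativeRing 0ℓ 0ℓ
  ringF = record { isCommutativeRing = isCommutativeRingF }

  module RF = CommutativeRing ringF
  open IntegerSolver ringF public using () renaming
    ( solve to solveF; _:=_ to _≋_; con to num; _:+_ to _⊕_; _:*_ to _⊗_
    ; _:-_ to _⊖_; :-_ to ⊝_; natR-+ to natR-+F; natR-* to natR-*F)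

  2F 3F 4F : F
  2F = natF 2
  3F = natF 3
  4F = natF 4

  *F-cancelˡ : ∀ {a x y} → a ≢ 0F → a *F x ≡ a *F y → x ≡ y
  *F-cancelˡ {a} {x} {y} a≢0 e = begin
    x                      ≡⟨ ≡.sym (unit x) ⟩
    invF a *F (a *F x)     ≡⟨ ≡.cong (invF a *F_) e ⟩
    invF a *F (a *F y)     ≡⟨ unit y ⟩
    y                      ∎
    where
    unit : ∀ z → invF a *F (a *F z) ≡ z
    unit z = begin
      invF a *F (a *F z)   ≡⟨ solveF 3 (λ i a z → i ⊗ (a ⊗ z) ≋ (a ⊗ i) ⊗ z) ≡.refl (invF a) a z ⟩
      (a *F invF a) *F z   ≡⟨ ≡.cong (_*F z) (invF-inverse a a≢0) ⟩
      1F *F z              ≡⟨ RF.*-identityˡ z ⟩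
      z                    ∎

  zero-factor : ∀ {a b} → a ≢ 0F → a *F b ≡ 0F → b ≡ 0F
  zero-factor {a} a≢0 e = *F-cancelˡ a≢0 (≡.trans e (≡.sym (RF.zeroʳ a)))

  integral : ∀ {a b} → a *F b ≡ 0F → a ≡ 0F ⊎ b ≡ 0F
  integral {a} {b} e with a ≟F 0F
  ... | yes a≡0 = inj₁ a≡0
  ... | no a≢0  = inj₂ (zero-factor a≢0 e)

  *F≢0 : ∀ {a b} → a ≢ 0F → b ≢ 0F → a *F b ≢ 0F
  *F≢0 a≢0 b≢0 e with integral e
  ... | inj₁ a≡0 = a≢0 a≡0
  ... | inj₂ b≡0 = b≢0 b≡0

  square≡0 : ∀ {a} → a *F a ≡ 0F → a ≡ 0F
  square≡0 e with integral e
  ... | inj₁ z = z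
  ... | inj₂ z = z

  invF≢0 : ∀ {a} → a ≢ 0F → invF a ≢ 0F
  invF≢0 {a} a≢0 e = 0≢1F (≡.trans (≡.sym (RF.zeroʳ a))
    (≡.trans (≡.cong (a *F_) (≡.sym e)) (invF-inverse a a≢0)))

  invF-inverseˡ : ∀ x → x ≢ 0F → invF x *F x ≡ 1F
  invF-inverseˡ x n = ≡.trans (RF.*-comm _ _) (invF-inverse x n)

  invF-unique : ∀ {a b} → a *F b ≡ 1F → invF a ≡ b
  invF-unique {a} {b} e = *F-cancelˡ a≢0 (≡.trans (invF-inverse a a≢0) (≡.sym e))
    where
    a≢0 : a ≢ 0F
    a≢0 ≡.refl = 0≢1F (≡.trans (≡.sym (RF.zeroˡ b)) e)

  invF-involutive : ∀ a → invF (invF a) ≡ a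
  invF-involutive a with a ≟F 0F
  ... | yes ≡.refl = ≡.trans (≡.cong invF invF-zero) invF-zero
  ... | no n       = invF-unique (invF-inverseˡ a n)

  invF-1 : invF 1F ≡ 1F
  invF-1 = invF-unique (RF.*-identityˡ 1F)

  invF-* : ∀ a b → invF (a *F b) ≡ invF a *F invF b
  invF-* a b with a ≟F 0F | b ≟F 0F
  ... | yes ≡.refl | _ = begin
    invF (0F *F b)       ≡⟨ ≡.cong invF (RF.zeroˡ b) ⟩
    invF 0F              ≡⟨ invF-zero ⟩
    0F                   ≡⟨ ≡.sym (RF.zeroˡ _) ⟩
    0F *F invF b         ≡⟨ ≡.cong (_*F invF b) (≡.sym invF-zero) ⟩
    invF 0F *F invF b    ∎
  ... | no _ | yes ≡.refl = begin
    invF (a *F 0F)       ≡⟨ ≡.cong invF (RF.zeroʳ a) ⟩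
    invF 0F              ≡⟨ invF-zero ⟩
    0F                   ≡⟨ ≡.sym (RF.zeroʳ _) ⟩
    invF a *F 0F         ≡⟨ ≡.cong (invF a *F_) (≡.sym invF-zero) ⟩
    invF a *F invF 0F    ∎
  ... | no a≢0 | no b≢0 = invF-unique (begin
    (a *F b) *F (invF a *F invF b)
      ≡⟨ solveF 4 (λ a b i j → (a ⊗ b) ⊗ (i ⊗ j) ≋ (a ⊗ i) ⊗ (b ⊗ j)) ≡.refl a b (invF a) (invF b) ⟩
    (a *F invF a) *F (b *F invF b)
      ≡⟨ ≡.cong₂ _*F_ (invF-inverse a a≢0) (invF-inverse b b≢0) ⟩
    1F *F 1F  ≡⟨ RF.*-identityˡ 1F ⟩
    1F        ∎)

  sub≡0 : ∀ {a b} → a -F b ≡ 0F → a ≡ b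
  sub≡0 {a} {b} e = begin
    a                ≡⟨ solveF 2 (λ a b → a ≋ (a ⊖ b) ⊕ b) ≡.refl a b ⟩
    (a -F b) +F b    ≡⟨ ≡.cong (_+F b) e ⟩
    0F +F b          ≡⟨ RF.+-identityˡ b ⟩
    b                ∎

  -- The ring solver knows no hypotheses. A goal that holds only because of `u ≡ v` is reduced to
  -- the polynomial identity X = Y + (u - v)Z with an explicit cofactor `Z`; nested uses handle
  -- several hypotheses at once, typically the equations of inverses.
  modulo : ∀ {X Y u v} Z → u ≡ v → X ≡ Y +F (u -F v) *F Z → X ≡ Y
  modulo {X} {Y} {u} Z ≡.refl e = ≡.trans e
    (solveF 3 (λ Y u Z → Y ⊕ (u ⊖ u) ⊗ Z ≋ Y) ≡.refl Y u Z)

  natF≡natR : ∀ n → natF n ≡ natR ringF n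
  natF≡natR zero    = ≡.refl
  natF≡natR (suc n) = ≡.cong (1F +F_) (natF≡natR n)

  natF-+ : ∀ m n → natF (m ℕ.+ n) ≡ natF m +F natF n
  natF-+ m n rewrite natF≡natR (m ℕ.+ n) | natF≡natR m | natF≡natR n = natR-+F m n

  natF-* : ∀ m n → natF (m ℕ.* n) ≡ natF m *F natF n
  natF-* m n rewrite natF≡natR (m ℕ.* n) | natF≡natR m | natF≡natR n = natR-*F m n

  powF-+ : ∀ x m n → powF x (m ℕ.+ n) ≡ powF x m *F powF x n
  powF-+ x zero    n = ≡.sym (RF.*-identityˡ _)
  powF-+ x (suc m) n = ≡.trans (≡.cong (x *F_) (powF-+ x m n)) (≡.sym (RF.*-assoc _ _ _))

  powF-* : ∀ x m n → powF x (m ℕ.* n) ≡ powF (powF x n) m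
  powF-* x zero    n = ≡.refl
  powF-* x (suc m) n = ≡.trans (powF-+ x n (m ℕ.* n)) (≡.cong (powF x n *F_) (powF-* x m n))

  powF-mul : ∀ x y n → powF (x *F y) n ≡ powF x n *F powF y n
  powF-mul x y zero    = ≡.sym (RF.*-identityˡ _)
  powF-mul x y (suc n) = ≡.trans (≡.cong ((x *F y) *F_) (powF-mul x y n))
    (solveF 4 (λ x y u v → (x ⊗ y) ⊗ (u ⊗ v) ≋ (x ⊗ u) ⊗ (y ⊗ v)) ≡.refl x y _ _)

  powF-1 : ∀ n → powF 1F n ≡ 1F
  powF-1 zero    = ≡.refl
  powF-1 (suc n) = ≡.trans (RF.*-identityˡ _) (powF-1 n)

  powF-natF : ∀ m r → natF (m ^ r) ≡ powF (natF m) r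
  powF-natF m zero    = RF.+-identityʳ 1F
  powF-natF m (suc r) = ≡.trans (natF-* m (m ^ r)) (≡.cong (natF m *F_) (powF-natF m r))

  powF≡0 : ∀ x n → powF x n ≡ 0F → x ≡ 0F
  powF≡0 x zero    e = ⊥-elim (0≢1F (≡.sym e))
  powF≡0 x (suc n) e with integral e
  ... | inj₁ z = z
  ... | inj₂ z = powF≡0 x n z

  private
    module Add = FiniteSums 𝔽 RF.+-commutativeMonoid
    module Mul = FiniteSums 𝔽 RF.*-commutativeMonoid

  -- Translation by 1 permutes F, so the sum of all x equals the sum of all x + 1, which exceeds it
  -- by q times 1.
  natF-order : natF order ≡ 0F
  natF-order = begin
    natF order                 ≡⟨ ≡.sym (sum-1 elements) ⟩
    Add.⨁ (λ _ → 1F)           ≡⟨ solveF 2 (λ s t → s ≋ (t ⊕ s) ⊖ t) ≡.refl _ (Add.⨁ (λ x → x)) ⟩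
    (Add.⨁ (λ x → x) +F Add.⨁ (λ _ → 1F)) -F Add.⨁ (λ x → x)
      ≡⟨ ≡.cong (_-F Add.⨁ (λ x → x)) (≡.sym (Add.⨁-∙ (λ x → x) (λ _ → 1F))) ⟩
    Add.⨁ (λ x → x +F 1F) -F Add.⨁ (λ x → x)
      ≡⟨ ≡.cong (_-F Add.⨁ (λ x → x)) (Add.⨁-reindex (_+F 1F) (_-F 1F)
           (λ x → solveF 1 (λ x → (x ⊕ num (+ 1)) ⊖ num (+ 1) ≋ x) ≡.refl x)
           (λ x → solveF 1 (λ x → (x ⊖ num (+ 1)) ⊕ num (+ 1) ≋ x) ≡.refl x) (λ x → x)) ⟩
    Add.⨁ (λ x → x) -F Add.⨁ (λ x → x)
      ≡⟨ RF.-‿inverseʳ _ ⟩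
    0F ∎
    where
    sum-1 : ∀ l → Add.⨁L l (λ _ → 1F) ≡ natF (length l)
    sum-1 []      = ≡.refl
    sum-1 (x ∷ l) = ≡.cong (1F +F_) (sum-1 l)

  -- If a divisor of 6 vanished in F, then q = 1 + 6k would be 1 in F, although q is 0 there. This
  -- supplies 2 ≠ 0 and 3 ≠ 0.
  numeral≢0 : ∀ d m → d ℕ.* m ≡ 6 → order % 6 ≡ 1 → natF d ≢ 0F
  numeral≢0 d m dm q≡1 d≡0 = 0≢1F (begin
    0F                                           ≡⟨ ≡.sym natF-order ⟩
    natF order                                   ≡⟨ ≡.cong natF (m≡m%n+[m/n]*n order 6) ⟩
    natF (order % 6 ℕ.+ (order ℕ./ 6) ℕ.* 6)     ≡⟨ natF-+ (order % 6) _ ⟩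
    natF (order % 6) +F natF ((order ℕ./ 6) ℕ.* 6)
      ≡⟨ ≡.cong₂ _+F_ (≡.cong natF q≡1) multiple ⟩
    (1F +F 0F) +F 0F                             ≡⟨ solveF 0 ((num (+ 1) ⊕ num (+ 0)) ⊕ num (+ 0) ≋ num (+ 1)) ≡.refl ⟩
    1F                                           ∎)
    where
    multiple : natF ((order ℕ./ 6) ℕ.* 6) ≡ 0F
    multiple = begin
      natF ((order ℕ./ 6) ℕ.* 6)                  ≡⟨ natF-* (order ℕ./ 6) 6 ⟩
      natF (order ℕ./ 6) *F natF 6                ≡⟨ ≡.cong (λ k → natF (order ℕ./ 6) *F natF k) (≡.sym dm) ⟩
      natF (order ℕ./ 6) *F natF (d ℕ.* m)        ≡⟨ ≡.cong (natF (order ℕ./ 6) *F_) (natF-* d m) ⟩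
      natF (order ℕ./ 6) *F (natF d *F natF m)    ≡⟨ ≡.cong (λ z → natF (order ℕ./ 6) *F (z *F natF m)) d≡0 ⟩
      natF (order ℕ./ 6) *F (0F *F natF m)
        ≡⟨ solveF 2 (λ a b → a ⊗ (num (+ 0) ⊗ b) ≋ num (+ 0)) ≡.refl _ _ ⟩
      0F                                          ∎

  order≢0 : order ≢ 0
  order≢0 e with elements | complete 0F
  order≢0 () | _ ∷ _ | _

  -- Multiplication by a nonzero x permutes the nonzero elements, so the factors at nonzero
  -- positions multiply to 1; the remaining x sits at the position of 0.
  fermat : ∀ x → powF x order ≡ x
  fermat x with x ≟F 0F
  ... | yes ≡.refl with order | order≢0
  ...   | zero  | n = ⊥-elim (n ≡.refl)
  ...   | suc k | _ = RF.zeroˡ _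
  fermat x | no x≢0 = begin
    powF x order                           ≡⟨ ≡.sym (prod-const elements) ⟩
    Mul.⨁ (λ _ → x)                        ≡⟨ Mul.⨁-cong pointwise ⟩
    Mul.⨁ (λ y → k y *F m y)               ≡⟨ Mul.⨁-∙ k m ⟩
    Mul.⨁ k *F Mul.⨁ m                     ≡⟨ ≡.cong₂ _*F_ prod-k (≡.trans (Mul.⨁-single 0F m m-off) m-on) ⟩
    1F *F x                                ≡⟨ RF.*-identityˡ x ⟩
    x                                      ∎
    where
    -- `h` replaces 0 by 1, so its product is that of the nonzero elements and can be cancelled; `k`
    -- and `m` split the constant x into its parts off 0 and at 0.
    h k m : F → F
    h y = if does (y ≟F 0F) then 1F else y
    k y = if does (y ≟F 0F) then 1F else x
    m y = if does (y ≟F 0F) then x else 1F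
    prod-const : ∀ l → Mul.⨁L l (λ _ → x) ≡ powF x (length l)
    prod-const []      = ≡.refl
    prod-const (a ∷ l) = ≡.cong (x *F_) (prod-const l)
    pointwise : ∀ y → x ≡ k y *F m y
    pointwise y with y ≟F 0F
    ... | yes _ = ≡.sym (RF.*-identityˡ x)
    ... | no _  = ≡.sym (RF.*-identityʳ x)
    m-off : ∀ y → y ≢ 0F → m y ≡ 1F
    m-off y n with y ≟F 0F
    ... | yes e = ⊥-elim (n e)
    ... | no _  = ≡.refl
    m-on : m 0F ≡ x
    m-on with 0F ≟F 0F
    ... | yes _ = ≡.refl
    ... | no n  = ⊥-elim (n ≡.refl)
    h≢0 : ∀ y → h y ≢ 0F
    h≢0 y with y ≟F 0F
    ... | yes _ = λ e → 0≢1F (≡.sym e)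
    ... | no n  = n
    prod-h≢0 : ∀ l → Mul.⨁L l h ≢ 0F
    prod-h≢0 []      = λ e → 0≢1F (≡.sym e)
    prod-h≢0 (a ∷ l) = *F≢0 (h≢0 a) (prod-h≢0 l)
    h-scale : ∀ y → h (x *F y) ≡ k y *F h y
    h-scale y with y ≟F 0F | (x *F y) ≟F 0F
    ... | yes _      | yes _ = ≡.sym (RF.*-identityˡ 1F)
    ... | yes ≡.refl | no n  = ⊥-elim (n (RF.zeroʳ x))
    ... | no n       | yes e = ⊥-elim (*F≢0 x≢0 n e)
    ... | no _       | no _  = ≡.refl
    prod-k : Mul.⨁ k ≡ 1F
    prod-k = *F-cancelˡ (prod-h≢0 elements) (begin
      Mul.⨁ h *F Mul.⨁ k             ≡⟨ RF.*-comm _ _ ⟩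
      Mul.⨁ k *F Mul.⨁ h             ≡⟨ ≡.sym (Mul.⨁-∙ k h) ⟩
      Mul.⨁ (λ y → k y *F h y)       ≡⟨ Mul.⨁-cong (λ y → ≡.sym (h-scale y)) ⟩
      Mul.⨁ (λ y → h (x *F y))       ≡⟨ Mul.⨁-reindex (x *F_) (invF x *F_) left right h ⟩
      Mul.⨁ h                        ≡⟨ ≡.sym (RF.*-identityʳ _) ⟩
      Mul.⨁ h *F 1F                  ∎)
      where
      left : ∀ y → invF x *F (x *F y) ≡ y
      left y = ≡.trans (≡.sym (RF.*-assoc _ _ _))
        (≡.trans (≡.cong (_*F y) (invF-inverseˡ x x≢0)) (RF.*-identityˡ y))
      right : ∀ y → x *F (invF x *F y) ≡ y
      right y = ≡.trans (≡.sym (RF.*-assoc _ _ _))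
        (≡.trans (≡.cong (_*F y) (invF-inverse x x≢0)) (RF.*-identityˡ y))

-- Polynomials over the field and the bound on their roots

module Polynomials (𝔽 : FiniteField) (𝕂 : CoeffField) where
  open Ops 𝔽 𝕂
  open FieldFacts 𝔽 𝕂
  open ≡-Reasoning

  -- The value at x of the polynomial with coefficients cs, followed by
  -- the coefficient ℓ in degree n.
  eval : ∀ {n} → F → Vec F n → F → F
  eval ℓ []       x = ℓ
  eval ℓ (c ∷ cs) x = c +F x *F eval ℓ cs x

  -- Synthetic division by X - a: the coefficients of the quotient are the
  -- values at a of the tails.
  quotient : ∀ {n} → F → Vec F (suc n) → Vec F n
  quotient a (c ∷ [])       = []
  quotient a (c ∷ cs@(_ ∷ _)) = eval 1F cs a ∷ quotient a cs

  quotient-eval : ∀ {n} a (cs : Vec F (suc n)) x →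
    eval 1F cs x -F eval 1F cs a ≡ (x -F a) *F eval 1F (quotient a cs) x
  quotient-eval a (c ∷ []) x =
    solveF 3 (λ c x a → (c ⊕ x ⊗ num (+ 1)) ⊖ (c ⊕ a ⊗ num (+ 1)) ≋ (x ⊖ a) ⊗ num (+ 1)) ≡.refl c x a
  quotient-eval a (c ∷ cs@(_ ∷ _)) x = begin
    (c +F x *F e x) -F (c +F a *F e a)
      ≡⟨ solveF 5 (λ c x a u v → (c ⊕ x ⊗ u) ⊖ (c ⊕ a ⊗ v) ≋ (x ⊖ a) ⊗ v ⊕ x ⊗ (u ⊖ v)) ≡.refl c x a (e x) (e a) ⟩
    (x -F a) *F e a +F x *F (e x -F e a)
      ≡⟨ ≡.cong (λ z → (x -F a) *F e a +F x *F z) (quotient-eval a cs x) ⟩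
    (x -F a) *F e a +F x *F ((x -F a) *F g)
      ≡⟨ solveF 4 (λ x a v g → (x ⊖ a) ⊗ v ⊕ x ⊗ ((x ⊖ a) ⊗ g) ≋ (x ⊖ a) ⊗ (v ⊕ x ⊗ g)) ≡.refl x a (e a) g ⟩
    (x -F a) *F (e a +F x *F g) ∎
    where
    e = eval 1F cs
    g = eval 1F (quotient a cs) x

  -- Dividing by X - a leaves a monic polynomial, and every other root survives in the quotient
  -- because F has no zero divisors.
  root-bound : ∀ {n} (cs : Vec F n) l → AllPairs _≢_ l →
               All (λ a → eval 1F cs a ≡ 0F) l → length l ≤ n
  root-bound cs []      _       _        = z≤n
  root-bound [] (a ∷ l) _       (e ∷ _)  = ⊥-elim (0≢1F (≡.sym e))
  root-bound cs@(_ ∷ _) (a ∷ l) (n ∷ ns) (e ∷ es) =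
    s≤s (root-bound (quotient a cs) l ns (All.zipWith root (n , es)))
    where
    root : ∀ {b} → (a ≢ b) × (eval 1F cs b ≡ 0F) → eval 1F (quotient a cs) b ≡ 0F
    root {b} (a≢b , eb) with integral (≡.trans (≡.sym (quotient-eval a cs b))
      (≡.trans (≡.cong₂ _-F_ eb e) (RF.-‿inverseʳ 0F)))
    ... | inj₁ z = ⊥-elim (a≢b (≡.sym (sub≡0 z)))
    ... | inj₂ z = z

  -- Polynomial functions of degree below n. Adding x^n makes them monic, so roots can be counted
  -- without computing coefficients.
  Low : ℕ → (F → F) → Set
  Low n f = Σ (Vec F n) λ cs → ∀ x → f x ≡ eval 0F cs x

  eval-0 : ∀ n x → eval 0F (Vec.replicate n 0F) x ≡ 0F
  eval-0 zero    x = ≡.refl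
  eval-0 (suc n) x = ≡.trans (≡.cong (λ z → 0F +F x *F z) (eval-0 n x))
    (solveF 1 (λ x → num (+ 0) ⊕ x ⊗ num (+ 0) ≋ num (+ 0)) ≡.refl x)

  eval-1 : ∀ {n} (cs : Vec F n) x → eval 1F cs x ≡ eval 0F cs x +F powF x n
  eval-1 []       x = ≡.sym (RF.+-identityˡ 1F)
  eval-1 (c ∷ cs) x = ≡.trans (≡.cong (λ z → c +F x *F z) (eval-1 cs x))
    (solveF 4 (λ c x u v → c ⊕ x ⊗ (u ⊕ v) ≋ (c ⊕ x ⊗ u) ⊕ x ⊗ v) ≡.refl c x _ _)

  low-0 : ∀ n → Low n (λ _ → 0F)
  low-0 n = Vec.replicate n 0F , λ x → ≡.sym (eval-0 n x)

  low-+ : ∀ {n f g} → Low n f → Low n g → Low n (λ x → f x +F g x)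
  low-+ (cs , e) (ds , e′) = Vec.zipWith _+F_ cs ds , λ x →
    ≡.trans (≡.cong₂ _+F_ (e x) (e′ x)) (eval-+ cs ds x)
    where
    eval-+ : ∀ {n} (cs ds : Vec F n) x →
      eval 0F cs x +F eval 0F ds x ≡ eval 0F (Vec.zipWith _+F_ cs ds) x
    eval-+ []       []       x = RF.+-identityʳ 0F
    eval-+ (c ∷ cs) (d ∷ ds) x = ≡.trans
      (solveF 5 (λ c x u d v → (c ⊕ x ⊗ u) ⊕ (d ⊕ x ⊗ v) ≋ (c ⊕ d) ⊕ x ⊗ (u ⊕ v)) ≡.refl c x _ d _)
      (≡.cong (λ z → (c +F d) +F x *F z) (eval-+ cs ds x))

  low-monomial : ∀ c {m n} → m < n → Low n (λ x → c *F powF x m)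
  low-monomial c {zero} {suc n} _ = c ∷ Vec.replicate n 0F , λ x →
    ≡.trans (solveF 2 (λ c x → c ⊗ num (+ 1) ≋ c ⊕ x ⊗ num (+ 0)) ≡.refl c x)
            (≡.cong (λ z → c +F x *F z) (≡.sym (eval-0 n x)))
  low-monomial c {suc m} {suc n} (s≤s m<n) with low-monomial c m<n
  ... | cs , e = 0F ∷ cs , λ x →
    ≡.trans (solveF 3 (λ c x u → c ⊗ (x ⊗ u) ≋ num (+ 0) ⊕ x ⊗ (c ⊗ u)) ≡.refl c x _)
            (≡.cong (λ z → 0F +F x *F z) (e x))

  monic-root-bound : ∀ {n f} → Low n f → ∀ l → AllPairs _≢_ l →
    All (λ a → f a +F powF a n ≡ 0F) l → length l ≤ n
  monic-root-bound (cs , e) l d r = root-bound cs l d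
    (All.map (λ {a} z → ≡.trans (eval-1 cs a) (≡.trans (≡.cong (_+F _) (≡.sym (e a))) z)) r)

-- Characteristic p: Frobenius, prime field and trace

module CharacteristicP (𝔽 : FiniteField) (𝕂 : CoeffField) (p r : ℕ)
  (p-prime : Prime p) (order≡p^r : FiniteField.order 𝔽 ≡ p ^ r) where
  open Ops 𝔽 𝕂
  open FieldFacts 𝔽 𝕂
  open Polynomials 𝔽 𝕂
  open ≡-Reasoning
  open import Data.Nat using (_!)
  open ℕₚ using (_!*_!≢0)
  open import Data.Nat.Combinatorics using (_C_; nCk≡n!/k![n-k]!; k![n∸k]!∣n!; nCn≡1)

  p>1 : 1 < p
  p>1 = ℕ.nonTrivial⇒n>1 p {{prime⇒nonTrivial p-prime}}

  natF-p : natF p ≡ 0F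
  natF-p = powF≡0 (natF p) r (begin
    powF (natF p) r   ≡⟨ ≡.sym (powF-natF p r) ⟩
    natF (p ^ r)      ≡⟨ ≡.cong natF (≡.sym order≡p^r) ⟩
    natF order        ≡⟨ natF-order ⟩
    0F                ∎)

  natF-∣ : ∀ {n} → p ∣ n → natF n ≡ 0F
  natF-∣ (divides k ≡.refl) = ≡.trans (natF-* k p)
    (≡.trans (≡.cong (natF k *F_) natF-p) (RF.zeroʳ _))

  -- If p did not divide n, Bézout coefficients would turn p = n = 0 in F into 1 = 0.
  natF≡0⇒∣ : ∀ n → natF n ≡ 0F → p ∣ n
  natF≡0⇒∣ n n≡0 with p ∣? n
  ... | yes p∣n = p∣n
  ... | no p∤n  = ⊥-elim (absurd (coprime-Bézout coprime))
    where
    coprime : ∀ {d} → d ∣ p × d ∣ n → d ≡ 1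
    coprime (d∣p , d∣n) with prime⇒irreducible p-prime d∣p
    ... | inj₁ d≡1    = d≡1
    ... | inj₂ ≡.refl = ⊥-elim (p∤n d∣n)
    1≡0 : ∀ x y {a b} → natF a ≡ 0F → natF b ≡ 0F → 1 ℕ.+ y ℕ.* b ≡ x ℕ.* a → ⊥
    1≡0 x y {a} {b} a≡0 b≡0 e = 0≢1F (begin
      0F                        ≡⟨ ≡.sym (RF.zeroʳ (natF x)) ⟩
      natF x *F 0F              ≡⟨ ≡.cong (natF x *F_) (≡.sym a≡0) ⟩
      natF x *F natF a          ≡⟨ ≡.sym (natF-* x a) ⟩
      natF (x ℕ.* a)            ≡⟨ ≡.cong natF (≡.sym e) ⟩
      1F +F natF (y ℕ.* b)      ≡⟨ ≡.cong (1F +F_) (natF-* y b) ⟩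
      1F +F natF y *F natF b    ≡⟨ ≡.cong (λ z → 1F +F natF y *F z) b≡0 ⟩
      1F +F natF y *F 0F        ≡⟨ solveF 1 (λ y → num (+ 1) ⊕ y ⊗ num (+ 0) ≋ num (+ 1)) ≡.refl (natF y) ⟩
      1F                        ∎)
    absurd : Bézout.Identity 1 p n → ⊥
    absurd (Bézout.+- x y e) = 1≡0 x y natF-p n≡0 e
    absurd (Bézout.-+ x y e) = 1≡0 y x n≡0 natF-p e

  p∤m! : ∀ {m} → m < p → ¬ (p ∣ m !)
  p∤m! {zero}  m<p p∣1 = ℕₚ.<-irrefl (≡.sym (∣1⇒≡1 p∣1)) p>1
  p∤m! {suc m} m<p d with euclidsLemma (suc m) (m !) p-prime d
  ... | inj₁ p∣m+1 = ℕₚ.<⇒≱ m<p (∣⇒≤ p∣m+1)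
  ... | inj₂ p∣m!  = p∤m! (ℕₚ.<-trans (ℕₚ.n<1+n m) m<p) p∣m!

  -- p divides p! = (p C k) k! (p - k)! and, being a prime larger than k and p - k, neither
  -- factorial.
  p∣pCk : ∀ {k} → 0 < k → k < p → p ∣ p C k
  p∣pCk {k} 0<k k<p with euclidsLemma (p C k) (k ! ℕ.* (p ∸ k) !) p-prime p∣product
    where
    product≡p! : (p C k) ℕ.* (k ! ℕ.* (p ∸ k) !) ≡ p !
    product≡p! = ≡.trans
      (≡.cong (ℕ._* (k ! ℕ.* (p ∸ k) !)) (nCk≡n!/k![n-k]! (ℕₚ.<⇒≤ k<p)))
      (m/n*n≡m {{ k !* (p ∸ k) !≢0 }} (k![n∸k]!∣n! (ℕₚ.<⇒≤ k<p)))
    p∣p! : ∀ {m} → 1 < m → m ∣ m !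
    p∣p! {suc m} _ = m∣m*n (m !)
    p∣product : p ∣ (p C k) ℕ.* (k ! ℕ.* (p ∸ k) !)
    p∣product = ≡.subst (p ∣_) (≡.sym product≡p!) (p∣p! p>1)
  ... | inj₁ d = d
  ... | inj₂ d with euclidsLemma (k !) ((p ∸ k) !) p-prime d
  ...   | inj₁ d₁ = ⊥-elim (p∤m! k<p d₁)
  ...   | inj₂ d₂ = ⊥-elim (p∤m! (ℕₚ.∸-monoʳ-< 0<k (ℕₚ.<⇒≤ k<p)) d₂)

  frob : F → F
  frob x = powF x p

  private
    open import Algebra.Properties.CommutativeSemiring.Binomial RF.commutativeSemiring
      using (binomial; binomialTerm) renaming (theorem to binomial-theorem)
    open import Algebra.Properties.Semiring.Exp RF.semiring using () renaming (_^_ to _^F_)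
    open import Algebra.Properties.Semiring.Mult RF.semiring using () renaming (_×_ to _×F_)
    open import Algebra.Properties.Semiring.Sum RF.semiring using (sum; sum-init-last; sum-cong-≋; sum-replicate-zero)

    powF≡^ : ∀ x n → powF x n ≡ x ^F n
    powF≡^ x zero    = ≡.refl
    powF≡^ x (suc n) = ≡.cong (x *F_) (powF≡^ x n)

    ×≡natF : ∀ n x → n ×F x ≡ natF n *F x
    ×≡natF zero    x = ≡.sym (RF.zeroˡ x)
    ×≡natF (suc n) x = ≡.trans (≡.cong (x +F_) (×≡natF n x))
      (solveF 2 (λ n x → x ⊕ n ⊗ x ≋ (num (+ 1) ⊕ n) ⊗ x) ≡.refl (natF n) x)

    -- The binomial theorem with vanishing inner coefficients. The exponent is a successor so that
    -- the index type splits into first, inner and last.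
    ends : ∀ m x y → (∀ k → 0 < k → k < suc m → natF (suc m C k) ≡ 0F) →
           (x +F y) ^F suc m ≡ x ^F suc m +F y ^F suc m
    ends m x y middle = begin
      (x +F y) ^F suc m                    ≡⟨ binomial-theorem (suc m) x y ⟩
      t Fin.zero +F sum (λ i → t (Fin.suc i))      ≡⟨ ≡.cong (t Fin.zero +F_) (sum-init-last (λ i → t (Fin.suc i))) ⟩
      t Fin.zero +F (sum (λ i → t (Fin.suc (inject₁ i))) +F t (Fin.suc (fromℕ m)))
        ≡⟨ ≡.cong (λ z → t Fin.zero +F (z +F t (Fin.suc (fromℕ m))))
             (≡.trans (sum-cong-≋ vanish) (sum-replicate-zero m)) ⟩
      t Fin.zero +F (0F +F t (Fin.suc (fromℕ m)))  ≡⟨ ≡.cong₂ (λ u v → u +F (0F +F v)) first last ⟩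
      y ^F suc m +F (0F +F x ^F suc m)     ≡⟨ solveF 2 (λ u v → v ⊕ (num (+ 0) ⊕ u) ≋ u ⊕ v) ≡.refl _ _ ⟩
      x ^F suc m +F y ^F suc m             ∎
      where
      t : Fin (suc (suc m)) → F
      t = binomialTerm x y (suc m)
      vanish : ∀ i → t (Fin.suc (inject₁ i)) ≡ 0F
      vanish i = ≡.trans (×≡natF (suc m C suc (toℕ (inject₁ i))) _)
        (≡.trans (≡.cong (_*F binomial-part) (middle _ (s≤s z≤n)
          (s≤s (≡.subst (_< m) (≡.sym (Finₚ.toℕ-inject₁ i)) (Finₚ.toℕ<n i))))) (RF.zeroˡ _))
        where binomial-part = binomial x y (suc m) (Fin.suc (inject₁ i))
      first : t Fin.zero ≡ y ^F suc m
      first = solveF 1 (λ y → num (+ 1) ⊗ y ⊕ num (+ 0) ≋ y) ≡.refl (y ^F suc m)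
      last : t (Fin.suc (fromℕ m)) ≡ x ^F suc m
      last rewrite Finₚ.toℕ-fromℕ m | nCn≡1 (suc m) | ℕₚ.n∸n≡0 m =
        solveF 1 (λ x → x ⊗ num (+ 1) ⊕ num (+ 0) ≋ x) ≡.refl (x ^F suc m)

  frob-+ : ∀ x y → frob (x +F y) ≡ frob x +F frob y
  frob-+ x y = begin
    powF (x +F y) p        ≡⟨ powF≡^ _ p ⟩
    (x +F y) ^F p          ≡⟨ freshman p p>1 (λ k 0<k k<p → natF-∣ (p∣pCk 0<k k<p)) ⟩
    x ^F p +F y ^F p       ≡⟨ ≡.sym (≡.cong₂ _+F_ (powF≡^ x p) (powF≡^ y p)) ⟩
    powF x p +F powF y p   ∎
    where
    -- p is generalised to n so that it can be matched against a successor.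
    freshman : ∀ n → 1 < n → (∀ k → 0 < k → k < n → natF (n C k) ≡ 0F) →
               (x +F y) ^F n ≡ x ^F n +F y ^F n
    freshman (suc m) _ middle = ends m x y middle

  frob-0 : frob 0F ≡ 0F
  frob-0 = zero-pow p p>1
    where
    zero-pow : ∀ n → 1 < n → powF 0F n ≡ 0F
    zero-pow (suc n) _ = RF.zeroˡ _

  frob-1 : frob 1F ≡ 1F
  frob-1 = powF-1 p

  frob-* : ∀ x y → frob (x *F y) ≡ frob x *F frob y
  frob-* x y = powF-mul x y p

  frob-natF : ∀ n → frob (natF n) ≡ natF n
  frob-natF zero    = frob-0
  frob-natF (suc n) = ≡.trans (frob-+ 1F (natF n)) (≡.cong₂ _+F_ frob-1 (frob-natF n))

  frob-inv : ∀ x → x ≢ 0F → frob x ≡ x → frob (invF x) ≡ invF x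
  frob-inv x x≢0 e = ≡.sym (invF-unique (begin
    x *F frob (invF x)        ≡⟨ ≡.cong (_*F frob (invF x)) (≡.sym e) ⟩
    frob x *F frob (invF x)   ≡⟨ ≡.sym (frob-* x (invF x)) ⟩
    frob (x *F invF x)        ≡⟨ ≡.cong frob (invF-inverse x x≢0) ⟩
    frob 1F                   ≡⟨ frob-1 ⟩
    1F                        ∎))

  natF-injective : ∀ {i j} → i < j → j < p → natF i ≢ natF j
  natF-injective {i} {j} i<j j<p e = ℕₚ.<⇒≱ (ℕₚ.≤-<-trans (ℕₚ.m∸n≤m j i) j<p)
    (∣⇒≤ {{ℕ.>-nonZero (ℕₚ.m<n⇒0<n∸m i<j)}} (natF≡0⇒∣ (j ∸ i) (begin
      natF (j ∸ i)
        ≡⟨ solveF 2 (λ a b → a ≋ (a ⊕ b) ⊖ b) ≡.refl (natF (j ∸ i)) (natF i) ⟩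
      (natF (j ∸ i) +F natF i) -F natF i   ≡⟨ ≡.cong (_-F natF i) (≡.sym (natF-+ (j ∸ i) i)) ⟩
      natF (j ∸ i ℕ.+ i) -F natF i         ≡⟨ ≡.cong (λ k → natF k -F natF i) (ℕₚ.m∸n+n≡m (ℕₚ.<⇒≤ i<j)) ⟩
      natF j -F natF i                     ≡⟨ ≡.cong (_-F natF i) (≡.sym e) ⟩
      natF i -F natF i                     ≡⟨ RF.-‿inverseʳ _ ⟩
      0F                                   ∎)))

  -- The prime field is the set of roots of X^p - X: it already supplies p of them.
  frob-fixed : ∀ t → frob t ≡ t → Any (λ k → natF k ≡ t) (upTo p)
  frob-fixed t ft with any? (λ k → natF k ≟F t) (upTo p)
  ... | yes found = found
  ... | no absent = ⊥-elim (ℕₚ.<-irrefl ≡.refl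
    (≡.subst (λ n → suc n ≤ p) (Listₚ.length-applyUpTo natF p)
      (monic-root-bound (low-monomial (-F 1F) p>1) (t ∷ applyUpTo natF p)
        (new ∷ AllPairsₚ.applyUpTo⁺₁ natF p natF-injective)
        (root t ft ∷ Allₚ.applyUpTo⁺₂ natF p (λ k → root (natF k) (frob-natF k))))))
    where
    new : All (t ≢_) (applyUpTo natF p)
    new = Allₚ.applyUpTo⁺₁ natF p λ {k} k<p e → absent (Anyₚ.applyUpTo⁺ (λ k → k) (≡.sym e) k<p)
    root : ∀ a → frob a ≡ a → (-F 1F) *F powF a 1 +F powF a p ≡ 0F
    root a fa = ≡.trans (≡.cong (_ +F_) fa)
      (solveF 1 (λ a → num -[1+ 0 ] ⊗ (a ⊗ num (+ 1)) ⊕ a ≋ num (+ 0)) ≡.refl a)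

  frobs : ℕ → F → F
  frobs zero    x = x
  frobs (suc i) x = frobs i (frob x)

  powF-frobs : ∀ i x → powF x (p ^ i) ≡ frobs i x
  powF-frobs zero    x = RF.*-identityʳ x
  powF-frobs (suc i) x = begin
    powF x (p ℕ.* p ^ i)       ≡⟨ ≡.cong (powF x) (ℕₚ.*-comm p (p ^ i)) ⟩
    powF x (p ^ i ℕ.* p)       ≡⟨ powF-* x (p ^ i) p ⟩
    powF (powF x p) (p ^ i)    ≡⟨ powF-frobs i (frob x) ⟩
    frobs i (frob x)           ∎

  frobs-all : ∀ x → frobs r x ≡ x
  frobs-all x = ≡.trans (≡.sym (powF-frobs r x))
    (≡.trans (≡.cong (powF x) (≡.sym order≡p^r)) (fermat x))

  -- The trace as a recursion along Frobenius instead of a sum over the exponents p^i: additivity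
  -- and linearity over the prime field become inductions on n.
  tr : ℕ → F → F
  tr zero    x = 0F
  tr (suc n) x = x +F tr n (frob x)

  trace≡tr : ∀ x → trace p r x ≡ tr r x
  trace≡tr x = go 0 r (λ i → i) (λ _ → ≡.refl)
    where
    go : ∀ k n (g : ℕ → ℕ) → (∀ i → g i ≡ k ℕ.+ i) →
         foldr (λ i s → powF x (p ^ i) +F s) 0F (applyUpTo g n) ≡ tr n (frobs k x)
    go k zero    g eq = ≡.refl
    go k (suc n) g eq = ≡.cong₂ _+F_
      (≡.trans (≡.cong (λ i → powF x (p ^ i)) (≡.trans (eq 0) (ℕₚ.+-identityʳ k))) (powF-frobs k x))
      (≡.trans (go (suc k) n (λ i → g (suc i)) (λ i → ≡.trans (eq (suc i)) (ℕₚ.+-suc k i)))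
               (≡.cong (tr n) (frobs-frob k x)))
      where
      frobs-frob : ∀ k x → frobs k (frob x) ≡ frob (frobs k x)
      frobs-frob zero    x = ≡.refl
      frobs-frob (suc k) x = frobs-frob k (frob x)

  tr-+ : ∀ n x y → tr n (x +F y) ≡ tr n x +F tr n y
  tr-+ zero    x y = ≡.sym (RF.+-identityʳ 0F)
  tr-+ (suc n) x y = begin
    (x +F y) +F tr n (frob (x +F y))           ≡⟨ ≡.cong (λ z → (x +F y) +F tr n z) (frob-+ x y) ⟩
    (x +F y) +F tr n (frob x +F frob y)        ≡⟨ ≡.cong ((x +F y) +F_) (tr-+ n (frob x) (frob y)) ⟩
    (x +F y) +F (tr n (frob x) +F tr n (frob y))
      ≡⟨ solveF 4 (λ x y u v → (x ⊕ y) ⊕ (u ⊕ v) ≋ (x ⊕ u) ⊕ (y ⊕ v)) ≡.refl x y _ _ ⟩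
    (x +F tr n (frob x)) +F (y +F tr n (frob y)) ∎

  tr-scale : ∀ n c x → frob c ≡ c → tr n (c *F x) ≡ c *F tr n x
  tr-scale zero    c x e = ≡.sym (RF.zeroʳ c)
  tr-scale (suc n) c x e = begin
    c *F x +F tr n (frob (c *F x))     ≡⟨ ≡.cong (λ z → c *F x +F tr n z) (≡.trans (frob-* c x) (≡.cong (_*F frob x) e)) ⟩
    c *F x +F tr n (c *F frob x)       ≡⟨ ≡.cong (c *F x +F_) (tr-scale n c (frob x) e) ⟩
    c *F x +F c *F tr n (frob x)       ≡⟨ ≡.sym (RF.distribˡ c _ _) ⟩
    c *F (x +F tr n (frob x))          ∎

  frob-tr : ∀ n x → frob (tr n x) ≡ tr n (frob x)
  frob-tr zero    x = frob-0
  frob-tr (suc n) x = ≡.trans (frob-+ x _) (≡.cong (frob x +F_) (frob-tr n (frob x)))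

  tr-last : ∀ n x → tr (suc n) x ≡ tr n x +F frobs n x
  tr-last zero    x = RF.+-comm x 0F
  tr-last (suc n) x = ≡.trans (≡.cong (x +F_) (tr-last n (frob x))) (≡.sym (RF.+-assoc _ _ _))

  -- Frobenius moves each conjugate to the next, and x^q = x brings the last back to the first.
  -- Hence traces lie in the prime field.
  frob-fixes-tr : ∀ x → frob (tr r x) ≡ tr r x
  frob-fixes-tr x = begin
    frob (tr r x)                      ≡⟨ frob-tr r x ⟩
    tr r (frob x)                      ≡⟨ solveF 2 (λ x t → t ≋ (x ⊕ t) ⊖ x) ≡.refl x _ ⟩
    tr (suc r) x -F x                  ≡⟨ ≡.cong (_-F x) (tr-last r x) ⟩
    (tr r x +F frobs r x) -F x         ≡⟨ ≡.cong (λ z → (tr r x +F z) -F x) (frobs-all x) ⟩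
    (tr r x +F x) -F x                 ≡⟨ solveF 2 (λ x t → (t ⊕ x) ⊖ x ≋ t) ≡.refl x _ ⟩
    tr r x                             ∎

  low-tr : ∀ {N} n → p ^ n ≤ N → Low N (λ x → tr n x)
  low-tr {N} zero    _ = low-0 N
  low-tr {N} (suc n) b = proj₁ total , λ x → ≡.trans (tr-last n x)
    (≡.trans (≡.cong (tr n x +F_) (≡.sym (≡.trans (RF.*-identityˡ _) (powF-frobs n x)))) (proj₂ total x))
    where
    p^n<N : p ^ n < N
    p^n<N = ℕₚ.<-≤-trans (ℕₚ.^-monoʳ-< p p>1 (ℕₚ.n<1+n n)) b
    total = low-+ (low-tr n (ℕₚ.<⇒≤ p^n<N)) (low-monomial 1F p^n<N)

  -- The trace is a polynomial of degree p^(r-1) < q, so it has a nonroot.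
  trace-nonzero : ∃ λ x → tr r x ≢ 0F
  trace-nonzero with any? (λ x → nonroot? x) elements
    where
    nonroot? : ∀ x → Relation.Nullary.Dec (tr r x ≢ 0F)
    nonroot? x = Relation.Nullary.¬? (tr r x ≟F 0F)
  ... | yes found = Any.satisfied found
  ... | no absent = ⊥-elim (too-many r ≡.refl)
    where
    zeros : ∀ {x} → tr r x ≡ 0F
    zeros {x} with tr r x ≟F 0F
    ... | yes z = z
    ... | no nz = ⊥-elim (absent (Any.map (λ { ≡.refl → nz }) (complete x)))
    too-many : ∀ n → n ≡ r → ⊥
    too-many zero    ≡.refl = 0≢1F (≡.sym (≡.trans (≡.sym (RF.+-identityʳ 1F))
      (≡.trans (≡.cong natF (≡.sym order≡p^r)) natF-order)))
    too-many (suc n) ≡.refl = ℕₚ.<⇒≱ (ℕₚ.^-monoʳ-< p p>1 (ℕₚ.n<1+n n))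
      (≡.subst (_≤ p ^ n) order≡p^r
        (monic-root-bound (low-tr n ℕₚ.≤-refl) elements distinct
          (All.universal (λ x → ≡.trans (≡.cong (tr n x +F_) (powF-frobs n x))
            (≡.trans (≡.sym (tr-last n x)) (zeros {x}))) elements)))

  -- The trace is linear over the prime field, and a nonzero value of it lies there, so that value
  -- can be divided out.
  trace-one : ∃ λ x → trace p r x ≡ 1F
  trace-one with trace-nonzero
  ... | x , nz = invF (tr r x) *F x , (begin
    trace p r (invF (tr r x) *F x)    ≡⟨ trace≡tr _ ⟩
    tr r (invF (tr r x) *F x)         ≡⟨ tr-scale r _ x (frob-inv _ nz (frob-fixes-tr x)) ⟩
    invF (tr r x) *F tr r x           ≡⟨ invF-inverseˡ _ nz ⟩
    1F                                ∎)

  trace-+ : ∀ x y → trace p r (x +F y) ≡ trace p r x +F trace p r y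
  trace-+ x y rewrite trace≡tr (x +F y) | trace≡tr x | trace≡tr y = tr-+ r x y

  natF-firstIndex : ∀ t ks → Any (λ k → natF k ≡ t) ks → natF (firstIndex t ks) ≡ t
  natF-firstIndex t (k ∷ ks) a with natF k ≟F t
  natF-firstIndex t (k ∷ ks) a         | yes e = e
  natF-firstIndex t (k ∷ ks) (here e)  | no n  = ⊥-elim (n e)
  natF-firstIndex t (k ∷ ks) (there a) | no n  = natF-firstIndex t ks a

  traceIndex : F → ℕ
  traceIndex x = firstIndex (trace p r x) (upTo p)

  -- Traces lie in the prime field, so the search in `firstIndex` succeeds and never reaches its
  -- default for the exhausted list.
  natF-traceIndex : ∀ x → natF (traceIndex x) ≡ trace p r x
  natF-traceIndex x = natF-firstIndex _ (upTo p) (frob-fixed _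
    (≡.subst (λ t → frob t ≡ t) (≡.sym (trace≡tr x)) (frob-fixes-tr x)))

-- Sums, delta functions and idempotents in the coefficient field

module CoefficientFacts (𝔽 : FiniteField) (𝕂 : CoeffField) where
  open Ops 𝔽 𝕂
  open FieldFacts 𝔽 𝕂
  open IntegerSolver coeffRing public using
    (solve; _:=_; con; _:+_; _:*_; _:-_; :-_; natR-+)
  open FiniteSums 𝔽 +-commutativeMonoid public using
    ( ⨁L; ⨁L-cong) renaming
    ( ⨁-cong to Σ-cong; ⨁-∙ to Σ-+; ⨁-swap to Σ-swap
    ; ⨁-single to Σ-single; ⨁-split to Σ-split; ⨁-reindex to Σ-reindex)
  open import Relation.Binary.Reasoning.Setoid setoid

  ≡⇒≈ : ∀ {a b} → a ≡ b → a ≈ b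
  ≡⇒≈ = reflexive

  1≉0 : ¬ (1# ≈ 0#)
  1≉0 e = charZero 0 (trans (+-identityʳ 1#) e)

  cancel : ∀ {a b c} → ¬ (a ≈ 0#) → a * b ≈ a * c → b ≈ c
  cancel {a} {b} {c} a≉0 e = begin
    b                   ≈⟨ sym (unit b) ⟩
    inv a * (a * b)     ≈⟨ *-congˡ e ⟩
    inv a * (a * c)     ≈⟨ unit c ⟩
    c                   ∎
    where
    unit : ∀ z → inv a * (a * z) ≈ z
    unit z = begin
      inv a * (a * z)   ≈⟨ solve 3 (λ i a z → i :* (a :* z) := (a :* i) :* z) refl (inv a) a z ⟩
      (a * inv a) * z   ≈⟨ *-congʳ (inv-inverse a a≉0) ⟩
      1# * z            ≈⟨ *-identityˡ z ⟩
      z                 ∎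

  cancel-0 : ∀ {a b} → ¬ (a ≈ 0#) → a * b ≈ 0# → b ≈ 0#
  cancel-0 a≉0 e = cancel a≉0 (trans e (sym (zeroʳ _)))

  *≉0 : ∀ {a b} → ¬ (a ≈ 0#) → ¬ (b ≈ 0#) → ¬ (a * b ≈ 0#)
  *≉0 a≉0 b≉0 e = b≉0 (cancel-0 a≉0 e)

  -≈0⇒≈ : ∀ {a b} → a - b ≈ 0# → a ≈ b
  -≈0⇒≈ {a} {b} e = begin
    a             ≈⟨ solve 2 (λ a b → a := (a :- b) :+ b) refl a b ⟩
    (a - b) + b   ≈⟨ +-congʳ e ⟩
    0# + b        ≈⟨ +-identityˡ b ⟩
    b             ∎

  Σ-*ˡ : ∀ k f → sumF (λ x → k * f x) ≈ k * sumF f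
  Σ-*ˡ k f = go elements
    where
    go : ∀ l → ⨁L l (λ x → k * f x) ≈ k * ⨁L l f
    go []      = sym (zeroʳ k)
    go (a ∷ l) = trans (+-congˡ (go l)) (sym (distribˡ k _ _))

  Σ-*ʳ : ∀ k f → sumF (λ x → f x * k) ≈ sumF f * k
  Σ-*ʳ k f = trans (Σ-cong λ x → *-comm (f x) k) (trans (Σ-*ˡ k f) (*-comm k _))

  Σ-- : ∀ f g → sumF (λ x → f x - g x) ≈ sumF f - sumF g
  Σ-- f g = begin
    sumF (λ x → f x - g x)              ≈⟨ Σ-+ f (λ x → - g x) ⟩
    sumF f + sumF (λ x → - g x)         ≈⟨ +-congˡ (Σ-cong λ x → solve 1 (λ a → :- a := con -[1+ 0 ] :* a) refl (g x)) ⟩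
    sumF f + sumF (λ x → - 1# * g x)    ≈⟨ +-congˡ (Σ-*ˡ (- 1#) g) ⟩
    sumF f + - 1# * sumF g              ≈⟨ solve 2 (λ a b → a :+ con -[1+ 0 ] :* b := a :- b) refl _ _ ⟩
    sumF f - sumF g                     ∎

  Σ-0 : sumF (λ _ → 0#) ≈ 0#
  Σ-0 = trans (Σ-cong λ _ → sym (zeroˡ 0#)) (trans (Σ-*ˡ 0# (λ _ → 0#)) (zeroˡ _))

  Σ-nonzero : ∀ {f g} → f 0F ≈ g 0F → (∀ x → x ≢ 0F → f x ≈ g x) → sumF f ≈ sumF g
  Σ-nonzero {f} {g} e h = Σ-cong pointwise
    where
    pointwise : ∀ x → f x ≈ g x
    pointwise x with x ≟F 0F
    ... | yes ≡.refl = e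
    ... | no n       = h x n

  Σ-shift : ∀ a f → sumF (λ x → f (x +F a)) ≈ sumF f
  Σ-shift a = Σ-reindex (_+F a) (_-F a)
    (λ x → solveF 2 (λ x a → (x ⊕ a) ⊖ a ≋ x) ≡.refl x a)
    (λ x → solveF 2 (λ x a → (x ⊖ a) ⊕ a ≋ x) ≡.refl x a)

  Σ-scale : ∀ {a} → a ≢ 0F → ∀ f → sumF (λ x → f (a *F x)) ≈ sumF f
  Σ-scale {a} n = Σ-reindex (a *F_) (invF a *F_)
    (λ x → modulo x (invF-inverse a n)
       (solveF 3 (λ x a i → i ⊗ (a ⊗ x) ≋ x ⊕ (a ⊗ i ⊖ num (+ 1)) ⊗ x) ≡.refl x a (invF a)))
    (λ x → modulo x (invF-inverse a n)
       (solveF 3 (λ x a i → a ⊗ (i ⊗ x) ≋ x ⊕ (a ⊗ i ⊖ num (+ 1)) ⊗ x) ≡.refl x a (invF a)))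

  Σ-inv : ∀ f → sumF (λ x → f (invF x)) ≈ sumF f
  Σ-inv = Σ-reindex invF invF invF-involutive invF-involutive

  -- Equality in K is not decidable, but idempotents behave as if it were:
  -- e and 1 - e annihilate each other and a nonzero element is invertible.
  idempotent-≈0 : ∀ {e} → e * e ≈ e → ¬ (e ≈ 1#) → e ≈ 0#
  idempotent-≈0 {e} i e≉1 = cancel-0 (λ z → e≉1 (sym (-≈0⇒≈ z))) (begin
    (1# - e) * e   ≈⟨ solve 1 (λ e → (con (+ 1) :- e) :* e := e :- e :* e) refl e ⟩
    e - e * e      ≈⟨ +-congˡ (-‿cong i) ⟩
    e - e          ≈⟨ -‿inverseʳ e ⟩
    0#             ∎)

  -- Up to double negation every idempotent is 0 or 1, so the terms other than e(t) add up to a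
  -- natural number n. Were e(t) = 1, the total would be 1 + n, which is nonzero in characteristic
  -- zero. The double negation does no harm because a contradiction is the goal.
  Σ-idempotent-≈0 : ∀ e → (∀ x → e x * e x ≈ e x) → sumF e ≈ 0# → ∀ t → e t ≈ 0#
  Σ-idempotent-≈0 e idem Σ≈0 t = idempotent-≈0 (idem t) λ et≈1 →
    isNatural rest rest-idem elements λ { (n , Σ≈n) → charZero n (begin
      1# + natR coeffRing n    ≈⟨ +-cong (sym et≈1) (sym Σ≈n) ⟩
      e t + sumF rest          ≈⟨ sym (Σ-split t e) ⟩
      sumF e                   ≈⟨ Σ≈0 ⟩
      0#                       ∎) }
    where
    rest : F → K
    rest x = if does (x ≟F t) then 0# else e x
    rest-idem : ∀ x → rest x * rest x ≈ rest x
    rest-idem x with x ≟F t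
    ... | yes _ = zeroˡ 0#
    ... | no _  = idem x
    isNatural : ∀ f → (∀ x → f x * f x ≈ f x) → ∀ l → ¬ ¬ ∃ λ n → ⨁L l f ≈ natR coeffRing n
    isNatural f i []      k = k (0 , refl)
    isNatural f i (a ∷ l) k = isNatural f i l λ { (n , s) →
      k (n , trans (+-congʳ (idempotent-≈0 (i a) λ fa≈1 → k (suc n , +-cong fa≈1 s)))
                   (trans (+-identityˡ _) s)) }

  δ-≡0 : ∀ {y} → y ≡ 0F → δ y ≈ 1#
  δ-≡0 {y} e with y ≟F 0F
  ... | yes _ = refl
  ... | no n  = ⊥-elim (n e)

  δ-≢0 : ∀ {y} → y ≢ 0F → δ y ≈ 0#
  δ-≢0 {y} n with y ≟F 0F
  ... | yes e = ⊥-elim (n e)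
  ... | no _  = refl

  δ-⇔ : ∀ {x y} → (x ≡ 0F → y ≡ 0F) → (y ≡ 0F → x ≡ 0F) → δ x ≈ δ y
  δ-⇔ {x} {y} f g with x ≟F 0F
  ... | yes e = sym (δ-≡0 (f e))
  ... | no n  = sym (δ-≢0 (λ e → n (g e)))

  δ-*-cong : ∀ {y a b} → (y ≡ 0F → a ≈ b) → δ y * a ≈ δ y * b
  δ-*-cong {y} f with y ≟F 0F
  ... | yes e = *-congˡ (f e)
  ... | no _  = trans (zeroˡ _) (sym (zeroˡ _))

  x-x≡0 : ∀ {x y} → x ≡ y → x -F y ≡ 0F
  x-x≡0 {x} ≡.refl = RF.-‿inverseʳ x

  Σ-δ : ∀ a (f : F → K) → sumF (λ x → δ (x -F a) * f x) ≈ f a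
  Σ-δ a f = trans
    (Σ-single a (λ x → δ (x -F a) * f x) λ x n → trans (*-congʳ (δ-≢0 (λ e → n (sub≡0 e)))) (zeroˡ _))
    (trans (*-congʳ (δ-≡0 (x-x≡0 {a} ≡.refl))) (*-identityˡ _))

  δ-sym : ∀ a b → δ (a -F b) ≈ δ (b -F a)
  δ-sym a b = δ-⇔ (λ e → x-x≡0 (≡.sym (sub≡0 e))) (λ e → x-x≡0 (≡.sym (sub≡0 e)))

  Σ-δ′ : ∀ a (f : F → K) → sumF (λ x → δ (a -F x) * f x) ≈ f a
  Σ-δ′ a f = trans (Σ-cong λ x → *-congʳ (δ-sym a x)) (Σ-δ a f)

  -- The inner sum counts the solutions of π x = y with weight w, so that a fibre count becomes a
  -- change of variables.
  Σ-fibre : ∀ (π : F → F) (w G : F → K) →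
    sumF (λ x → w x * G (π x)) ≈ sumF (λ y → sumF (λ x → w x * δ (π x -F y)) * G y)
  Σ-fibre π w G = begin
    sumF (λ x → w x * G (π x))
      ≈⟨ Σ-cong (λ x → trans (*-congˡ (sym (Σ-δ′ (π x) G))) (sym (Σ-*ˡ (w x) _))) ⟩
    sumF (λ x → sumF (λ y → w x * (δ (π x -F y) * G y)))
      ≈⟨ Σ-swap _ ⟩
    sumF (λ y → sumF (λ x → w x * (δ (π x -F y) * G y)))
      ≈⟨ Σ-cong (λ y → trans (Σ-cong λ x → sym (*-assoc _ _ _)) (Σ-*ʳ (G y) _)) ⟩
    sumF (λ y → sumF (λ x → w x * δ (π x -F y)) * G y) ∎

  q : K
  q = sumF (λ _ → 1#)

  q≉0 : ¬ (q ≈ 0#)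
  q≉0 e = 1≉0 (Σ-idempotent-≈0 (λ _ → 1#) (λ _ → *-identityˡ 1#) e 0F)

-- Multiplicative characters and the quadratic character

module Characters (𝔽 : FiniteField) (𝕂 : CoeffField) where
  open Ops 𝔽 𝕂
  open FieldFacts 𝔽 𝕂
  open CoefficientFacts 𝔽 𝕂
  open import Relation.Binary.Reasoning.Setoid setoid

  at-0 : ∀ {χ} → IsCharacter χ → χ 0F ≈ 0#
  at-0 c = proj₁ c

  at-1 : ∀ {χ} → IsCharacter χ → χ 1F ≈ 1#
  at-1 c = proj₁ (proj₂ c)

  at-* : ∀ {χ} → IsCharacter χ → ∀ x y → χ (x *F y) ≈ χ x * χ y
  at-* c = proj₂ (proj₂ c)

  ·-character : ∀ {χ θ} → IsCharacter χ → IsCharacter θ → IsCharacter (χ · θ)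
  ·-character c d
    = trans (*-congʳ (at-0 c)) (zeroˡ _)
    , trans (*-cong (at-1 c) (at-1 d)) (*-identityˡ 1#)
    , λ x y → trans (*-cong (at-* c x y) (at-* d x y))
        (solve 4 (λ a b u v → (a :* b) :* (u :* v) := (a :* u) :* (b :* v)) refl _ _ _ _)

  conj-character : ∀ {χ} → IsCharacter χ → IsCharacter (conj χ)
  conj-character {χ} c
    = trans (≡⇒≈ (≡.cong χ invF-zero)) (at-0 c)
    , trans (≡⇒≈ (≡.cong χ invF-1)) (at-1 c)
    , λ x y → trans (≡⇒≈ (≡.cong χ (invF-* x y))) (at-* c _ _)

  cube-character : ∀ {χ} → IsCharacter χ → IsCharacter (cube χ)
  cube-character c = ·-character (·-character c c) c

  conj-conj : ∀ χ x → conj (conj χ) x ≈ χ x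
  conj-conj χ x = ≡⇒≈ (≡.cong χ (invF-involutive x))

  *-conj : ∀ {χ} → IsCharacter χ → ∀ {x} → x ≢ 0F → χ x * conj χ x ≈ 1#
  *-conj {χ} c {x} n = trans (sym (at-* c _ _))
    (trans (≡⇒≈ (≡.cong χ (invF-inverse x n))) (at-1 c))

  -- The trivial character in the convention χ(0) = 0; `W ε` is summation over the nonzero elements.
  ε : F → K
  ε x = if does (x ≟F 0F) then 0# else 1#

  ε-0 : ε 0F ≈ 0#
  ε-0 with 0F ≟F 0F
  ... | yes _ = refl
  ... | no n  = ⊥-elim (n ≡.refl)

  ε-≢0 : ∀ {x} → x ≢ 0F → ε x ≈ 1#
  ε-≢0 {x} n with x ≟F 0F
  ... | yes e = ⊥-elim (n e)
  ... | no _  = refl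

  ε+δ : ∀ x → ε x ≈ 1# - δ x
  ε+δ x with x ≟F 0F
  ... | yes _ = solve 0 (con (+ 0) := con (+ 1) :- con (+ 1)) refl
  ... | no _  = solve 0 (con (+ 1) := con (+ 1) :- con (+ 0)) refl

  Σε≉0 : ¬ (sumF ε ≈ 0#)
  Σε≉0 n≈0 = 1≉0 (trans (sym (ε-≢0 (λ e → 0≢1F (≡.sym e)))) (Σ-idempotent-≈0 ε ε-idem n≈0 1F))
    where
    ε-idem : ∀ x → ε x * ε x ≈ ε x
    ε-idem x with x ≟F 0F
    ... | yes _ = zeroˡ 0#
    ... | no _  = *-identityˡ 1#

  Σ-trivial : ∀ {χ} → IsCharacter χ → IsTrivial χ → sumF χ ≈ sumF ε
  Σ-trivial c t = Σ-nonzero (trans (at-0 c) (sym ε-0)) λ x n → trans (t x n) (sym (ε-≢0 n))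

  -- The common shape of the sums below. Since characters vanish at 0, the integrand may be changed
  -- there, and rescaling the variable only costs a value of χ.
  W : (F → K) → (F → K) → K
  W χ f = sumF (λ w → χ w * f w)

  W-cong : ∀ {χ θ f g} → χ 0F ≈ 0# → θ 0F ≈ 0# →
           (∀ w → w ≢ 0F → χ w * f w ≈ θ w * g w) → W χ f ≈ W θ g
  W-cong z z′ = Σ-nonzero (trans (trans (*-congʳ z) (zeroˡ _)) (sym (trans (*-congʳ z′) (zeroˡ _))))

  W-congʳ : ∀ {χ f g} → χ 0F ≈ 0# → (∀ w → w ≢ 0F → f w ≈ g w) → W χ f ≈ W χ g
  W-congʳ z h = W-cong z z λ w n → *-congˡ (h w n)

  W-weight : ∀ {χ θ} f → (∀ w → χ w ≈ θ w) → W χ f ≈ W θ f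
  W-weight f h = Σ-cong λ w → *-congʳ (h w)

  W-*ˡ : ∀ χ k f → W χ (λ w → k * f w) ≈ k * W χ f
  W-*ˡ χ k f = trans (Σ-cong λ w → solve 3 (λ x k f → x :* (k :* f) := k :* (x :* f)) refl _ k _) (Σ-*ˡ k _)

  W-- : ∀ χ f g → W χ (λ w → f w - g w) ≈ W χ f - W χ g
  W-- χ f g = trans (Σ-cong λ w → solve 3 (λ x f g → x :* (f :- g) := x :* f :- x :* g) refl _ _ _) (Σ-- _ _)

  W-Σ : ∀ χ (f : F → F → K) → W χ (λ x → sumF (f x)) ≈ sumF (λ y → W χ (λ x → f x y))
  W-Σ χ f = trans (Σ-cong λ x → sym (Σ-*ˡ (χ x) (f x))) (Σ-swap _)

  W-swap : ∀ χ θ (f : F → F → K) → W χ (λ x → W θ (f x)) ≈ W θ (λ y → W χ (λ x → f x y))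
  W-swap χ θ f = trans (W-Σ χ _) (Σ-cong λ y → W-*ˡ χ (θ y) (λ x → f x y))

  W₂ : (χ θ : F → K) → (F → F → K) → K
  W₂ χ θ f = W χ (λ v → W θ (f v))

  W₂-cong : ∀ χ θ {f k} → (∀ v w → f v w ≈ k v w) → W₂ χ θ f ≈ W₂ χ θ k
  W₂-cong χ θ h = Σ-cong λ v → *-congˡ (Σ-cong λ w → *-congˡ (h v w))

  W₂-*ˡ : ∀ χ θ k f → W₂ χ θ (λ v w → k * f v w) ≈ k * W₂ χ θ f
  W₂-*ˡ χ θ k f = trans (Σ-cong λ v → *-congˡ (W-*ˡ θ k (f v))) (W-*ˡ χ k _)

  W-W₂-swap : ∀ ρ χ θ (f : F → F → F → K) →
    W ρ (λ z → W₂ χ θ (f z)) ≈ W₂ χ θ (λ v w → W ρ (λ z → f z v w))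
  W-W₂-swap ρ χ θ f = trans (W-swap ρ χ _) (Σ-cong λ v → *-congˡ (W-swap ρ θ _))

  W-scale : ∀ {χ} → IsCharacter χ → ∀ {a} → a ≢ 0F → ∀ f →
            W χ f ≈ χ a * W χ (λ w → f (a *F w))
  W-scale {χ} c {a} n f = begin
    W χ f                                             ≈⟨ sym (Σ-scale n (λ w → χ w * f w)) ⟩
    sumF (λ w → χ (a *F w) * f (a *F w))              ≈⟨ Σ-cong (λ w → trans (*-congʳ (at-* c a w)) (*-assoc _ _ _)) ⟩
    sumF (λ w → χ a * (χ w * f (a *F w)))             ≈⟨ Σ-*ˡ (χ a) _ ⟩
    χ a * W χ (λ w → f (a *F w))                      ∎

  W-inv : ∀ χ f → W χ f ≈ W (conj χ) (λ w → f (invF w))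
  W-inv χ f = sym (Σ-inv (λ w → χ w * f w))

  -- S = Σχ satisfies χ(x)S = S for x ≠ 0, so S/(q-1) is an idempotent,
  -- and this idempotent is 1 only if χ is trivial.
  Σ-nontrivial : ∀ {χ} → IsCharacter χ → Nontrivial χ → sumF χ ≈ 0#
  Σ-nontrivial {χ} c nontrivial = begin
    S               ≈⟨ solve 1 (λ s → s := con (+ 1) :* s) refl S ⟩
    1# * S          ≈⟨ *-congʳ (sym nν≈1) ⟩
    (n * ν) * S     ≈⟨ *-assoc n ν S ⟩
    n * (ν * S)     ≈⟨ *-congˡ (idempotent-≈0 idem νS≉1) ⟩
    n * 0#          ≈⟨ zeroʳ n ⟩
    0#              ∎
    where
    S = sumF χ
    n = sumF ε
    ν = inv n
    nν≈1 : n * ν ≈ 1#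
    nν≈1 = inv-inverse n Σε≉0
    absorb : ∀ x → x ≢ 0F → χ x * S ≈ S
    absorb x x≢0 = begin
      χ x * S                     ≈⟨ sym (Σ-*ˡ (χ x) χ) ⟩
      sumF (λ y → χ x * χ y)      ≈⟨ Σ-cong (λ y → sym (at-* c x y)) ⟩
      sumF (λ y → χ (x *F y))     ≈⟨ Σ-scale x≢0 χ ⟩
      S                           ∎
    SS≈nS : S * S ≈ n * S
    SS≈nS = begin
      S * S                       ≈⟨ sym (Σ-*ʳ S χ) ⟩
      sumF (λ x → χ x * S)        ≈⟨ Σ-nonzero
        (trans (trans (*-congʳ (at-0 c)) (zeroˡ S)) (sym (trans (*-congʳ ε-0) (zeroˡ S))))
        (λ x x≢0 → trans (absorb x x≢0) (trans (sym (*-identityˡ S)) (*-congʳ (sym (ε-≢0 x≢0))))) ⟩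
      sumF (λ x → ε x * S)        ≈⟨ Σ-*ʳ S ε ⟩
      n * S                       ∎
    idem : (ν * S) * (ν * S) ≈ ν * S
    idem = begin
      (ν * S) * (ν * S)           ≈⟨ solve 2 (λ v s → (v :* s) :* (v :* s) := (v :* v) :* (s :* s)) refl ν S ⟩
      (ν * ν) * (S * S)           ≈⟨ *-congˡ SS≈nS ⟩
      (ν * ν) * (n * S)           ≈⟨ solve 3 (λ v n s → (v :* v) :* (n :* s) := (n :* v) :* (v :* s)) refl ν n S ⟩
      (n * ν) * (ν * S)           ≈⟨ *-congʳ nν≈1 ⟩
      1# * (ν * S)                ≈⟨ *-identityˡ _ ⟩
      ν * S                       ∎
    νS≉1 : ¬ (ν * S ≈ 1#)
    νS≉1 e = nontrivial λ x x≢0 → begin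
      χ x                         ≈⟨ sym (*-identityʳ _) ⟩
      χ x * 1#                    ≈⟨ *-congˡ (sym e) ⟩
      χ x * (ν * S)               ≈⟨ solve 3 (λ x v s → x :* (v :* s) := v :* (x :* s)) refl (χ x) ν S ⟩
      ν * (χ x * S)               ≈⟨ *-congˡ (absorb x x≢0) ⟩
      ν * S                       ≈⟨ e ⟩
      1#                          ∎

  -- A case split on `φ x` that also delivers the evidence: a square root, or the absence of one.
  data SquareView (x : F) : Set where
    vanishing : x ≡ 0F → φ x ≈ 0# → SquareView x
    square    : ∀ y → x ≢ 0F → y *F y ≡ x → φ x ≈ 1# → SquareView x
    nonsquare : x ≢ 0F → (∀ y → y *F y ≢ x) → φ x ≈ - 1# → SquareView x

  squareView : ∀ x → SquareView x
  squareView x = view (x ≟F 0F) (any? (λ y → (y *F y) ≟F x) elements) refl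
    where
    view : ∀ (d : Dec (x ≡ 0F)) (a : Dec (Any (λ y → y *F y ≡ x) elements)) →
           φ x ≈ (if does d then 0# else (if does a then 1# else (- 1#))) → SquareView x
    view (yes e) a       v = vanishing e v
    view (no n)  (yes a) v = square (proj₁ (Any.satisfied a)) n (proj₂ (Any.satisfied a)) v
    view (no n)  (no na) v = nonsquare n (λ y e → na (Any.map (λ { ≡.refl → e }) (complete y))) v

  φ-0 : φ 0F ≈ 0#
  φ-0 with squareView 0F
  ... | vanishing _ v   = v
  ... | square _ n _ _  = ⊥-elim (n ≡.refl)
  ... | nonsquare n _ _ = ⊥-elim (n ≡.refl)

  φ-square : ∀ {y} → y ≢ 0F → φ (y *F y) ≈ 1#
  φ-square {y} n with squareView (y *F y)
  ... | vanishing e _    = ⊥-elim (n (square≡0 e))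
  ... | square _ _ _ v   = v
  ... | nonsquare _ ns _ = ⊥-elim (ns y ≡.refl)

  φ-nonsquare : ∀ {x} → (∀ y → y *F y ≢ x) → φ x ≈ - 1#
  φ-nonsquare {x} ns with squareView x
  ... | vanishing ≡.refl _ = ⊥-elim (ns 0F (RF.zeroˡ 0F))
  ... | square y _ e _     = ⊥-elim (ns y e)
  ... | nonsquare _ _ v    = v

  φ-1 : φ 1F ≈ 1#
  φ-1 = trans (≡⇒≈ (≡.cong φ (≡.sym (RF.*-identityˡ 1F)))) (φ-square (λ e → 0≢1F (≡.sym e)))

  φ² : ∀ {x} → x ≢ 0F → φ x * φ x ≈ 1#
  φ² {x} n with squareView x
  ... | vanishing e _   = ⊥-elim (n e)
  ... | square _ _ _ v  = trans (*-cong v v) (*-identityˡ 1#)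
  ... | nonsquare _ _ v = trans (*-cong v v) (solve 0 (con -[1+ 0 ] :* con -[1+ 0 ] := con (+ 1)) refl)

  φ-inv : ∀ x → φ (invF x) ≈ φ x
  φ-inv x with squareView x
  ... | vanishing ≡.refl _ = ≡⇒≈ (≡.cong φ invF-zero)
  ... | square y n ≡.refl v = trans (≡⇒≈ (≡.cong φ (invF-* y y)))
    (trans (φ-square (invF≢0 (λ { ≡.refl → n (RF.zeroˡ 0F) }))) (sym v))
  ... | nonsquare n ns v = trans (φ-nonsquare (λ y e → ns (invF y)
    (≡.trans (≡.sym (invF-* y y)) (≡.trans (≡.cong invF e) (invF-involutive x))))) (sym v)

  φ-square-* : ∀ {a} → a ≢ 0F → ∀ x → φ ((a *F a) *F x) ≈ φ x
  φ-square-* {a} n x with squareView x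
  ... | vanishing ≡.refl _ = ≡⇒≈ (≡.cong φ (RF.zeroʳ _))
  ... | square y x≢0 ≡.refl v = trans
    (≡⇒≈ (≡.cong φ (solveF 2 (λ a y → (a ⊗ a) ⊗ (y ⊗ y) ≋ (a ⊗ y) ⊗ (a ⊗ y)) ≡.refl a y)))
    (trans (φ-square (*F≢0 n λ { ≡.refl → x≢0 (RF.zeroˡ 0F) })) (sym v))
  ... | nonsquare x≢0 ns v = trans (φ-nonsquare λ y e → ns (invF a *F y) (≡.trans
    (solveF 2 (λ i y → (i ⊗ y) ⊗ (i ⊗ y) ≋ (i ⊗ i) ⊗ (y ⊗ y)) ≡.refl (invF a) y)
    (≡.trans (≡.cong ((invF a *F invF a) *F_) e)
      (modulo ((a *F invF a +F 1F) *F x) (invF-inverse a n)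
        (solveF 3 (λ a i x → (i ⊗ i) ⊗ ((a ⊗ a) ⊗ x) ≋ x ⊕ (a ⊗ i ⊖ num (+ 1)) ⊗ ((a ⊗ i ⊕ num (+ 1)) ⊗ x)) ≡.refl a (invF a) x)))))
    (sym v)

  double≢0 : 2F ≢ 0F → ∀ {y} → y ≢ 0F → y ≢ -F y
  double≢0 2≢0 {y} n e = *F≢0 2≢0 n (≡.trans
    (solveF 1 (λ y → num (+ 2) ⊗ y ≋ y ⊖ (⊝ y)) ≡.refl y) (x-x≡0 e))

  square-count : 2F ≢ 0F → ∀ t → sumF (λ k → δ ((k *F k) -F t)) ≈ 1# + φ t
  square-count 2≢0 t with squareView t
  ... | vanishing ≡.refl v = begin
    sumF (λ k → δ ((k *F k) -F 0F))
      ≈⟨ Σ-cong (λ k → trans (δ-⇔ (λ e → x-x≡0 (square≡0 (sub≡0 e)))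
           (λ e → x-x≡0 (≡.trans (≡.cong₂ _*F_ (sub≡0 e) (sub≡0 e)) (RF.zeroˡ 0F)))) (sym (*-identityʳ _))) ⟩
    sumF (λ k → δ (k -F 0F) * 1#)   ≈⟨ Σ-δ 0F (λ _ → 1#) ⟩
    1#                              ≈⟨ sym (+-identityʳ 1#) ⟩
    1# + 0#                         ≈⟨ +-congˡ (sym v) ⟩
    1# + φ 0F                       ∎
  ... | square y n ≡.refl v = begin
    sumF (λ k → δ ((k *F k) -F (y *F y)))                       ≈⟨ Σ-cong roots ⟩
    sumF (λ k → δ (k -F y) * 1# + δ (k -F (-F y)) * 1#)     ≈⟨ Σ-+ _ _ ⟩
    sumF (λ k → δ (k -F y) * 1#) + sumF (λ k → δ (k -F (-F y)) * 1#)
      ≈⟨ +-cong (Σ-δ y (λ _ → 1#)) (Σ-δ (-F y) (λ _ → 1#)) ⟩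
    1# + 1#                                                 ≈⟨ +-congˡ (sym v) ⟩
    1# + φ (y *F y)                                         ∎
    where
    y≢-y : y ≢ -F y
    y≢-y = double≢0 2≢0 λ { ≡.refl → n (RF.zeroˡ 0F) }
    factor : ∀ k → (k *F k) -F (y *F y) ≡ (k -F y) *F (k -F (-F y))
    factor k = solveF 2 (λ k y → k ⊗ k ⊖ y ⊗ y ≋ (k ⊖ y) ⊗ (k ⊖ (⊝ y))) ≡.refl k y
    roots : ∀ k → δ ((k *F k) -F (y *F y)) ≈ δ (k -F y) * 1# + δ (k -F (-F y)) * 1#
    roots k with (k -F y) ≟F 0F | (k -F (-F y)) ≟F 0F
    ... | yes e | yes e′ = ⊥-elim (y≢-y (≡.trans (≡.sym (sub≡0 e)) (sub≡0 e′)))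
    ... | yes e | no _   = trans (δ-≡0 (≡.trans (factor k) (≡.trans (≡.cong (_*F (k -F (-F y))) e) (RF.zeroˡ _))))
                             (solve 0 (con (+ 1) := con (+ 1) :* con (+ 1) :+ con (+ 0) :* con (+ 1)) refl)
    ... | no _  | yes e  = trans (δ-≡0 (≡.trans (factor k) (≡.trans (≡.cong ((k -F y) *F_) e) (RF.zeroʳ _))))
                             (solve 0 (con (+ 1) := con (+ 0) :* con (+ 1) :+ con (+ 1) :* con (+ 1)) refl)
    ... | no a  | no b   = trans (δ-≢0 (λ e → *F≢0 a b (≡.trans (≡.sym (factor k)) e)))
                             (solve 0 (con (+ 0) := con (+ 0) :* con (+ 1) :+ con (+ 0) :* con (+ 1)) refl)
  ... | nonsquare n ns v = begin
    sumF (λ k → δ ((k *F k) -F t))    ≈⟨ Σ-cong (λ k → δ-≢0 (λ e → ns k (sub≡0 e))) ⟩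
    sumF (λ _ → 0#)                 ≈⟨ Σ-0 ⟩
    0#                              ≈⟨ solve 0 (con (+ 0) := con (+ 1) :+ con -[1+ 0 ]) refl ⟩
    1# + - 1#                       ≈⟨ +-congˡ (sym v) ⟩
    1# + φ t                        ∎

  Σ-squares : 2F ≢ 0F → ∀ G → sumF (λ k → G (k *F k)) ≈ sumF (λ t → (1# + φ t) * G t)
  Σ-squares 2≢0 G = begin
    sumF (λ k → G (k *F k))                                 ≈⟨ Σ-cong (λ k → sym (*-identityˡ _)) ⟩
    sumF (λ k → 1# * G (k *F k))                            ≈⟨ Σ-fibre (λ k → k *F k) (λ _ → 1#) G ⟩
    sumF (λ t → sumF (λ k → 1# * δ ((k *F k) -F t)) * G t)
      ≈⟨ Σ-cong (λ t → *-congʳ (trans (Σ-cong λ k → *-identityˡ _) (square-count 2≢0 t))) ⟩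
    sumF (λ t → (1# + φ t) * G t)                           ∎

  -- With G = 1, `Σ-squares` reads q = q + Σφ.
  Σφ : 2F ≢ 0F → sumF φ ≈ 0#
  Σφ 2≢0 = begin
    sumF φ                         ≈⟨ solve 2 (λ f q → f := (q :+ f) :- q) refl (sumF φ) q ⟩
    (q + sumF φ) - q               ≈⟨ +-congʳ (sym (Σ-+ (λ _ → 1#) φ)) ⟩
    sumF (λ t → 1# + φ t) - q      ≈⟨ +-congʳ (Σ-cong λ t → sym (*-identityʳ _)) ⟩
    sumF (λ t → (1# + φ t) * 1#) - q  ≈⟨ +-congʳ (sym (Σ-squares 2≢0 (λ _ → 1#))) ⟩
    q - q                          ≈⟨ -‿inverseʳ q ⟩
    0#                             ∎

  2≉0 : ¬ (1# + 1# ≈ 0#)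
  2≉0 e = charZero 1 (trans (+-congˡ (+-identityʳ 1#)) e)

  -- For a nonsquare t, Σ_u (φ(u) + φ(tu)) = 0 although every term is 0 or -2.
  φ-*-nonsquare : 2F ≢ 0F → ∀ {t} → (∀ y → y *F y ≢ t) → ∀ u → φ (t *F u) ≈ φ t * φ u
  φ-*-nonsquare 2≢0 {t} ns u = begin
    φ (t *F u)      ≈⟨ -≈0⇒≈ (trans (+-congˡ (solve 1 (λ a → :- (:- a) := a) refl (φ u))) (begin
      φ (t *F u) + φ u          ≈⟨ pair u ⟩
      (- (1# + 1#)) * e u       ≈⟨ *-congˡ (Σ-idempotent-≈0 e e-idem Σe u) ⟩
      (- (1# + 1#)) * 0#        ≈⟨ zeroʳ _ ⟩
      0#                        ∎)) ⟩
    - φ u           ≈⟨ solve 1 (λ a → :- a := con -[1+ 0 ] :* a) refl (φ u) ⟩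
    - 1# * φ u      ≈⟨ *-congʳ (sym (φ-nonsquare ns)) ⟩
    φ t * φ u       ∎
    where
    t≢0 : t ≢ 0F
    t≢0 ≡.refl = ns 0F (RF.zeroˡ 0F)
    e : F → K
    e u with squareView u | squareView (t *F u)
    ... | nonsquare _ _ _ | nonsquare _ _ _ = 1#
    ... | _               | _               = 0#
    e-idem : ∀ u → e u * e u ≈ e u
    e-idem u with squareView u | squareView (t *F u)
    ... | nonsquare _ _ _ | nonsquare _ _ _ = *-identityˡ 1#
    ... | nonsquare _ _ _ | vanishing _ _   = zeroˡ 0#
    ... | nonsquare _ _ _ | square _ _ _ _  = zeroˡ 0#
    ... | vanishing _ _   | _               = zeroˡ 0#
    ... | square _ _ _ _  | _               = zeroˡ 0#
    pair : ∀ u → φ (t *F u) + φ u ≈ (- (1# + 1#)) * e u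
    pair u with squareView u | squareView (t *F u)
    ... | nonsquare _ _ v | nonsquare _ _ v′ = trans (+-cong v′ v)
      (solve 0 (con -[1+ 0 ] :+ con -[1+ 0 ] := (:- (con (+ 1) :+ con (+ 1))) :* con (+ 1)) refl)
    ... | nonsquare n _ _ | vanishing z _   = ⊥-elim (*F≢0 t≢0 n z)
    ... | nonsquare _ _ v | square _ _ _ v′ = trans (+-cong v′ v)
      (solve 0 (con (+ 1) :+ con -[1+ 0 ] := (:- (con (+ 1) :+ con (+ 1))) :* con (+ 0)) refl)
    ... | vanishing ≡.refl v | _ = trans (+-cong (trans (≡⇒≈ (≡.cong φ (RF.zeroʳ t))) v) v)
      (solve 0 (con (+ 0) :+ con (+ 0) := (:- (con (+ 1) :+ con (+ 1))) :* con (+ 0)) refl)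
    ... | square y n ≡.refl v | _ = trans
      (+-cong (trans (≡⇒≈ (≡.cong φ (RF.*-comm t _)))
        (trans (φ-square-* (λ { ≡.refl → n (RF.zeroˡ 0F) }) t) (φ-nonsquare ns))) v)
      (solve 0 (con -[1+ 0 ] :+ con (+ 1) := (:- (con (+ 1) :+ con (+ 1))) :* con (+ 0)) refl)
    Σe : sumF e ≈ 0#
    Σe = cancel-0 (λ z → 2≉0 (trans (solve 1 (λ a → a := :- (:- a)) refl _)
                    (trans (-‿cong z) (solve 0 (:- con (+ 0) := con (+ 0)) refl)))) (begin
      (- (1# + 1#)) * sumF e             ≈⟨ sym (Σ-*ˡ _ e) ⟩
      sumF (λ u → (- (1# + 1#)) * e u)   ≈⟨ Σ-cong (λ u → sym (pair u)) ⟩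
      sumF (λ u → φ (t *F u) + φ u)      ≈⟨ Σ-+ _ φ ⟩
      sumF (λ u → φ (t *F u)) + sumF φ   ≈⟨ +-cong (trans (Σ-scale t≢0 φ) (Σφ 2≢0)) (Σφ 2≢0) ⟩
      0# + 0#                            ≈⟨ +-identityˡ 0# ⟩
      0#                                 ∎)

  φ-character : 2F ≢ 0F → IsCharacter φ
  φ-character 2≢0 = φ-0 , φ-1 , mul
    where
    mul : ∀ x y → φ (x *F y) ≈ φ x * φ y
    mul x y with squareView x
    ... | vanishing ≡.refl v = trans (≡⇒≈ (≡.cong φ (RF.zeroˡ y))) (trans v (trans (sym (zeroˡ _)) (*-congʳ (sym v))))
    ... | square a n ≡.refl v = trans (φ-square-* (λ { ≡.refl → n (RF.zeroˡ 0F) }) y)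
      (trans (sym (*-identityˡ _)) (*-congʳ (sym v)))
    ... | nonsquare _ ns v = φ-*-nonsquare 2≢0 ns y

-- Standing data: additive character, cubic character, parameters

record AdditiveSetting (𝔽 : FiniteField) (𝕂 : CoeffField) : Set where
  open Ops 𝔽 𝕂
  open CoefficientFacts 𝔽 𝕂 using (q)
  field
    2≢0          : natF 2 ≢ 0F
    3≢0          : natF 3 ≢ 0F
    ψ            : F → K
    ψ-+          : ∀ x y → ψ (x +F y) ≈ ψ x * ψ y
    ψ-0          : ψ 0F ≈ 1#
    ψ-orthogonal : ∀ c → sumF (λ x → ψ (c *F x)) ≈ δ c * q

record CubicCharacter (𝔽 : FiniteField) (𝕂 : CoeffField) : Set where
  open Ops 𝔽 𝕂
  field
    η            : F → K
    η-char       : IsCharacter η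
    η-nontrivial : Nontrivial η
    η³-trivial   : IsTrivial (cube η)

record Parameters (𝔽 : FiniteField) (𝕂 : CoeffField) : Set where
  open Ops 𝔽 𝕂
  field
    A B : F → K
    cA  : IsCharacter A
    cB  : IsCharacter B
    nM  : Nontrivial (cube A)
    nB  : Nontrivial B
    n₁  : Nontrivial (cube A · conj B · conj B)
    n₂  : Nontrivial (cube A · cube A · conj (cube B))
    nC  : Nontrivial (φ · cube A · conj B)
    n₄  : Nontrivial (φ · cube A · conj (cube B))

-- Gauss sums, Hasse-Davenport for squares, and the kernel of ₃F₂

module GaussSums (𝔽 : FiniteField) (𝕂 : CoeffField) (setting : AdditiveSetting 𝔽 𝕂) where
  open Ops 𝔽 𝕂
  open FieldFacts 𝔽 𝕂
  open CoefficientFacts 𝔽 𝕂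
  open Characters 𝔽 𝕂
  open AdditiveSetting setting
  open import Relation.Binary.Reasoning.Setoid setoid

  g : (F → K) → K
  g χ = W χ ψ

  φ-char : IsCharacter φ
  φ-char = φ-character 2≢0

  4≢0 : 4F ≢ 0F
  4≢0 e = *F≢0 2≢0 2≢0 (≡.trans (solveF 0 (num (+ 2) ⊗ num (+ 2) ≋ num (+ 4)) ≡.refl) e)

  ψ-≡ : ∀ {x y} → x ≡ y → ψ x ≈ ψ y
  ψ-≡ e = ≡⇒≈ (≡.cong ψ e)

  ψ-split : ∀ {x y z} → x ≡ y +F z → ψ x ≈ ψ y * ψ z
  ψ-split e = trans (ψ-≡ e) (ψ-+ _ _)

  Wε-ψ : ∀ c → W ε (λ z → ψ (c *F z)) ≈ δ c * q - 1#
  Wε-ψ c = begin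
    W ε (λ z → ψ (c *F z))
      ≈⟨ Σ-cong (λ z → trans (*-congʳ (ε+δ z)) (trans
           (solve 2 (λ d p → (con (+ 1) :- d) :* p := p :- d :* p) refl (δ z) _)
           (+-congˡ (-‿cong (trans (δ-*-cong (at-zero z)) (*-congʳ (δ-⇔ (shift z) (unshift z)))))))) ⟩
    sumF (λ z → ψ (c *F z) - δ (z -F 0F) * 1#)
      ≈⟨ Σ-- _ _ ⟩
    sumF (λ z → ψ (c *F z)) - sumF (λ z → δ (z -F 0F) * 1#)
      ≈⟨ +-cong (ψ-orthogonal c) (-‿cong (Σ-δ 0F (λ _ → 1#))) ⟩
    δ c * q - 1# ∎
    where
    at-zero : ∀ z → z ≡ 0F → ψ (c *F z) ≈ 1#
    at-zero z ≡.refl = trans (ψ-≡ (RF.zeroʳ c)) ψ-0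
    shift : ∀ z → z ≡ 0F → z -F 0F ≡ 0F
    shift z e = x-x≡0 e
    unshift : ∀ z → z -F 0F ≡ 0F → z ≡ 0F
    unshift z e = sub≡0 e

  twist-≢0 : ∀ {χ} → IsCharacter χ → ∀ {u} → u ≢ 0F →
             W χ (λ z → ψ (u *F z)) ≈ conj χ u * g χ
  twist-≢0 {χ} c {u} n = begin
    W χ (λ z → ψ (u *F z))                            ≈⟨ W-scale c (invF≢0 n) _ ⟩
    conj χ u * W χ (λ z → ψ (u *F (invF u *F z)))     ≈⟨ *-congˡ (Σ-cong λ z → *-congˡ (ψ-≡ (modulo z (invF-inverse u n)
      (solveF 3 (λ u i z → u ⊗ (i ⊗ z) ≋ z ⊕ (u ⊗ i ⊖ num (+ 1)) ⊗ z) ≡.refl u (invF u) z)))) ⟩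
    conj χ u * g χ                                    ∎

  -- At u = 0 the left side is the full sum of χ, which vanishes by nontriviality; `twist-≢0` serves
  -- where u is known to be nonzero.
  twist : ∀ {χ} → IsCharacter χ → Nontrivial χ → ∀ u →
          W χ (λ z → ψ (u *F z)) ≈ conj χ u * g χ
  twist {χ} c nt u with u ≟F 0F
  ... | no n       = twist-≢0 c n
  ... | yes ≡.refl = begin
    W χ (λ z → ψ (0F *F z))     ≈⟨ Σ-cong (λ z → trans (*-congˡ (trans (ψ-≡ (RF.zeroˡ z)) ψ-0)) (*-identityʳ _)) ⟩
    sumF χ                      ≈⟨ Σ-nontrivial c nt ⟩
    0#                          ≈⟨ sym (zeroˡ _) ⟩
    0# * g χ                    ≈⟨ *-congʳ (sym (at-0 (conj-character c))) ⟩
    conj χ 0F * g χ             ∎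

  -1≢0 : -F 1F ≢ 0F
  -1≢0 e = 0≢1F (≡.trans (≡.sym (RF.-‿inverseʳ 1F)) (≡.trans (≡.cong (1F +F_) e) (RF.+-identityʳ 1F)))

  -≢0 : ∀ {x} → x ≢ 0F → -F x ≢ 0F
  -≢0 {x} n e = *F≢0 -1≢0 n (≡.trans (solveF 1 (λ x → num -[1+ 0 ] ⊗ x ≋ ⊝ x) ≡.refl x) e)

  at-≉0 : ∀ {χ} → IsCharacter χ → ∀ {x} → x ≢ 0F → ¬ (χ x ≈ 0#)
  at-≉0 c n e = 1≉0 (trans (sym (*-conj c n)) (trans (*-congʳ e) (zeroˡ _)))

  at-square-unit : ∀ {χ} → IsCharacter χ → ∀ {u} → u *F u ≡ 1F → χ u * χ u ≈ 1#
  at-square-unit {χ} c e = trans (sym (at-* c _ _)) (trans (≡⇒≈ (≡.cong χ e)) (at-1 c))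

  -1²≡1 : (-F 1F) *F (-F 1F) ≡ 1F
  -1²≡1 = solveF 0 (num -[1+ 0 ] ⊗ num -[1+ 0 ] ≋ num (+ 1)) ≡.refl

  at-minus : ∀ {χ} → IsCharacter χ → ∀ x → χ (-F x) ≈ χ (-F 1F) * χ x
  at-minus {χ} c x = trans (≡⇒≈ (≡.cong χ (solveF 1 (λ x → ⊝ x ≋ num -[1+ 0 ] ⊗ x) ≡.refl x))) (at-* c _ _)

  -- Writing g(χ)χ̄(y) as a twisted sum over z makes the sum over y purely additive, and it singles
  -- out z = -1.
  g-conj : ∀ {χ} → IsCharacter χ → Nontrivial χ → g χ * g (conj χ) ≈ χ (-F 1F) * q
  g-conj {χ} c nt = begin
    g χ * g (conj χ)
      ≈⟨ sym (W-*ˡ (conj χ) (g χ) ψ) ⟩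
    W (conj χ) (λ y → g χ * ψ y)
      ≈⟨ Σ-cong (λ y → trans (sym (*-assoc _ _ _)) (*-congʳ (sym (twist c nt y)))) ⟩
    sumF (λ y → W χ (λ z → ψ (y *F z)) * ψ y)
      ≈⟨ Σ-cong (λ y → trans (*-comm _ _) (sym (W-*ˡ χ (ψ y) _))) ⟩
    sumF (λ y → W χ (λ z → ψ y * ψ (y *F z)))
      ≈⟨ sym (W-Σ χ _) ⟩
    W χ (λ z → sumF (λ y → ψ y * ψ (y *F z)))
      ≈⟨ Σ-cong (λ z → *-congˡ (trans
           (Σ-cong λ y → sym (ψ-split (solveF 2 (λ y z → (z ⊖ num -[1+ 0 ]) ⊗ y ≋ y ⊕ y ⊗ z) ≡.refl y z)))
           (ψ-orthogonal (z -F (-F 1F))))) ⟩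
    W χ (λ z → δ (z -F (-F 1F)) * q)
      ≈⟨ Σ-cong (λ z → solve 3 (λ a b q → a :* (b :* q) := b :* (a :* q)) refl _ _ _) ⟩
    sumF (λ z → δ (z -F (-F 1F)) * (χ z * q))
      ≈⟨ Σ-δ (-F 1F) (λ z → χ z * q) ⟩
    χ (-F 1F) * q ∎

  -- For nontrivial χ this is `g-conj`; for trivial χ the Gauss sum is -1. Triviality is not
  -- decided: since a contradiction is the goal, it suffices that both cases are refuted.
  g≉0 : ∀ {χ} → IsCharacter χ → ¬ (g χ ≈ 0#)
  g≉0 {χ} c g≈0 = nontrivial-absurd λ trivial → 1≉0 (begin
    1#                    ≈⟨ solve 1 (λ q → con (+ 1) := :- (con (+ 0) :* q :- con (+ 1))) refl q ⟩
    - (0# * q - 1#)       ≈⟨ -‿cong (+-congʳ (*-congʳ (sym (δ-≢0 (λ e → 0≢1F (≡.sym e)))))) ⟩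
    - (δ 1F * q - 1#)     ≈⟨ -‿cong (sym (Wε-ψ 1F)) ⟩
    - W ε (λ z → ψ (1F *F z))
      ≈⟨ -‿cong (W-cong ε-0 (at-0 c) λ z n → *-cong (trans (ε-≢0 n) (sym (trivial z n))) (ψ-≡ (RF.*-identityˡ z))) ⟩
    - g χ                 ≈⟨ -‿cong g≈0 ⟩
    - 0#                  ≈⟨ solve 0 (:- con (+ 0) := con (+ 0)) refl ⟩
    0#                    ∎)
    where
    nontrivial-absurd : ¬ Nontrivial χ
    nontrivial-absurd nt = *≉0 (at-≉0 c -1≢0) q≉0
      (trans (sym (g-conj c nt)) (trans (*-congʳ g≈0) (zeroˡ _)))

  -- Summing over t = s² with weight 1 + φ(t), the part with weight 1 is a complete additive sum and
  -- vanishes.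
  quadratic : ∀ {a} → a ≢ 0F → sumF (λ s → ψ (a *F (s *F s))) ≈ φ a * g φ
  quadratic {a} n = begin
    sumF (λ s → ψ (a *F (s *F s)))                ≈⟨ Σ-squares 2≢0 (λ t → ψ (a *F t)) ⟩
    sumF (λ t → (1# + φ t) * ψ (a *F t))          ≈⟨ Σ-cong (λ t → trans (distribʳ _ _ _) (+-congʳ (*-identityˡ _))) ⟩
    sumF (λ t → ψ (a *F t) + φ t * ψ (a *F t))    ≈⟨ Σ-+ _ _ ⟩
    sumF (λ t → ψ (a *F t)) + W φ (λ t → ψ (a *F t))
      ≈⟨ +-cong (trans (ψ-orthogonal a) (trans (*-congʳ (δ-≢0 n)) (zeroˡ q))) (twist-≢0 φ-char n) ⟩
    0# + conj φ a * g φ                           ≈⟨ +-identityˡ _ ⟩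
    conj φ a * g φ                                ≈⟨ *-congʳ (φ-inv a) ⟩
    φ a * g φ                                     ∎

  Σψ-linear : ∀ {c} → c ≢ 0F → sumF (λ x → ψ (c *F x)) ≈ 0#
  Σψ-linear n = trans (ψ-orthogonal _) (trans (*-congʳ (δ-≢0 n)) (zeroˡ q))

  φ-nontrivial : Nontrivial φ
  φ-nontrivial t = Σε≉0 (trans (sym (Σ-trivial φ-char t)) (Σφ 2≢0))

  gφ² : g φ * g φ ≈ φ (-F 1F) * q
  gφ² = trans (*-congˡ (W-weight ψ λ x → sym (φ-inv x))) (g-conj φ-char φ-nontrivial)

  -- φ(-z) g(φ) is expanded as Σ_s ψ(-(s - z)²/z), after which the sum over z
  -- is an additive character sum.
  hasse-davenport-2 : ∀ {χ} → IsCharacter χ →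
    (φ (-F 1F) * g φ) * (g χ * g (φ · χ)) ≈ q * (conj χ 4F * g (χ · χ))
  hasse-davenport-2 {χ} c = begin
    κ * (g χ * g (φ · χ))
      ≈⟨ *-congˡ (sym (W-*ˡ (φ · χ) (g χ) ψ)) ⟩
    κ * W (φ · χ) (λ z → g χ * ψ z)
      ≈⟨ *-congˡ (W-cong (at-0 (·-character φ-char c)) φ-0 inner) ⟩
    κ * W φ (λ z → W χ (λ t → ψ (invF z *F t +F z)))
      ≈⟨ sym (W-*ˡ φ κ _) ⟩
    W φ (λ z → κ * W χ (λ t → ψ (invF z *F t +F z)))
      ≈⟨ W-cong φ-0 ε-0 (λ z n → complete-square z n (W χ (λ t → ψ (invF z *F t +F z)))) ⟩
    W ε (λ z → W χ (λ t → ψ (invF z *F t +F z)) * sumF (λ s → ψ ((-F invF z) *F ((s -F z) *F (s -F z)))))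
      ≈⟨ W-congʳ ε-0 (λ z n → trans (sym (Σ-*ʳ _ _)) (trans (Σ-cong λ t → *-assoc _ _ _)
           (Σ-cong λ t → *-congˡ (trans (sym (Σ-*ˡ _ _)) (Σ-cong λ s → exponent z n t s))))) ⟩
    W ε (λ z → W χ (λ t → sumF (λ s → ψ (natF 2 *F s) * ψ ((t -F (s *F s)) *F invF z))))
      ≈⟨ trans (W-swap ε χ _) (Σ-cong λ t → *-congˡ (W-Σ ε _)) ⟩
    W χ (λ t → sumF (λ s → W ε (λ z → ψ (natF 2 *F s) * ψ ((t -F (s *F s)) *F invF z))))
      ≈⟨ Σ-cong (λ t → *-congˡ (Σ-cong λ s → trans (W-*ˡ ε _ _) (*-congˡ (collapse t s)))) ⟩
    W χ (λ t → sumF (λ s → ψ (natF 2 *F s) * (δ (t -F (s *F s)) * q - 1#)))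
      ≈⟨ Σ-cong (λ t → *-congˡ (drop t)) ⟩
    W χ (λ t → q * sumF (λ s → δ (t -F (s *F s)) * ψ (natF 2 *F s)))
      ≈⟨ W-*ˡ χ q _ ⟩
    q * W χ (λ t → sumF (λ s → δ (t -F (s *F s)) * ψ (natF 2 *F s)))
      ≈⟨ *-congˡ (trans (W-Σ χ _) (Σ-cong λ s → trans
           (Σ-cong λ t → solve 3 (λ a b d → a :* (b :* d) := b :* (a :* d)) refl _ _ _) (Σ-δ (s *F s) _))) ⟩
    q * sumF (λ s → χ (s *F s) * ψ (natF 2 *F s))
      ≈⟨ *-congˡ (Σ-cong λ s → *-congʳ (at-* c s s)) ⟩
    q * W (χ · χ) (λ s → ψ (natF 2 *F s))
      ≈⟨ *-congˡ (twist-≢0 (·-character c c) 2≢0) ⟩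
    q * (conj (χ · χ) 2F * g (χ · χ))
      ≈⟨ *-congˡ (*-congʳ (trans (sym (at-* c _ _)) (≡⇒≈ (≡.cong χ (≡.trans (≡.sym (invF-* 2F 2F))
           (≡.cong invF (solveF 0 (num (+ 2) ⊗ num (+ 2) ≋ num (+ 4)) ≡.refl))))))) ⟩
    q * (conj χ 4F * g (χ · χ)) ∎
    where
    κ = φ (-F 1F) * g φ
    inner : ∀ z → z ≢ 0F → (φ · χ) z * (g χ * ψ z) ≈ φ z * W χ (λ t → ψ (invF z *F t +F z))
    inner z n = begin
      (φ z * χ z) * (g χ * ψ z)
        ≈⟨ *-congˡ (trans (*-comm _ _) (sym (W-*ˡ χ (ψ z) ψ))) ⟩
      (φ z * χ z) * W χ (λ t → ψ z * ψ t)
        ≈⟨ *-congˡ (W-scale c (invF≢0 n) _) ⟩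
      (φ z * χ z) * (conj χ z * W χ (λ t → ψ z * ψ (invF z *F t)))
        ≈⟨ solve 4 (λ f x y w → (f :* x) :* (y :* w) := (f :* w) :* (x :* y)) refl _ _ _ _ ⟩
      (φ z * W χ (λ t → ψ z * ψ (invF z *F t))) * (χ z * conj χ z)
        ≈⟨ *-cong (*-congˡ (Σ-cong λ t → *-congˡ (sym (ψ-split (RF.+-comm _ _))))) (*-conj c n) ⟩
      (φ z * W χ (λ t → ψ (invF z *F t +F z))) * 1#
        ≈⟨ *-identityʳ _ ⟩
      φ z * W χ (λ t → ψ (invF z *F t +F z)) ∎
    complete-square : ∀ z → z ≢ 0F → ∀ X →
      φ z * (κ * X) ≈ ε z * (X * sumF (λ s → ψ ((-F invF z) *F ((s -F z) *F (s -F z)))))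
    complete-square z n X = begin
      φ z * ((φ (-F 1F) * g φ) * X)
        ≈⟨ solve 4 (λ f m k x → f :* ((m :* k) :* x) := x :* ((m :* f) :* k)) refl _ _ _ X ⟩
      X * ((φ (-F 1F) * φ z) * g φ)
        ≈⟨ *-congˡ (*-congʳ (trans (*-congˡ (sym (φ-inv z))) (sym (at-minus φ-char (invF z))))) ⟩
      X * (φ (-F invF z) * g φ)
        ≈⟨ *-congˡ (sym (quadratic (-≢0 (invF≢0 n)))) ⟩
      X * sumF (λ s → ψ ((-F invF z) *F (s *F s)))
        ≈⟨ *-congˡ (sym (Σ-shift (-F z) _)) ⟩
      X * sumF (λ s → ψ ((-F invF z) *F ((s -F z) *F (s -F z))))
        ≈⟨ sym (*-identityˡ _) ⟩
      1# * (X * sumF (λ s → ψ ((-F invF z) *F ((s -F z) *F (s -F z)))))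
        ≈⟨ *-congʳ (sym (ε-≢0 n)) ⟩
      ε z * (X * sumF (λ s → ψ ((-F invF z) *F ((s -F z) *F (s -F z))))) ∎
    exponent : ∀ z → z ≢ 0F → ∀ t s →
      ψ (invF z *F t +F z) * ψ ((-F invF z) *F ((s -F z) *F (s -F z)))
      ≈ ψ (natF 2 *F s) * ψ ((t -F (s *F s)) *F invF z)
    exponent z n t s = trans (sym (ψ-+ _ _)) (ψ-split (modulo ((natF 2 *F s) -F z) (invF-inverse z n)
      (solveF 4 (λ z i t s → (i ⊗ t ⊕ z) ⊕ (⊝ i) ⊗ ((s ⊖ z) ⊗ (s ⊖ z))
        ≋ (num (+ 2) ⊗ s ⊕ (t ⊖ s ⊗ s) ⊗ i) ⊕ (z ⊗ i ⊖ num (+ 1)) ⊗ (num (+ 2) ⊗ s ⊖ z)) ≡.refl z (invF z) t s)))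
    collapse : ∀ t s → W ε (λ z → ψ ((t -F (s *F s)) *F invF z)) ≈ δ (t -F (s *F s)) * q - 1#
    collapse t s = trans (W-inv ε _) (trans (W-cong (trans (≡⇒≈ (≡.cong ε invF-zero)) ε-0) ε-0
      λ z n → *-cong (trans (ε-≢0 (invF≢0 n)) (sym (ε-≢0 n))) (ψ-≡ (≡.cong ((t -F (s *F s)) *F_) (invF-involutive z))))
      (Wε-ψ _))
    -- The -1 left by the omitted z = 0 contributes the sum of ψ(2s), which is 0.
    drop : ∀ t → sumF (λ s → ψ (natF 2 *F s) * (δ (t -F (s *F s)) * q - 1#))
               ≈ q * sumF (λ s → δ (t -F (s *F s)) * ψ (natF 2 *F s))
    drop t = begin
      sumF (λ s → ψ (natF 2 *F s) * (δ (t -F (s *F s)) * q - 1#))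
        ≈⟨ Σ-cong (λ s → solve 3 (λ p d q → p :* (d :* q :- con (+ 1)) := q :* (d :* p) :- p) refl _ _ q) ⟩
      sumF (λ s → q * (δ (t -F (s *F s)) * ψ (natF 2 *F s)) - ψ (natF 2 *F s))
        ≈⟨ trans (Σ-- _ _) (+-cong (Σ-*ˡ q _) (-‿cong (Σψ-linear 2≢0))) ⟩
      q * sumF (λ s → δ (t -F (s *F s)) * ψ (natF 2 *F s)) - 0#
        ≈⟨ solve 1 (λ a → a :- con (+ 0) := a) refl _ ⟩
      q * sumF (λ s → δ (t -F (s *F s)) * ψ (natF 2 *F s)) ∎


  -- For χ = AB̄ the factor χ̄(1 - y) times g(χ) is the sum of χ(w)ψ((1 - y)w). Replacing y by -y/w
  -- separates the exponent into w + y and moves the coupling into the argument of f. The function f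
  -- stays arbitrary so that the step can be applied to two variables, one inside the other.
  euler : ∀ {A B} → IsCharacter A → IsCharacter B → Nontrivial (A · conj B) → ∀ f →
    g (A · conj B) * W A (λ y → (conj A · B) (1F -F y) * f y)
    ≈ A (-F 1F) * W (conj B) (λ w → W A (λ y → ψ (w +F y) * f (-F (invF w *F y))))
  euler {A} {B} cA cB nt f = begin
    g χ * W A (λ y → (conj A · B) (1F -F y) * f y)
      ≈⟨ sym (W-*ˡ A (g χ) _) ⟩
    W A (λ y → g χ * ((conj A · B) (1F -F y) * f y))
      ≈⟨ Σ-cong (λ y → *-congˡ (unfold y)) ⟩
    W A (λ y → W χ (λ w → ψ ((1F -F y) *F w) * f y))
      ≈⟨ W-swap A χ _ ⟩
    W χ (λ w → W A (λ y → ψ ((1F -F y) *F w) * f y))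
      ≈⟨ W-cong (at-0 cχ) (at-0 (conj-character cB)) inner ⟩
    W (conj B) (λ w → A (-F 1F) * W A (λ y → ψ (w +F y) * f (-F (invF w *F y))))
      ≈⟨ W-*ˡ (conj B) (A (-F 1F)) _ ⟩
    A (-F 1F) * W (conj B) (λ w → W A (λ y → ψ (w +F y) * f (-F (invF w *F y)))) ∎
    where
    χ = A · conj B
    cχ = ·-character cA (conj-character cB)
    unfold : ∀ y → g χ * ((conj A · B) (1F -F y) * f y) ≈ W χ (λ w → ψ ((1F -F y) *F w) * f y)
    unfold y = begin
      g χ * ((conj A · B) (1F -F y) * f y)
        ≈⟨ solve 4 (λ g a b f → g :* ((a :* b) :* f) := ((a :* b) :* g) :* f) refl _ _ _ _ ⟩
      ((conj A · B) (1F -F y) * g χ) * f y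
        ≈⟨ *-congʳ (*-congʳ (*-congˡ (sym (conj-conj B _)))) ⟩
      (conj χ (1F -F y) * g χ) * f y
        ≈⟨ *-congʳ (sym (twist cχ nt _)) ⟩
      W χ (λ w → ψ ((1F -F y) *F w)) * f y
        ≈⟨ sym (Σ-*ʳ (f y) _) ⟩
      sumF (λ w → (χ w * ψ ((1F -F y) *F w)) * f y)
        ≈⟨ Σ-cong (λ w → *-assoc _ _ _) ⟩
      W χ (λ w → ψ ((1F -F y) *F w) * f y) ∎
    inner : ∀ w → w ≢ 0F →
      χ w * W A (λ y → ψ ((1F -F y) *F w) * f y)
      ≈ conj B w * (A (-F 1F) * W A (λ y → ψ (w +F y) * f (-F (invF w *F y))))
    inner w n = begin
      (A w * conj B w) * W A (λ y → ψ ((1F -F y) *F w) * f y)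
        ≈⟨ *-congˡ (W-scale cA (-≢0 (invF≢0 n)) _) ⟩
      (A w * conj B w) * (A (-F invF w) * W A (λ y → ψ ((1F -F ((-F invF w) *F y)) *F w) * f ((-F invF w) *F y)))
        ≈⟨ *-congˡ (*-cong (at-minus cA (invF w)) (Σ-cong λ y → *-congˡ (*-cong
             (ψ-≡ (modulo y (invF-inverse w n)
               (solveF 3 (λ w i y → (num (+ 1) ⊖ (⊝ i) ⊗ y) ⊗ w ≋ (w ⊕ y) ⊕ (w ⊗ i ⊖ num (+ 1)) ⊗ y) ≡.refl w (invF w) y)))
             (≡⇒≈ (≡.cong f (solveF 2 (λ i y → (⊝ i) ⊗ y ≋ ⊝ (i ⊗ y)) ≡.refl (invF w) y)))))) ⟩
      (A w * conj B w) * ((A (-F 1F) * conj A w) * W A (λ y → ψ (w +F y) * f (-F (invF w *F y))))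
        ≈⟨ solve 5 (λ a b m c s → (a :* b) :* ((m :* c) :* s) := (a :* c) :* (b :* (m :* s))) refl _ _ _ _ _ ⟩
      (A w * conj A w) * (conj B w * (A (-F 1F) * W A (λ y → ψ (w +F y) * f (-F (invF w *F y)))))
        ≈⟨ trans (*-congʳ (*-conj cA n)) (*-identityˡ _) ⟩
      conj B w * (A (-F 1F) * W A (λ y → ψ (w +F y) * f (-F (invF w *F y)))) ∎

  -- The case f = 1 of `euler`, where the double sum separates.
  jacobi : ∀ {A B} → IsCharacter A → IsCharacter B → Nontrivial (A · conj B) →
    g (A · conj B) * J A (B · conj A) ≈ A (-F 1F) * (g A * g (conj B))
  jacobi {A} {B} cA cB nt = begin
    g (A · conj B) * J A (B · conj A)
      ≈⟨ *-congˡ (Σ-cong λ y → *-congˡ (trans (*-comm _ _) (sym (*-identityʳ _)))) ⟩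
    g (A · conj B) * W A (λ y → (conj A · B) (1F -F y) * 1#)
      ≈⟨ euler cA cB nt (λ _ → 1#) ⟩
    A (-F 1F) * W (conj B) (λ w → W A (λ y → ψ (w +F y) * 1#))
      ≈⟨ *-congˡ (Σ-cong λ w → *-congˡ (trans (Σ-cong λ y → *-congˡ (trans (*-identityʳ _) (ψ-+ w y))) (W-*ˡ A (ψ w) ψ))) ⟩
    A (-F 1F) * W (conj B) (λ w → ψ w * g A)
      ≈⟨ *-congˡ (trans (Σ-cong λ w → sym (*-assoc _ _ _)) (trans (Σ-*ʳ (g A) _) (*-comm _ _))) ⟩
    A (-F 1F) * (g A * g (conj B)) ∎

  jacobi≉0 : ∀ {A B} → IsCharacter A → IsCharacter B → Nontrivial (A · conj B) →
    ¬ (J A (B · conj A) ≈ 0#)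
  jacobi≉0 cA cB nt e = *≉0 (at-≉0 cA -1≢0) (*≉0 (g≉0 cA) (g≉0 (conj-character cB)))
    (trans (sym (jacobi cA cB nt)) (trans (*-congˡ e) (zeroʳ _)))

  -- What remains of ₃P₂ after two `euler` steps and after Ā₁(1 - λxy) is written as a sum over z:
  -- one character per variable and values of ψ, coupled only through λxyz/(vw).
  kernel : (A₁ A₂ A₃ B₁ B₂ : F → K) → F → K
  kernel A₁ A₂ A₃ B₁ B₂ λ′ =
    W (conj B₂) λ v → W A₃ λ x → ψ (v +F x) * W (conj B₁) λ w → W A₂ λ y → ψ (w +F y) *
      W A₁ λ z → ψ ((1F -F (λ′ *F (-F (invF v *F x)) *F (-F (invF w *F y)))) *F z)

  -- g(A₂B̄₁) and g(A₃B̄₂) play two roles: they turn the Jacobi sums of the denominator into Gauss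
  -- sums, and they are the factors that `euler` consumes. Hence they drop out of the formula.
  ₃F₂-kernel : ∀ {A₁ A₂ A₃ B₁ B₂} → IsCharacter A₁ → IsCharacter A₂ → IsCharacter A₃ →
    IsCharacter B₁ → IsCharacter B₂ →
    Nontrivial A₁ → Nontrivial (A₂ · conj B₁) → Nontrivial (A₃ · conj B₂) → ∀ λ′ →
    (g A₁ * ((g A₂ * g (conj B₁)) * (g A₃ * g (conj B₂)))) * ₃F₂ A₁ A₂ A₃ B₁ B₂ λ′
    ≈ kernel A₁ A₂ A₃ B₁ B₂ λ′
  ₃F₂-kernel {A₁} {A₂} {A₃} {B₁} {B₂} c₁ c₂ c₃ d₁ d₂ n₁ n₂ n₃ λ′ =
    -- `jacobi` and `euler` both bring in the signs A₂(-1) and A₃(-1), which are therefore placed on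
    -- both sides and cancelled.
    cancel (*≉0 (at-≉0 c₂ -1≢0) (at-≉0 c₃ -1≢0)) (begin
      (s₂ * s₃) * ((g A₁ * ((g A₂ * g (conj B₁)) * (g A₃ * g (conj B₂)))) * (P * inv (J₂ * J₃)))
        ≈⟨ solve 9 (λ s t a b c d e p i → (s :* t) :* ((a :* ((b :* c) :* (d :* e))) :* (p :* i))
             := ((s :* (b :* c)) :* (t :* (d :* e))) :* (a :* (p :* i))) refl _ _ _ _ _ _ _ P _ ⟩
      ((s₂ * (g A₂ * g (conj B₁))) * (s₃ * (g A₃ * g (conj B₂)))) * (g A₁ * (P * inv (J₂ * J₃)))
        ≈⟨ *-congʳ (*-cong (sym (jacobi c₂ d₁ n₂)) (sym (jacobi c₃ d₂ n₃))) ⟩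
      ((g χ₂ * J₂) * (g χ₃ * J₃)) * (g A₁ * (P * inv (J₂ * J₃)))
        ≈⟨ solve 7 (λ u j v k a p i → ((u :* j) :* (v :* k)) :* (a :* (p :* i))
             := (v :* (u :* (a :* p))) :* ((j :* k) :* i)) refl _ J₂ _ J₃ _ P _ ⟩
      (g χ₃ * (g χ₂ * (g A₁ * P))) * ((J₂ * J₃) * inv (J₂ * J₃))
        ≈⟨ trans (*-congˡ (inv-inverse _ (*≉0 (jacobi≉0 c₂ d₁ n₂) (jacobi≉0 c₃ d₂ n₃)))) (*-identityʳ _) ⟩
      g χ₃ * (g χ₂ * (g A₁ * P))
        ≈⟨ *-congˡ push ⟩
      g χ₃ * (s₂ * W A₃ (λ x → (conj A₃ · B₂) (1F -F x) * f₃ x))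
        ≈⟨ solve 3 (λ a b c → a :* (b :* c) := b :* (a :* c)) refl _ _ _ ⟩
      s₂ * (g χ₃ * W A₃ (λ x → (conj A₃ · B₂) (1F -F x) * f₃ x))
        ≈⟨ *-congˡ (euler c₃ d₂ n₃ f₃) ⟩
      s₂ * (s₃ * kernel A₁ A₂ A₃ B₁ B₂ λ′)
        ≈⟨ sym (*-assoc _ _ _) ⟩
      (s₂ * s₃) * kernel A₁ A₂ A₃ B₁ B₂ λ′ ∎)
    where
    s₂ = A₂ (-F 1F)
    s₃ = A₃ (-F 1F)
    χ₂ = A₂ · conj B₁
    χ₃ = A₃ · conj B₂
    J₂ = J A₂ (B₁ · conj A₂)
    J₃ = J A₃ (B₂ · conj A₃)
    P = ₃P₂ A₁ A₂ A₃ B₁ B₂ λ′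
    f₂ : F → F → K
    f₂ x y = W A₁ λ z → ψ ((1F -F (λ′ *F x *F y)) *F z)
    f₃ : F → K
    f₃ x = W (conj B₁) λ w → W A₂ λ y → ψ (w +F y) * f₂ x (-F (invF w *F y))
    term : ∀ x y → g A₁ * (A₃ x * (conj A₃ · B₂) (1F -F x) * A₂ y * (conj A₂ · B₁) (1F -F y)
                            * conj A₁ (1F -F (λ′ *F x *F y)))
                 ≈ (A₃ x * (conj A₃ · B₂) (1F -F x)) * (A₂ y * ((conj A₂ · B₁) (1F -F y) * f₂ x y))
    term x y = trans
      (solve 6 (λ g a b c d e → g :* ((((a :* b) :* c) :* d) :* e) := (a :* b) :* (c :* (d :* (e :* g))))
        refl _ _ _ _ _ _)
      (*-congˡ (*-congˡ (*-congˡ (sym (twist c₁ n₁ _)))))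
    push : g χ₂ * (g A₁ * P) ≈ s₂ * W A₃ (λ x → (conj A₃ · B₂) (1F -F x) * f₃ x)
    push = begin
      g χ₂ * (g A₁ * P)
        ≈⟨ *-congˡ (trans (sym (Σ-*ˡ (g A₁) _)) (Σ-cong λ x → trans (sym (Σ-*ˡ (g A₁) _))
             (trans (Σ-cong λ y → term x y) (Σ-*ˡ _ _)))) ⟩
      g χ₂ * sumF (λ x → (A₃ x * (conj A₃ · B₂) (1F -F x)) * W A₂ (λ y → (conj A₂ · B₁) (1F -F y) * f₂ x y))
        ≈⟨ trans (sym (Σ-*ˡ (g χ₂) _)) (Σ-cong λ x → trans
             (solve 3 (λ g a w → g :* (a :* w) := a :* (g :* w)) refl _ _ _)
             (trans (*-congˡ (euler c₂ d₁ n₂ (f₂ x)))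
               (solve 4 (λ a b s w → (a :* b) :* (s :* w) := s :* (a :* (b :* w))) refl _ _ _ _))) ⟩
      sumF (λ x → s₂ * (A₃ x * ((conj A₃ · B₂) (1F -F x) * f₃ x)))
        ≈⟨ Σ-*ˡ s₂ _ ⟩
      s₂ * W A₃ (λ x → (conj A₃ · B₂) (1F -F x) * f₃ x) ∎

-- Cubic characters, Cardano's formula and Hasse-Davenport for cubes

module Cubic (𝔽 : FiniteField) (𝕂 : CoeffField) (setting : AdditiveSetting 𝔽 𝕂) (cubicCharacter : CubicCharacter 𝔽 𝕂) where
  open Ops 𝔽 𝕂
  open FieldFacts 𝔽 𝕂
  open CoefficientFacts 𝔽 𝕂
  open Characters 𝔽 𝕂
  open AdditiveSetting setting
  open CubicCharacter cubicCharacter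
  open GaussSums 𝔽 𝕂 setting
  open import Relation.Binary.Reasoning.Setoid setoid

  cub : F → F
  cub k = k *F k *F k

  cub≢0 : ∀ {k} → k ≢ 0F → cub k ≢ 0F
  cub≢0 n = *F≢0 (*F≢0 n n) n

  at-cub : ∀ {χ} → IsCharacter χ → ∀ k → χ (cub k) ≈ cube χ k
  at-cub c k = trans (at-* c _ _) (*-congʳ (at-* c k k))

  η-cub : ∀ {k} → k ≢ 0F → η (cub k) ≈ 1#
  η-cub n = trans (at-cub η-char _) (η³-trivial _ n)

  η̄-cub : ∀ {k} → k ≢ 0F → conj η (cub k) ≈ 1#
  η̄-cub {k} n = trans (≡⇒≈ (≡.cong η (≡.trans (invF-* _ _) (≡.cong (_*F invF k) (invF-* k k))))) (η-cub (invF≢0 n))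

  conj-η : ∀ {x} → x ≢ 0F → conj η x ≈ η x * η x
  conj-η {x} n = begin
    conj η x                          ≈⟨ sym (*-identityˡ _) ⟩
    1# * conj η x                     ≈⟨ *-congʳ (sym (η³-trivial x n)) ⟩
    (η x * η x * η x) * conj η x      ≈⟨ *-assoc _ _ _ ⟩
    (η x * η x) * (η x * conj η x)    ≈⟨ *-congˡ (*-conj η-char n) ⟩
    (η x * η x) * 1#                  ≈⟨ *-identityʳ _ ⟩
    η x * η x                         ∎

  Ση̄ : sumF (conj η) ≈ 0#
  Ση̄ = trans (Σ-inv η) (Σ-nontrivial η-char η-nontrivial)

  δ*≈0 : ∀ {y a} → (y ≡ 0F → a ≈ 0#) → δ y * a ≈ 0#
  δ*≈0 f = trans (δ-*-cong f) (zeroʳ _)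

  preimage? : (π : F → F) → ∀ t → Dec (∃ λ k → π k ≡ t)
  preimage? π t with any? (λ k → π k ≟F t) elements
  ... | yes a = yes (Any.satisfied a)
  ... | no na = no λ { (k , e) → na (Any.map (λ { ≡.refl → e }) (complete k)) }

  Σ-fibre-sizes : ∀ (π : F → F) → sumF (λ t → 1# - sumF (λ k → δ (π k -F t))) ≈ 0#
  Σ-fibre-sizes π = begin
    sumF (λ t → 1# - sumF (λ k → δ (π k -F t)))        ≈⟨ Σ-- _ _ ⟩
    q - sumF (λ t → sumF (λ k → δ (π k -F t)))         ≈⟨ +-congˡ (-‿cong (trans (Σ-swap _) (Σ-cong λ k →
      trans (Σ-cong λ t → sym (*-identityʳ _)) (Σ-δ′ (π k) (λ _ → 1#))))) ⟩
    q - q                                              ≈⟨ -‿inverseʳ q ⟩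
    0#                                                 ∎

  no-preimage : ∀ {π : F → F} {t} → ¬ (∃ λ k → π k ≡ t) → sumF (λ k → δ (π k -F t)) ≈ 0#
  no-preimage n = trans (Σ-cong λ k → δ-≢0 (λ e → n (k , sub≡0 e))) Σ-0

  -- For an injective map 1 minus the size of a fibre is 0 or 1, and these defects add up to q - q =
  -- 0, so none of them is 1.
  injective⇒surjective : ∀ (π : F → F) → (∀ x y → π x ≡ π y → x ≡ y) → ∀ t → ∃ λ k → π k ≡ t
  injective⇒surjective π inj t with preimage? π t
  ... | yes found = found
  ... | no absent = ⊥-elim (1≉0 (begin
    1#             ≈⟨ solve 0 (con (+ 1) := con (+ 1) :- con (+ 0)) refl ⟩
    1# - 0#        ≈⟨ +-congˡ (-‿cong (sym (no-preimage absent))) ⟩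
    missing t      ≈⟨ Σ-idempotent-≈0 missing idem (Σ-fibre-sizes π) t ⟩
    0#             ∎))
    where
    missing : F → K
    missing t = 1# - sumF (λ k → δ (π k -F t))
    idem : ∀ t → missing t * missing t ≈ missing t
    idem t with preimage? π t
    ... | no n  = trans (*-cong v v) (trans (*-identityˡ 1#) (sym v))
      where
      v : missing t ≈ 1#
      v = trans (+-congˡ (-‿cong (no-preimage n))) (solve 0 (con (+ 1) :- con (+ 0) := con (+ 1)) refl)
    ... | yes (k , e) = trans (*-cong v v) (trans (zeroˡ 0#) (sym v))
      where
      v : missing t ≈ 0#
      v = trans (+-congˡ (-‿cong (trans
        (Σ-single k (λ k → δ (π k -F t)) λ x x≢k → δ-≢0 (λ z → x≢k (inj x k (≡.trans (sub≡0 z) (≡.sym e)))))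
        (δ-≡0 (x-x≡0 e))))) (-‿inverseʳ 1#)

  -- Without a nontrivial cube root of unity cubing would be bijective and η trivial.
  cube-root-of-unity : ∃ λ ω → (ω ≢ 1F) × (cub ω ≡ 1F)
  cube-root-of-unity with any? (λ x → ¬? (x ≟F 1F) ×-dec (cub x ≟F 1F)) elements
  ... | yes a = Any.satisfied a
  ... | no na = ⊥-elim (η-nontrivial λ u u≢0 → trivial u u≢0 (injective⇒surjective cub inj u))
    where
    trivial : ∀ u → u ≢ 0F → (∃ λ k → cub k ≡ u) → η u ≈ 1#
    trivial u u≢0 (k , ≡.refl) = η-cub λ { ≡.refl → u≢0 (RF.zeroʳ _) }
    only-1 : ∀ x → cub x ≡ 1F → x ≡ 1F
    only-1 x e with x ≟F 1F
    ... | yes e′ = e′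
    ... | no n   = ⊥-elim (na (Any.map (λ { ≡.refl → n , e }) (complete x)))
    inj : ∀ x y → cub x ≡ cub y → x ≡ y
    inj x y e with y ≟F 0F
    ... | yes ≡.refl with integral (≡.trans e (RF.zeroʳ _))
    ...   | inj₁ z = square≡0 z
    ...   | inj₂ z = z
    inj x y e | no n = ≡.trans (modulo x (≡.sym (invF-inverse y n))
        (solveF 3 (λ x y i → x ≋ y ⊗ (x ⊗ i) ⊕ (num (+ 1) ⊖ y ⊗ i) ⊗ x) ≡.refl x y (invF y)))
      (≡.trans (≡.cong (y *F_) (only-1 (x *F invF y) (≡.trans
        (solveF 2 (λ x i → (x ⊗ i) ⊗ (x ⊗ i) ⊗ (x ⊗ i) ≋ (x ⊗ x ⊗ x) ⊗ (i ⊗ i ⊗ i)) ≡.refl x (invF y))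
        (≡.trans (≡.cong (_*F (cub (invF y))) e)
          (modulo (1F +F y *F invF y +F (y *F invF y) *F (y *F invF y)) (invF-inverse y n)
            (solveF 2 (λ y i → (y ⊗ y ⊗ y) ⊗ (i ⊗ i ⊗ i) ≋ num (+ 1) ⊕ (y ⊗ i ⊖ num (+ 1)) ⊗ (num (+ 1) ⊕ y ⊗ i ⊕ (y ⊗ i) ⊗ (y ⊗ i)))
              ≡.refl y (invF y)))))))
        (RF.*-identityʳ y))

  ω : F
  ω = proj₁ cube-root-of-unity

  ω≢1 : ω ≢ 1F
  ω≢1 = proj₁ (proj₂ cube-root-of-unity)

  ω²+ω+1 : ω *F ω +F ω +F 1F ≡ 0F
  ω²+ω+1 = zero-factor (λ z → ω≢1 (sub≡0 z)) (≡.trans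
    (solveF 1 (λ w → (w ⊖ num (+ 1)) ⊗ (w ⊗ w ⊕ w ⊕ num (+ 1)) ≋ w ⊗ w ⊗ w ⊖ num (+ 1)) ≡.refl ω)
    (x-x≡0 (proj₂ (proj₂ cube-root-of-unity))))

  -- (2ω + 1)² = 4(ω² + ω + 1) - 3. That -3 is a square makes y³ - 3βy injective on the y of
  -- nonsquare discriminant.
  √-3 : F
  √-3 = 2F *F ω +F 1F

  √-3² : √-3 *F √-3 ≡ -F 3F
  √-3² = modulo 4F ω²+ω+1 (solveF 1 (λ w → (num (+ 2) ⊗ w ⊕ num (+ 1)) ⊗ (num (+ 2) ⊗ w ⊕ num (+ 1))
    ≋ (⊝ num (+ 3)) ⊕ ((w ⊗ w ⊕ w ⊕ num (+ 1)) ⊖ num (+ 0)) ⊗ num (+ 4)) ≡.refl ω)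

  √-3≢0 : √-3 ≢ 0F
  √-3≢0 e = 3≢0 (≡.trans (solveF 1 (λ t → t ≋ ⊝ (⊝ t)) ≡.refl 3F)
    (≡.trans (≡.cong -F_ (≡.trans (≡.sym √-3²) (≡.trans (≡.cong (_*F √-3) e) (RF.zeroˡ _))))
      (solveF 0 (⊝ num (+ 0) ≋ num (+ 0)) ≡.refl)))

  ω≢ω² : ω ≢ ω *F ω
  ω≢ω² e = √-3≢0 (≡.trans (modulo 1F e
    (solveF 1 (λ w → num (+ 2) ⊗ w ⊕ num (+ 1) ≋ (w ⊗ w ⊕ w ⊕ num (+ 1)) ⊕ (w ⊖ w ⊗ w) ⊗ num (+ 1)) ≡.refl ω)) ω²+ω+1)

  1≢ω² : 1F ≢ ω *F ω
  1≢ω² e = ω≢1 (≡.trans (modulo ω e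
    (solveF 1 (λ w → w ≋ w ⊗ w ⊗ w ⊕ (num (+ 1) ⊖ w ⊗ w) ⊗ w) ≡.refl ω)) (proj₂ (proj₂ cube-root-of-unity)))

  3# : K
  3# = 1# + (1# + 1#)

  3≉0 : ¬ (3# ≈ 0#)
  3≉0 e = charZero 2 (trans (+-congˡ (+-congˡ (+-identityʳ 1#))) e)

  cube-roots-of-1 : sumF (λ k → δ (cub k -F 1F)) ≈ 3#
  cube-roots-of-1 = begin
    sumF (λ k → δ (cub k -F 1F))
      ≈⟨ Σ-cong roots ⟩
    sumF (λ k → at 1F k + (at ω k + at (ω *F ω) k))
      ≈⟨ trans (Σ-+ (at 1F) _) (+-congˡ (Σ-+ (at ω) _)) ⟩
    sumF (at 1F) + (sumF (at ω) + sumF (at (ω *F ω)))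
      ≈⟨ +-cong (Σ-δ 1F (λ _ → 1#)) (+-cong (Σ-δ ω (λ _ → 1#)) (Σ-δ (ω *F ω) (λ _ → 1#))) ⟩
    3# ∎
    where
    at : F → F → K
    at a k = δ (k -F a) * 1#
    on : ∀ a → at a a ≈ 1#
    on a = trans (*-identityʳ _) (δ-≡0 (x-x≡0 ≡.refl))
    off : ∀ {a k} → k ≢ a → at a k ≈ 0#
    off n = trans (*-identityʳ _) (δ-≢0 (λ e → n (sub≡0 e)))
    factor : ∀ k → (k -F 1F) *F ((k -F ω) *F (k -F (ω *F ω))) ≡ cub k -F 1F
    factor k = modulo ((k -F 1F) *F ((-F k) +F (ω -F 1F))) ω²+ω+1
      (solveF 2 (λ k w → (k ⊖ num (+ 1)) ⊗ ((k ⊖ w) ⊗ (k ⊖ w ⊗ w)) ≋ (k ⊗ k ⊗ k ⊖ num (+ 1))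
        ⊕ ((w ⊗ w ⊕ w ⊕ num (+ 1)) ⊖ num (+ 0)) ⊗ ((k ⊖ num (+ 1)) ⊗ ((⊝ k) ⊕ (w ⊖ num (+ 1))))) ≡.refl k ω)
    cub-ω² : cub (ω *F ω) ≡ 1F
    cub-ω² = ≡.trans (solveF 1 (λ w → (w ⊗ w) ⊗ (w ⊗ w) ⊗ (w ⊗ w) ≋ (w ⊗ w ⊗ w) ⊗ (w ⊗ w ⊗ w)) ≡.refl ω)
      (≡.trans (≡.cong (λ z → z *F z) (proj₂ (proj₂ cube-root-of-unity))) (RF.*-identityˡ 1F))
    roots : ∀ k → δ (cub k -F 1F) ≈ at 1F k + (at ω k + at (ω *F ω) k)
    roots k with k ≟F 1F | k ≟F ω | k ≟F (ω *F ω)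
    ... | yes ≡.refl | _ | _ = trans (δ-≡0 (x-x≡0 (solveF 0 (num (+ 1) ⊗ num (+ 1) ⊗ num (+ 1) ≋ num (+ 1)) ≡.refl)))
      (sym (trans (+-cong (on 1F) (+-cong (off (λ e → ω≢1 (≡.sym e))) (off 1≢ω²)))
        (solve 0 (con (+ 1) :+ (con (+ 0) :+ con (+ 0)) := con (+ 1)) refl)))
    ... | no a | yes e | _ = trans (δ-≡0 (x-x≡0 (≡.trans (≡.cong cub e) (proj₂ (proj₂ cube-root-of-unity)))))
      (sym (trans (+-cong (off a) (+-cong (trans (≡⇒≈ (≡.cong (at ω) e)) (on ω)) (off (λ e′ → ω≢ω² (≡.trans (≡.sym e) e′)))))
        (solve 0 (con (+ 0) :+ (con (+ 1) :+ con (+ 0)) := con (+ 1)) refl)))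
    ... | no a | no b | yes e = trans (δ-≡0 (x-x≡0 (≡.trans (≡.cong cub e) cub-ω²)))
      (sym (trans (+-cong (off a) (+-cong (off b) (trans (≡⇒≈ (≡.cong (at (ω *F ω)) e)) (on (ω *F ω)))))
        (solve 0 (con (+ 0) :+ (con (+ 0) :+ con (+ 1)) := con (+ 1)) refl)))
    ... | no a | no b | no d = trans
      (δ-≢0 (λ e → *F≢0 (λ z → a (sub≡0 z)) (*F≢0 (λ z → b (sub≡0 z)) (λ z → d (sub≡0 z))) (≡.trans (factor k) e)))
      (sym (trans (+-cong (off a) (+-cong (off b) (off d)))
        (solve 0 (con (+ 0) :+ (con (+ 0) :+ con (+ 0)) := con (+ 0)) refl)))

  -- Only nonzero k are counted, so that at t = 0 the count agrees with `cube-weight`, whose three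
  -- characters vanish there.
  cube-count : F → K
  cube-count t = sumF (λ k → ε k * δ (cub k -F t))

  cube-weight : F → K
  cube-weight t = ε t + (η t + conj η t)

  cube-count-cube : ∀ {a} → a ≢ 0F → cube-count (cub a) ≈ 3#
  cube-count-cube {a} n = begin
    sumF (λ k → ε k * δ (cub k -F cub a))
      ≈⟨ Σ-cong (λ k → pointwise k) ⟩
    sumF (λ k → δ (cub k -F cub a))
      ≈⟨ sym (Σ-scale n _) ⟩
    sumF (λ k → δ (cub (a *F k) -F cub a))
      ≈⟨ Σ-cong (λ k → δ-⇔ (to k) (from k)) ⟩
    sumF (λ k → δ (cub k -F 1F))
      ≈⟨ cube-roots-of-1 ⟩
    3# ∎
    where
    pointwise : ∀ k → ε k * δ (cub k -F cub a) ≈ δ (cub k -F cub a)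
    pointwise k with k ≟F 0F
    ... | yes ≡.refl = trans (zeroˡ _) (sym (δ-≢0 (λ e → cub≢0 n (≡.trans (≡.sym (sub≡0 e)) (RF.zeroʳ _)))))
    ... | no _       = *-identityˡ _
    factor : ∀ k → cub (a *F k) -F cub a ≡ cub a *F (cub k -F 1F)
    factor k = solveF 2 (λ a k → (a ⊗ k) ⊗ (a ⊗ k) ⊗ (a ⊗ k) ⊖ a ⊗ a ⊗ a ≋ (a ⊗ a ⊗ a) ⊗ (k ⊗ k ⊗ k ⊖ num (+ 1))) ≡.refl a k
    to : ∀ k → cub (a *F k) -F cub a ≡ 0F → cub k -F 1F ≡ 0F
    to k e = zero-factor (cub≢0 n) (≡.trans (≡.sym (factor k)) e)
    from : ∀ k → cub k -F 1F ≡ 0F → cub (a *F k) -F cub a ≡ 0F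
    from k e = ≡.trans (factor k) (≡.trans (≡.cong (cub a *F_) e) (RF.zeroʳ _))

  cube-count≈0 : ∀ {t} → (∀ k → k ≢ 0F → cub k ≢ t) → cube-count t ≈ 0#
  cube-count≈0 {t} h = trans (Σ-cong term) Σ-0
    where
    term : ∀ k → ε k * δ (cub k -F t) ≈ 0#
    term k with k ≟F 0F
    ... | yes _ = zeroˡ _
    ... | no n  = trans (*-identityˡ _) (δ-≢0 (λ e → h k n (sub≡0 e)))

  -- Off the cubes the difference is 1 + η + η², three times an idempotent,
  -- and the differences sum to 0.
  cube-count≈weight : ∀ t → cube-count t ≈ cube-weight t
  cube-count≈weight t = sym (-≈0⇒≈ (trans (difference t) (trans (*-congˡ (Σ-idempotent-≈0 e idem Σe t)) (zeroʳ _))))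
    where
    third = inv 3#
    E : F → K
    E t = 1# + (η t + η t * η t)
    e : F → K
    e t with t ≟F 0F | preimage? cub t
    ... | no _  | no _  = third * E t
    ... | no _  | yes _ = 0#
    ... | yes _ | _     = 0#
    third-inv : 3# * third ≈ 1#
    third-inv = inv-inverse 3# 3≉0
    idem : ∀ t → e t * e t ≈ e t
    idem t with t ≟F 0F | preimage? cub t
    ... | no n  | no _  = begin
      (third * E t) * (third * E t)
        ≈⟨ solve 2 (λ v h → (v :* (con (+ 1) :+ (h :+ h :* h))) :* (v :* (con (+ 1) :+ (h :+ h :* h)))
             := (v :* v) :* ((con (+ 1) :+ (con (+ 1) :+ con (+ 1))) :* (con (+ 1) :+ (h :+ h :* h))
                  :+ (h :* h :* h :- con (+ 1)) :* (con (+ 2) :+ h))) refl third (η t) ⟩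
      (third * third) * (3# * E t + (η t * η t * η t - 1#) * (natR coeffRing 2 + η t))
        ≈⟨ *-congˡ (trans (+-congˡ (trans (*-congʳ (trans (+-congʳ (η³-trivial t n)) (-‿inverseʳ 1#))) (zeroˡ _))) (+-identityʳ _)) ⟩
      (third * third) * (3# * E t)
        ≈⟨ solve 3 (λ v a b → (v :* v) :* (a :* b) := (a :* v) :* (v :* b)) refl third 3# (E t) ⟩
      (3# * third) * (third * E t)
        ≈⟨ trans (*-congʳ third-inv) (*-identityˡ _) ⟩
      third * E t ∎
    ... | no _  | yes _ = zeroˡ 0#
    ... | yes _ | _     = zeroˡ 0#
    difference : ∀ t → cube-weight t - cube-count t ≈ 3# * e t
    difference t with t ≟F 0F | preimage? cub t
    ... | yes ≡.refl | _ = trans (+-cong (+-cong refl (+-cong (at-0 η-char) (at-0 (conj-character η-char))))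
            (-‿cong (cube-count≈0 λ k n → cub≢0 n)))
          (solve 0 ((con (+ 0) :+ (con (+ 0) :+ con (+ 0))) :- con (+ 0)
            := (con (+ 1) :+ (con (+ 1) :+ con (+ 1))) :* con (+ 0)) refl)
    ... | no n | yes (a , ≡.refl) = trans (+-cong (+-cong refl (+-cong (η-cub a≢0) (η̄-cub a≢0)))
            (-‿cong (cube-count-cube a≢0)))
          (solve 0 ((con (+ 1) :+ (con (+ 1) :+ con (+ 1))) :- (con (+ 1) :+ (con (+ 1) :+ con (+ 1)))
            := (con (+ 1) :+ (con (+ 1) :+ con (+ 1))) :* con (+ 0)) refl)
      where
      a≢0 : a ≢ 0F
      a≢0 ≡.refl = n (RF.zeroʳ _)
    ... | no n | no absent = begin
      (1# + (η t + conj η t)) - cube-count t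
        ≈⟨ +-cong (+-congˡ (+-congˡ (conj-η n))) (-‿cong (cube-count≈0 λ k _ e → absent (k , e))) ⟩
      E t - 0#              ≈⟨ solve 1 (λ a → a :- con (+ 0) := con (+ 1) :* a) refl (E t) ⟩
      1# * E t              ≈⟨ *-congʳ (sym third-inv) ⟩
      (3# * third) * E t    ≈⟨ *-assoc _ _ _ ⟩
      3# * (third * E t)    ∎
    Σe : sumF e ≈ 0#
    Σe = cancel-0 3≉0 (begin
      3# * sumF e                                        ≈⟨ sym (Σ-*ˡ 3# e) ⟩
      sumF (λ t → 3# * e t)                              ≈⟨ Σ-cong (λ t → sym (difference t)) ⟩
      sumF (λ t → cube-weight t - cube-count t)          ≈⟨ Σ-- cube-weight cube-count ⟩
      sumF cube-weight - sumF cube-count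
        ≈⟨ +-cong (trans (Σ-+ ε _) (+-congˡ (trans (Σ-+ η (conj η)) (+-cong (Σ-nontrivial η-char η-nontrivial) Ση̄)))) (-‿cong total) ⟩
      (sumF ε + (0# + 0#)) - sumF ε
        ≈⟨ solve 1 (λ a → (a :+ (con (+ 0) :+ con (+ 0))) :- a := con (+ 0)) refl (sumF ε) ⟩
      0# ∎)
      where
      total : sumF cube-count ≈ sumF ε
      total = trans (Σ-swap (λ t k → ε k * δ (cub k -F t)))
        (Σ-cong λ k → trans (Σ-cong λ t → *-comm _ _) (Σ-δ′ (cub k) (λ _ → ε k)))

  Σ-cubes : ∀ G → W ε (λ k → G (cub k)) ≈ W ε G + (W η G + W (conj η) G)
  Σ-cubes G = begin
    W ε (λ k → G (cub k))                        ≈⟨ Σ-fibre cub ε G ⟩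
    sumF (λ t → cube-count t * G t)              ≈⟨ Σ-cong (λ t → trans (*-congʳ (cube-count≈weight t))
      (solve 4 (λ a b c g → (a :+ (b :+ c)) :* g := a :* g :+ (b :* g :+ c :* g)) refl (ε t) (η t) (conj η t) (G t))) ⟩
    sumF (λ t → ε t * G t + (η t * G t + conj η t * G t))
      ≈⟨ trans (Σ-+ _ _) (+-congˡ (Σ-+ _ _)) ⟩
    W ε G + (W η G + W (conj η) G)               ∎


  -- Discriminant of X² - yX + β, whose roots are the u with u + β/u = y.
  disc : F → F → F
  disc β y = (y *F y) -F (4F *F β)

  -- Completing the square, u + β/u = y becomes (2u - y)² = y² - 4β, so y has 1 + φ(y² - 4β)
  -- preimages.
  Σ-torus : ∀ {β} → β ≢ 0F → ∀ G →
    W ε (λ u → G (u +F β *F invF u)) ≈ sumF (λ y → (1# + φ (disc β y)) * G y)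
  Σ-torus {β} β≢0 G = trans (Σ-fibre (λ u → u +F β *F invF u) ε G) (Σ-cong λ y → *-congʳ (count y))
    where
    identity : ∀ u → u ≢ 0F → ∀ y → (((2F *F u) -F y) *F ((2F *F u) -F y)) -F disc β y
                                  ≡ (4F *F u) *F ((u +F β *F invF u) -F y)
    identity u n y = modulo (-F (4F *F β)) (invF-inverse u n)
      (solveF 4 (λ u i y b → (num (+ 2) ⊗ u ⊖ y) ⊗ (num (+ 2) ⊗ u ⊖ y) ⊖ (y ⊗ y ⊖ num (+ 4) ⊗ b)
        ≋ (num (+ 4) ⊗ u) ⊗ ((u ⊕ b ⊗ i) ⊖ y) ⊕ (u ⊗ i ⊖ num (+ 1)) ⊗ (⊝ (num (+ 4) ⊗ b))) ≡.refl u (invF u) y β)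
    to-square : ∀ y u → ε u * δ ((u +F β *F invF u) -F y)
                      ≈ δ ((((2F *F u) -F y) *F ((2F *F u) -F y)) -F disc β y)
    to-square y u with u ≟F 0F
    -- At u = 0 the square equation would read 4β = 0, so passing to it adds no solution.
    ... | yes ≡.refl = trans (zeroˡ _) (sym (δ-≢0 (λ e → *F≢0 4≢0 β≢0 (≡.trans
      (solveF 2 (λ y b → num (+ 4) ⊗ b ≋ (num (+ 2) ⊗ num (+ 0) ⊖ y) ⊗ (num (+ 2) ⊗ num (+ 0) ⊖ y) ⊖ (y ⊗ y ⊖ num (+ 4) ⊗ b)) ≡.refl y β) e))))
    ... | no n = trans (*-identityˡ _) (δ-⇔
      (λ e → ≡.trans (identity u n y) (≡.trans (≡.cong ((4F *F u) *F_) e) (RF.zeroʳ _)))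
      (λ e → zero-factor (*F≢0 4≢0 n) (≡.trans (≡.sym (identity u n y)) e)))
    count : ∀ y → sumF (λ u → ε u * δ ((u +F β *F invF u) -F y)) ≈ 1# + φ (disc β y)
    count y = begin
      sumF (λ u → ε u * δ ((u +F β *F invF u) -F y))          ≈⟨ Σ-cong (to-square y) ⟩
      sumF (λ u → δ ((((2F *F u) -F y) *F ((2F *F u) -F y)) -F disc β y))
        ≈⟨ Σ-scale 2≢0 (λ k → δ (((k -F y) *F (k -F y)) -F disc β y)) ⟩
      sumF (λ k → δ (((k -F y) *F (k -F y)) -F disc β y))     ≈⟨ Σ-shift (-F y) (λ k → δ ((k *F k) -F disc β y)) ⟩
      sumF (λ k → δ ((k *F k) -F disc β y))                   ≈⟨ square-count 2≢0 (disc β y) ⟩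
      1# + φ (disc β y)                                       ∎

  -- With G = 1, `Σ-torus` reads q - 1 = q + Σφ(disc).
  Σφ-disc : ∀ {β} → β ≢ 0F → sumF (λ y → φ (disc β y)) ≈ - 1#
  Σφ-disc {β} β≢0 = begin
    sumF (λ y → φ (disc β y))
      ≈⟨ solve 2 (λ q s → s := (q :+ s) :- q) refl q _ ⟩
    (q + sumF (λ y → φ (disc β y))) - q
      ≈⟨ +-congʳ (trans (sym (Σ-+ _ _)) (Σ-cong λ y → sym (*-identityʳ _))) ⟩
    sumF (λ y → (1# + φ (disc β y)) * 1#) - q
      ≈⟨ +-congʳ (sym (Σ-torus β≢0 (λ _ → 1#))) ⟩
    W ε (λ _ → 1#) - q
      ≈⟨ +-congʳ (Σ-cong λ u → trans (*-identityʳ _) (trans (ε+δ u)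
           (+-congˡ (-‿cong (trans (δ-⇔ (λ e → x-x≡0 e) sub≡0) (sym (*-identityʳ _))))))) ⟩
    sumF (λ u → 1# - δ (u -F 0F) * 1#) - q
      ≈⟨ +-congʳ (trans (Σ-- _ _) (+-congˡ (-‿cong (Σ-δ 0F (λ _ → 1#))))) ⟩
    (q - 1#) - q
      ≈⟨ solve 1 (λ q → (q :- con (+ 1)) :- q := con -[1+ 0 ]) refl q ⟩
    - 1# ∎

  -- The Dickson polynomial of degree 3: it sends u + β/u to u³ + β³/u³.
  cubic : F → F → F
  cubic β y = (cub y) -F (3F *F β *F y)

  -- For y = u + β/u the discriminant is (u - β/u)², and u³ - β³/u³ is u - β/u times u² + β + β²/u²
  -- = y² - β.
  disc-cubic : ∀ β y → disc (cub β) (cubic β y) ≡ (((y *F y) -F β) *F ((y *F y) -F β)) *F disc β y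
  disc-cubic β y = solveF 2 (λ b y →
    (y ⊗ y ⊗ y ⊖ num (+ 3) ⊗ b ⊗ y) ⊗ (y ⊗ y ⊗ y ⊖ num (+ 3) ⊗ b ⊗ y) ⊖ num (+ 4) ⊗ (b ⊗ b ⊗ b)
    ≋ ((y ⊗ y ⊖ b) ⊗ (y ⊗ y ⊖ b)) ⊗ (y ⊗ y ⊖ num (+ 4) ⊗ b)) ≡.refl β y

  -- The y with nonsquare discriminant are mapped bijectively by y³ - 3βy to
  -- the c with nonsquare discriminant: injectivity holds since -3 is a square,
  -- and by Σφ-disc the total weights 1 - φ(disc) of both sides agree.
  nonsplit-count : ∀ {β} → β ≢ 0F → ∀ c →
    sumF (λ y → (1# - φ (disc β y)) * δ (cubic β y -F c)) ≈ 1# - φ (disc (cub β) c)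
  nonsplit-count {β} β≢0 c = sym (-≈0⇒≈ (trans (defect c) (trans (*-congˡ (Σ-idempotent-≈0 e idem Σe c)) (zeroʳ _))))
    where
    N : F → K
    N c = sumF (λ y → (1# - φ (disc β y)) * δ (cubic β y -F c))
    e : F → K
    e c with squareView (disc (cub β) c) | preimage? (cubic β) c
    ... | nonsquare _ _ _ | no _  = 1#
    ... | nonsquare _ _ _ | yes _ = 0#
    ... | vanishing _ _   | _     = 0#
    ... | square _ _ _ _  | _     = 0#
    idem : ∀ c → e c * e c ≈ e c
    idem c with squareView (disc (cub β) c) | preimage? (cubic β) c
    ... | nonsquare _ _ _ | no _  = *-identityˡ 1#
    ... | nonsquare _ _ _ | yes _ = zeroˡ 0#
    ... | vanishing _ _   | _     = zeroˡ 0#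
    ... | square _ _ _ _  | _     = zeroˡ 0#
    N≈0 : ∀ {c} → (∀ y → cubic β y ≡ c → φ (disc β y) ≈ 1#) → N c ≈ 0#
    N≈0 h = trans (Σ-cong λ y → trans (*-comm _ _) (δ*≈0 λ z →
      trans (+-congˡ (-‿cong (h y (sub≡0 z)))) (-‿inverseʳ 1#))) Σ-0
    N-single : ∀ y₀ {c} → cubic β y₀ ≡ c → (∀ y → y ≢ y₀ → cubic β y ≡ c → φ (disc β y) ≈ 1#) →
      N c ≈ 1# - φ (disc β y₀)
    N-single y₀ {c} e h = trans
      (Σ-single y₀ (λ y → (1# - φ (disc β y)) * δ (cubic β y -F c)) λ y n → trans (*-comm _ _) (δ*≈0 λ z →
        trans (+-congˡ (-‿cong (h y n (sub≡0 z)))) (-‿inverseʳ 1#)))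
      (trans (*-congˡ (δ-≡0 (x-x≡0 e))) (*-identityʳ _))
    φ-disc : ∀ {c y} → cubic β y ≡ c → disc (cub β) c ≢ 0F → φ (disc β y) ≈ φ (disc (cub β) c)
    φ-disc {y = y} ≡.refl n = trans
      (sym (φ-square-* (λ z → n (≡.trans (disc-cubic β y)
        (≡.trans (≡.cong (λ t → (t *F t) *F disc β y) z)
          (solveF 1 (λ d → (num (+ 0) ⊗ num (+ 0)) ⊗ d ≋ num (+ 0)) ≡.refl _)))) (disc β y)))
      (≡⇒≈ (≡.cong φ (≡.sym (disc-cubic β y))))
    2× : K
    2× = 1# + 1#
    defect : ∀ c → (1# - φ (disc (cub β) c)) - N c ≈ 2× * e c
    defect c with squareView (disc (cub β) c) | preimage? (cubic β) c
    ... | square _ n _ v | _ = trans (+-cong (+-congˡ (-‿cong v)) (-‿cong (N≈0 λ y eq → trans (φ-disc eq n) v)))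
      (solve 0 ((con (+ 1) :- con (+ 1)) :- con (+ 0) := (con (+ 1) :+ con (+ 1)) :* con (+ 0)) refl)
    ... | nonsquare n ns v | no absent = trans
      (+-cong (+-congˡ (-‿cong v)) (-‿cong (N≈0 λ y eq → ⊥-elim (absent (y , eq)))))
      (solve 0 ((con (+ 1) :- con -[1+ 0 ]) :- con (+ 0) := (con (+ 1) :+ con (+ 1)) :* con (+ 1)) refl)
    ... | nonsquare n ns v | yes (y₀ , ≡.refl) = trans
      (+-cong (+-congˡ (-‿cong v)) (-‿cong (trans (N-single y₀ ≡.refl λ y y≢y₀ eq → ⊥-elim (collide y y≢y₀ eq))
        (+-congˡ (-‿cong (trans (φ-disc ≡.refl n) v))))))
      (solve 0 ((con (+ 1) :- con -[1+ 0 ]) :- (con (+ 1) :- con -[1+ 0 ]) := (con (+ 1) :+ con (+ 1)) :* con (+ 0)) refl)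
      where
      -- Distinct y and y₀ with the same image satisfy y² + y y₀ + y₀² = 3β, hence (2y + y₀)² = -3
      -- disc(y₀). As -3 is a square, so is the discriminant of y₀, and with it that of the image.
      collide : ∀ y → y ≢ y₀ → cubic β y ≡ cubic β y₀ → ⊥
      collide y n′ eq = ns (t *F a) (≡.trans
        (solveF 2 (λ t a → (t ⊗ a) ⊗ (t ⊗ a) ≋ (a ⊗ a) ⊗ (t ⊗ t)) ≡.refl t a)
        (≡.trans (≡.cong ((a *F a) *F_) t²) (≡.sym (disc-cubic β y₀))))
        where
        z : (y *F y +F y *F y₀ +F y₀ *F y₀) -F (3F *F β) ≡ 0F
        z = zero-factor (λ e → n′ (sub≡0 e)) (≡.trans
          (solveF 3 (λ b y z → (y ⊖ z) ⊗ (y ⊗ y ⊕ y ⊗ z ⊕ z ⊗ z ⊖ num (+ 3) ⊗ b)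
            ≋ (y ⊗ y ⊗ y ⊖ num (+ 3) ⊗ b ⊗ y) ⊖ (z ⊗ z ⊗ z ⊖ num (+ 3) ⊗ b ⊗ z)) ≡.refl β y y₀) (x-x≡0 eq))
        i = invF √-3
        a = (y₀ *F y₀) -F β
        t = (2F *F y +F y₀) *F i
        t² : t *F t ≡ disc β y₀
        t² = *F-cancelˡ (*F≢0 √-3≢0 √-3≢0) (≡.trans
          (modulo ((2F *F y +F y₀) *F (2F *F y +F y₀) *F (√-3 *F i +F 1F)) (invF-inverse √-3 √-3≢0)
            (solveF 4 (λ s i y z → (s ⊗ s) ⊗ (((num (+ 2) ⊗ y ⊕ z) ⊗ i) ⊗ ((num (+ 2) ⊗ y ⊕ z) ⊗ i))
              ≋ ((num (+ 2) ⊗ y ⊕ z) ⊗ (num (+ 2) ⊗ y ⊕ z)) ⊕ (s ⊗ i ⊖ num (+ 1))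
                  ⊗ ((num (+ 2) ⊗ y ⊕ z) ⊗ (num (+ 2) ⊗ y ⊕ z) ⊗ (s ⊗ i ⊕ num (+ 1)))) ≡.refl √-3 i y y₀))
          (≡.trans (modulo 4F z (solveF 3 (λ b y z → (num (+ 2) ⊗ y ⊕ z) ⊗ (num (+ 2) ⊗ y ⊕ z)
              ≋ (⊝ num (+ 3)) ⊗ (z ⊗ z ⊖ num (+ 4) ⊗ b) ⊕ (((y ⊗ y ⊕ y ⊗ z ⊕ z ⊗ z) ⊖ num (+ 3) ⊗ b) ⊖ num (+ 0)) ⊗ num (+ 4))
              ≡.refl β y y₀))
            (≡.cong (_*F disc β y₀) (≡.sym √-3²))))
    -- Here c² = 4β³. The preimage y₀ = c/β has y₀² = 4β and weight 1 - φ(0) = 1. Any other preimage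
    -- has y² = β, so its discriminant -3y² is a nonzero square and its weight is 0.
    ... | vanishing D≡0 v | _ = trans
      (+-cong (+-congˡ (-‿cong v)) (-‿cong (trans (N-single y₀ y₀↦c other)
        (+-congˡ (-‿cong (trans (≡⇒≈ (≡.cong φ (x-x≡0 y₀²))) φ-0))))))
      (solve 0 ((con (+ 1) :- con (+ 0)) :- (con (+ 1) :- con (+ 0)) := (con (+ 1) :+ con (+ 1)) :* con (+ 0)) refl)
      where
      i = invF β
      y₀ = c *F i
      c² : c *F c ≡ 4F *F cub β
      c² = sub≡0 D≡0
      βi : β *F i ≡ 1F
      βi = invF-inverse β β≢0
      y₀β : y₀ *F β ≡ c
      y₀β = modulo c βi (solveF 3 (λ c b i → (c ⊗ i) ⊗ b ≋ c ⊕ (b ⊗ i ⊖ num (+ 1)) ⊗ c) ≡.refl c β i)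
      y₀² : y₀ *F y₀ ≡ 4F *F β
      y₀² = ≡.trans (modulo (i *F i) c² (solveF 3 (λ c b i → (c ⊗ i) ⊗ (c ⊗ i)
          ≋ (num (+ 4) ⊗ (b ⊗ b ⊗ b)) ⊗ (i ⊗ i) ⊕ (c ⊗ c ⊖ num (+ 4) ⊗ (b ⊗ b ⊗ b)) ⊗ (i ⊗ i)) ≡.refl c β i))
        (modulo (4F *F β *F (β *F i +F 1F)) βi (solveF 2 (λ b i → (num (+ 4) ⊗ (b ⊗ b ⊗ b)) ⊗ (i ⊗ i)
          ≋ num (+ 4) ⊗ b ⊕ (b ⊗ i ⊖ num (+ 1)) ⊗ (num (+ 4) ⊗ b ⊗ (b ⊗ i ⊕ num (+ 1)))) ≡.refl β i))
      cubic-y : ∀ y → y *F y ≡ 4F *F β → cubic β y ≡ y *F β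
      cubic-y y e = modulo y e (solveF 2 (λ b y → y ⊗ y ⊗ y ⊖ num (+ 3) ⊗ b ⊗ y
        ≋ y ⊗ b ⊕ (y ⊗ y ⊖ num (+ 4) ⊗ b) ⊗ y) ≡.refl β y)
      y₀↦c : cubic β y₀ ≡ c
      y₀↦c = ≡.trans (cubic-y y₀ y₀²) y₀β
      other : ∀ y → y ≢ y₀ → cubic β y ≡ c → φ (disc β y) ≈ 1#
      other y n eq = cases (integral (≡.trans (≡.sym (disc-cubic β y)) (≡.trans (≡.cong (disc (cub β)) eq) D≡0)))
        where
        cases : ((y *F y) -F β) *F ((y *F y) -F β) ≡ 0F ⊎ disc β y ≡ 0F → φ (disc β y) ≈ 1#
        cases (inj₂ z) = ⊥-elim (n (*F-cancelˡ β≢0 (≡.trans (RF.*-comm _ _) (≡.trans (≡.sym (cubic-y y (sub≡0 z)))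
          (≡.trans eq (≡.trans (≡.sym y₀β) (RF.*-comm _ _)))))))
        cases (inj₁ z) = trans (≡⇒≈ (≡.cong φ (≡.trans
            (modulo 4F y² (solveF 2 (λ b y → (y ⊗ y ⊖ num (+ 4) ⊗ b) ≋ (⊝ num (+ 3)) ⊗ (y ⊗ y) ⊕ (y ⊗ y ⊖ b) ⊗ num (+ 4)) ≡.refl β y))
            (≡.trans (≡.cong (_*F (y *F y)) (≡.sym √-3²))
              (solveF 2 (λ s y → (s ⊗ s) ⊗ (y ⊗ y) ≋ (s ⊗ y) ⊗ (s ⊗ y)) ≡.refl √-3 y)))))
          (φ-square (*F≢0 √-3≢0 λ { ≡.refl → β≢0 (≡.trans (≡.sym y²) (RF.zeroˡ 0F)) }))
          where
          y² : y *F y ≡ β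
          y² = sub≡0 (square≡0 z)
    Σe : sumF e ≈ 0#
    Σe = cancel-0 2≉0 (begin
      2× * sumF e                                          ≈⟨ sym (Σ-*ˡ 2× e) ⟩
      sumF (λ c → 2× * e c)                                ≈⟨ Σ-cong (λ c → sym (defect c)) ⟩
      sumF (λ c → (1# - φ (disc (cub β) c)) - N c)         ≈⟨ Σ-- _ N ⟩
      sumF (λ c → 1# - φ (disc (cub β) c)) - sumF N        ≈⟨ +-cong (half (cub≢0 β≢0)) (-‿cong (trans total (half β≢0))) ⟩
      (q - - 1#) - (q - - 1#)                              ≈⟨ -‿inverseʳ _ ⟩
      0#                                                   ∎)
      where
      half : ∀ {β} → β ≢ 0F → sumF (λ c → 1# - φ (disc β c)) ≈ q - - 1#
      half n = trans (Σ-- _ _) (+-congˡ (-‿cong (Σφ-disc n)))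
      total : sumF N ≈ sumF (λ y → 1# - φ (disc β y))
      total = trans (Σ-swap (λ c y → (1# - φ (disc β y)) * δ (cubic β y -F c)))
        (Σ-cong λ y → trans (Σ-cong λ c → *-comm _ _) (Σ-δ′ (cubic β y) (λ _ → 1# - φ (disc β y))))

  -- With b = β³ the substitution w → b/w fixes w + b/w and exchanges η̄ and η, since η(b) = 1.
  η̄-to-η : ∀ {β} → β ≢ 0F → ∀ h →
    W (conj η) (λ w → h (w +F cub β *F invF w)) ≈ W η (λ w → h (w +F cub β *F invF w))
  η̄-to-η {β} β≢0 h = begin
    W (conj η) (λ w → h (w +F b *F invF w))
      ≈⟨ W-inv (conj η) _ ⟩
    W (conj (conj η)) (λ w → h (invF w +F b *F invF (invF w)))
      ≈⟨ W-weight _ (conj-conj η) ⟩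
    W η (λ w → h (invF w +F b *F invF (invF w)))
      ≈⟨ W-scale η-char (invF≢0 b≢0) _ ⟩
    η (invF b) * W η (λ w → h (invF (invF b *F w) +F b *F invF (invF (invF b *F w))))
      ≈⟨ *-cong (η̄-cub β≢0) (Σ-cong λ w → *-congˡ (≡⇒≈ (≡.cong h (swap w)))) ⟩
    1# * W η (λ w → h (w +F b *F invF w))
      ≈⟨ *-identityˡ _ ⟩
    W η (λ w → h (w +F b *F invF w)) ∎
    where
    b = cub β
    b≢0 : b ≢ 0F
    b≢0 = cub≢0 β≢0
    swap : ∀ w → invF (invF b *F w) +F b *F invF (invF (invF b *F w)) ≡ w +F b *F invF w
    swap w = ≡.trans (≡.cong₂ (λ s t → s +F b *F t)
        (≡.trans (invF-* (invF b) w) (≡.cong (_*F invF w) (invF-involutive b))) (invF-involutive _))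
      (modulo w (invF-inverse b b≢0) (solveF 4 (λ b j w i → b ⊗ i ⊕ b ⊗ (j ⊗ w) ≋ (w ⊕ b ⊗ i) ⊕ (b ⊗ j ⊖ num (+ 1)) ⊗ w)
        ≡.refl b (invF b) w (invF w)))

  -- Twice the left side is the sum of its versions with weights 1 + φ(disc) and 1 - φ(disc). The
  -- first is parametrised by y = u + β/u, where the cubic becomes u³ + β³/u³ and `Σ-cubes` brings
  -- in η and η̄; the second is `nonsplit-count`. The φ-weighted sums over c cancel.
  cardano : ∀ {β} → β ≢ 0F → ∀ h →
    sumF (λ y → h (cubic β y)) ≈ sumF h + W η (λ w → h (w +F cub β *F invF w))
  cardano {β} β≢0 h = cancel 2≉0 (begin
    (1# + 1#) * X
      ≈⟨ solve 2 (λ x d → (con (+ 1) :+ con (+ 1)) :* x := (x :+ d) :+ (x :- d)) refl X _ ⟩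
    (X + sumF (λ y → φ (disc β y) * h (cubic β y))) + (X - sumF (λ y → φ (disc β y) * h (cubic β y)))
      ≈⟨ +-cong split nonsplit ⟩
    ((Y + D) + (Z + Z)) + (Y - D)
      ≈⟨ solve 3 (λ y d z → ((y :+ d) :+ (z :+ z)) :+ (y :- d) := (con (+ 1) :+ con (+ 1)) :* (y :+ z)) refl Y D Z ⟩
    (1# + 1#) * (Y + Z) ∎)
    where
    b = cub β
    X = sumF (λ y → h (cubic β y))
    Y = sumF h
    D = sumF (λ c → φ (disc b c) * h c)
    G : F → K
    G w = h (w +F b *F invF w)
    Z = W η G
    substitution : ∀ u → u ≢ 0F → cubic β (u +F β *F invF u) ≡ cub u +F b *F invF (cub u)
    substitution u n = ≡.trans
      (modulo (3F *F β *F (u +F β *F invF u)) (invF-inverse u n)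
        (solveF 3 (λ u i b → (u ⊕ b ⊗ i) ⊗ (u ⊕ b ⊗ i) ⊗ (u ⊕ b ⊗ i) ⊖ num (+ 3) ⊗ b ⊗ (u ⊕ b ⊗ i)
          ≋ (u ⊗ u ⊗ u ⊕ (b ⊗ b ⊗ b) ⊗ (i ⊗ i ⊗ i)) ⊕ (u ⊗ i ⊖ num (+ 1)) ⊗ (num (+ 3) ⊗ b ⊗ (u ⊕ b ⊗ i)))
          ≡.refl u (invF u) β))
      (≡.cong (λ t → cub u +F b *F t) (≡.sym (≡.trans (invF-* _ _) (≡.cong (_*F invF u) (invF-* u u)))))
    distribute : ∀ f k → sumF (λ y → (1# + f y) * k y) ≈ sumF k + sumF (λ y → f y * k y)
    distribute f k = trans (Σ-cong λ y → trans (distribʳ _ _ _) (+-congʳ (*-identityˡ _))) (Σ-+ k _)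
    split : X + sumF (λ y → φ (disc β y) * h (cubic β y)) ≈ (Y + D) + (Z + Z)
    split = begin
      X + sumF (λ y → φ (disc β y) * h (cubic β y))
        ≈⟨ sym (distribute (λ y → φ (disc β y)) (λ y → h (cubic β y))) ⟩
      sumF (λ y → (1# + φ (disc β y)) * h (cubic β y))
        ≈⟨ sym (Σ-torus β≢0 (λ y → h (cubic β y))) ⟩
      W ε (λ u → h (cubic β (u +F β *F invF u)))
        ≈⟨ W-congʳ ε-0 (λ u n → ≡⇒≈ (≡.cong h (substitution u n))) ⟩
      W ε (λ u → G (cub u))
        ≈⟨ Σ-cubes G ⟩
      W ε G + (W η G + W (conj η) G)
        ≈⟨ +-cong (trans (Σ-torus (cub≢0 β≢0) h) (distribute (λ c → φ (disc b c)) h)) (+-congˡ (η̄-to-η β≢0 h)) ⟩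
      (Y + D) + (Z + Z) ∎
    distribute- : ∀ f k → sumF (λ y → (1# - f y) * k y) ≈ sumF k - sumF (λ y → f y * k y)
    distribute- f k = trans (Σ-cong λ y → solve 2 (λ f k → (con (+ 1) :- f) :* k := k :- f :* k) refl _ _) (Σ-- k _)
    nonsplit : X - sumF (λ y → φ (disc β y) * h (cubic β y)) ≈ Y - D
    nonsplit = begin
      X - sumF (λ y → φ (disc β y) * h (cubic β y))
        ≈⟨ sym (distribute- (λ y → φ (disc β y)) (λ y → h (cubic β y))) ⟩
      sumF (λ y → (1# - φ (disc β y)) * h (cubic β y))
        ≈⟨ Σ-fibre (cubic β) (λ y → 1# - φ (disc β y)) h ⟩
      sumF (λ c → sumF (λ y → (1# - φ (disc β y)) * δ (cubic β y -F c)) * h c)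
        ≈⟨ Σ-cong (λ c → *-congʳ (nonsplit-count β≢0 c)) ⟩
      sumF (λ c → (1# - φ (disc b c)) * h c)
        ≈⟨ distribute- (λ c → φ (disc b c)) h ⟩
      Y - D ∎


  -- The Kloosterman sum in three variables of product t with the characters η̄, η and 1.
  kloosterman : F → K
  kloosterman t = W (conj η) λ x → W η λ y → ψ (x +F (y +F invF (x *F y) *F t))

  -- With y = (x/t)w the exponent is x + a(w + β³/w) for a = x/t and β = t/x, so `cardano` applies
  -- to h(c) = ψ(ac), whose full sum is 0. The new exponent a(y³ - 3βy) + x = -3y + (1 + y³/t)x is
  -- linear in x, as the next summation requires.
  η-kloosterman : ∀ {x t} → x ≢ 0F → t ≢ 0F →
    W η (λ y → ψ (x +F (y +F invF (x *F y) *F t)))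
    ≈ η x * (conj η t * sumF (λ y → ψ (-F (3F *F y)) * ψ ((1F +F cub y *F invF t) *F x)))
  η-kloosterman {x} {t} x≢0 t≢0 = begin
    W η (λ y → ψ (x +F (y +F invF (x *F y) *F t)))
      ≈⟨ W-scale η-char a≢0 _ ⟩
    η a * W η (λ w → ψ (x +F (a *F w +F invF (x *F (a *F w)) *F t)))
      ≈⟨ *-cong (at-* η-char x (invF t)) (Σ-cong λ w → *-congˡ (trans
           (ψ-split (≡.cong (x +F_) (exponent w))) (*-comm _ _))) ⟩
    (η x * conj η t) * W η (λ w → h (w +F cub β *F invF w) * ψ x)
      ≈⟨ trans (*-assoc _ _ _) (*-congˡ (*-congˡ (trans (Σ-cong λ w → sym (*-assoc _ _ _)) (Σ-*ʳ (ψ x) _)))) ⟩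
    η x * (conj η t * (W η (λ w → h (w +F cub β *F invF w)) * ψ x))
      ≈⟨ *-congˡ (*-congˡ (*-congʳ root-sum)) ⟩
    η x * (conj η t * (sumF (λ y → h (cubic β y)) * ψ x))
      ≈⟨ *-congˡ (*-congˡ (trans (sym (Σ-*ʳ (ψ x) _)) (Σ-cong λ y →
           trans (sym (ψ-+ _ _)) (ψ-split (exponent′ y))))) ⟩
    η x * (conj η t * sumF (λ y → ψ (-F (3F *F y)) * ψ ((1F +F cub y *F invF t) *F x))) ∎
    where
    a = x *F invF t
    β = t *F invF x
    a≢0 : a ≢ 0F
    a≢0 = *F≢0 x≢0 (invF≢0 t≢0)
    h : F → K
    h c = ψ (a *F c)
    exponent : ∀ w → a *F w +F invF (x *F (a *F w)) *F t ≡ a *F (w +F cub β *F invF w)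
    exponent w = ≡.trans
      (≡.cong (λ s → a *F w +F s *F t) (≡.trans (invF-* x (a *F w)) (≡.cong (invF x *F_) (≡.trans (invF-* a w)
        (≡.cong (_*F invF w) (≡.trans (invF-* x (invF t)) (≡.cong (invF x *F_) (invF-involutive t))))))))
      (modulo (-F ((t *F invF t) *F m)) (invF-inverse x x≢0) (modulo (-F m) (invF-inverse t t≢0)
        (solveF 6 (λ x i t j w v → (x ⊗ j) ⊗ w ⊕ (i ⊗ ((i ⊗ t) ⊗ v)) ⊗ t
          ≋ ((x ⊗ j) ⊗ (w ⊕ ((t ⊗ i) ⊗ (t ⊗ i) ⊗ (t ⊗ i)) ⊗ v) ⊕ (x ⊗ i ⊖ num (+ 1)) ⊗ (⊝ ((t ⊗ j) ⊗ (t ⊗ t ⊗ i ⊗ i ⊗ v))))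
            ⊕ (t ⊗ j ⊖ num (+ 1)) ⊗ (⊝ (t ⊗ t ⊗ i ⊗ i ⊗ v))) ≡.refl x (invF x) t (invF t) w (invF w))))
      where m = t *F t *F invF x *F invF x *F invF w
    exponent′ : ∀ y → a *F cubic β y +F x ≡ (-F (3F *F y)) +F (1F +F cub y *F invF t) *F x
    exponent′ y = modulo (-F ((t *F invF t) *F (3F *F y))) (invF-inverse x x≢0)
      (modulo (-F (3F *F y)) (invF-inverse t t≢0)
        (solveF 5 (λ x i t j y → (x ⊗ j) ⊗ ((y ⊗ y ⊗ y) ⊖ num (+ 3) ⊗ (t ⊗ i) ⊗ y) ⊕ x
          ≋ (((⊝ (num (+ 3) ⊗ y)) ⊕ (num (+ 1) ⊕ (y ⊗ y ⊗ y) ⊗ j) ⊗ x) ⊕ (x ⊗ i ⊖ num (+ 1)) ⊗ (⊝ ((t ⊗ j) ⊗ (num (+ 3) ⊗ y))))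
            ⊕ (t ⊗ j ⊖ num (+ 1)) ⊗ (⊝ (num (+ 3) ⊗ y))) ≡.refl x (invF x) t (invF t) y))
    root-sum : W η (λ w → h (w +F cub β *F invF w)) ≈ sumF (λ y → h (cubic β y))
    root-sum = sym (trans (cardano (*F≢0 t≢0 (invF≢0 x≢0)) h)
      (trans (+-congʳ (Σψ-linear a≢0)) (+-identityˡ _)))

  -- The factors η̄(x) and η(x) cancel, and the additive sum over x picks out y³ = -t; the omitted x
  -- = 0 contributes the sum of ψ(-3y), which is 0.
  kloosterman-value : ∀ {t} → t ≢ 0F →
    kloosterman t ≈ q * (conj η t * sumF (λ u → δ (t -F cub u) * ψ (3F *F u)))
  kloosterman-value {t} t≢0 = begin
    kloosterman t
      ≈⟨ W-cong (at-0 (conj-character η-char)) ε-0 (λ x n → trans (*-congˡ (η-kloosterman n t≢0))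
           (trans (solve 4 (λ a b c d → a :* (b :* (c :* d)) := (b :* a) :* (c :* d)) refl _ _ _ _)
             (*-congʳ (trans (*-conj η-char n) (sym (ε-≢0 n)))))) ⟩
    W ε (λ x → conj η t * sumF (λ y → ψ (-F (3F *F y)) * ψ ((1F +F cub y *F invF t) *F x)))
      ≈⟨ trans (W-*ˡ ε _ _) (*-congˡ (W-Σ ε _)) ⟩
    conj η t * sumF (λ y → W ε (λ x → ψ (-F (3F *F y)) * ψ ((1F +F cub y *F invF t) *F x)))
      ≈⟨ *-congˡ (Σ-cong λ y → trans (W-*ˡ ε _ _) (*-congˡ (Wε-ψ _))) ⟩
    conj η t * sumF (λ y → ψ (-F (3F *F y)) * (δ (1F +F cub y *F invF t) * q - 1#))
      ≈⟨ *-congˡ (trans (Σ-cong λ y → solve 3 (λ p d q → p :* (d :* q :- con (+ 1)) := q :* (d :* p) :- p) refl _ _ q)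
           (trans (Σ-- _ _) (trans (+-cong (Σ-*ˡ q _) (-‿cong vanish)) (solve 1 (λ a → a :- con (+ 0) := a) refl _)))) ⟩
    conj η t * (q * sumF (λ y → δ (1F +F cub y *F invF t) * ψ (-F (3F *F y))))
      -- y = -u turns y³ = -t into u³ = t.
      ≈⟨ *-congˡ (*-congˡ (sym (Σ-scale -1≢0 _))) ⟩
    conj η t * (q * sumF (λ u → δ (1F +F cub ((-F 1F) *F u) *F invF t) * ψ (-F (3F *F ((-F 1F) *F u)))))
      ≈⟨ *-congˡ (*-congˡ (Σ-cong λ u → *-cong (δ-⇔ (to u) (from u))
           (ψ-≡ (solveF 1 (λ u → ⊝ (num (+ 3) ⊗ (num -[1+ 0 ] ⊗ u)) ≋ num (+ 3) ⊗ u) ≡.refl u)))) ⟩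
    conj η t * (q * sumF (λ u → δ (t -F cub u) * ψ (3F *F u)))
      ≈⟨ solve 3 (λ a b c → a :* (b :* c) := b :* (a :* c)) refl _ _ _ ⟩
    q * (conj η t * sumF (λ u → δ (t -F cub u) * ψ (3F *F u))) ∎
    where
    vanish : sumF (λ y → ψ (-F (3F *F y))) ≈ 0#
    vanish = trans (Σ-cong λ y → ψ-≡ (solveF 2 (λ t y → ⊝ (t ⊗ y) ≋ (⊝ t) ⊗ y) ≡.refl 3F y)) (Σψ-linear (-≢0 3≢0))
    to : ∀ u → 1F +F cub ((-F 1F) *F u) *F invF t ≡ 0F → t -F cub u ≡ 0F
    to u e = ≡.trans (modulo (-F (cub u)) (≡.sym (invF-inverse t t≢0))
        (solveF 3 (λ t j u → t ⊖ u ⊗ u ⊗ u ≋ t ⊗ (num (+ 1) ⊕ ((num -[1+ 0 ] ⊗ u) ⊗ (num -[1+ 0 ] ⊗ u) ⊗ (num -[1+ 0 ] ⊗ u)) ⊗ j)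
          ⊕ (num (+ 1) ⊖ t ⊗ j) ⊗ (⊝ (u ⊗ u ⊗ u))) ≡.refl t (invF t) u))
      (≡.trans (≡.cong (t *F_) e) (RF.zeroʳ t))
    from : ∀ u → t -F cub u ≡ 0F → 1F +F cub ((-F 1F) *F u) *F invF t ≡ 0F
    from u e = ≡.trans (modulo 1F (≡.sym (invF-inverse t t≢0))
        (solveF 3 (λ t j u → num (+ 1) ⊕ ((num -[1+ 0 ] ⊗ u) ⊗ (num -[1+ 0 ] ⊗ u) ⊗ (num -[1+ 0 ] ⊗ u)) ⊗ j
          ≋ (t ⊖ u ⊗ u ⊗ u) ⊗ j ⊕ (num (+ 1) ⊖ t ⊗ j) ⊗ num (+ 1)) ≡.refl t (invF t) u))
      (≡.trans (≡.cong (_*F invF t) e) (RF.zeroˡ _))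

  -- f = 1 gives the relation between Gauss sums; a general f is needed inside
  -- the kernel of ₃F₂.
  hasse-davenport-3 : ∀ {A} → IsCharacter A → ∀ f →
    W (A · conj η) (λ x → W (A · η) (λ y → W A (λ z → ψ (x +F (y +F z)) * f ((x *F y) *F z))))
    ≈ q * W (cube A) (λ u → ψ (3F *F u) * f (cub u))
  hasse-davenport-3 {A} cA f = begin
    W (A · conj η) (λ x → W (A · η) (λ y → W A (λ z → ψ (x +F (y +F z)) * f ((x *F y) *F z))))
      ≈⟨ W-cong (at-0 (·-character cA cη̄)) (at-0 cη̄) (λ x n → trans (*-assoc _ _ _)
           (trans (solve 3 (λ a b c → a :* (b :* c) := b :* (a :* c)) refl _ _ _) (*-congˡ (inner x n)))) ⟩
    W (conj η) (λ x → W η (λ y → W A (λ t → ψ (x +F (y +F invF (x *F y) *F t)) * f t)))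
      ≈⟨ Σ-cong (λ x → *-congˡ (W-swap η A _)) ⟩
    W (conj η) (λ x → W A (λ t → W η (λ y → ψ (x +F (y +F invF (x *F y) *F t)) * f t)))
      ≈⟨ W-swap (conj η) A _ ⟩
    W A (λ t → W (conj η) (λ x → W η (λ y → ψ (x +F (y +F invF (x *F y) *F t)) * f t)))
      ≈⟨ Σ-cong (λ t → *-congˡ (trans (Σ-cong λ x → *-congˡ (W-*ʳ η _ _)) (W-*ʳ (conj η) _ _))) ⟩
    W A (λ t → kloosterman t * f t)
      ≈⟨ W-congʳ (at-0 cA) (λ t n → *-congʳ (kloosterman-value n)) ⟩
    W A (λ t → (q * (conj η t * sumF (λ u → δ (t -F cub u) * ψ (3F *F u)))) * f t)
      ≈⟨ Σ-cong (λ t → trans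
           (solve 5 (λ a q e s f → a :* ((q :* (e :* s)) :* f) := q :* ((a :* (e :* f)) :* s)) refl _ q _ _ _)
           (*-congˡ (trans (sym (Σ-*ˡ _ _)) (Σ-cong λ u → solve 3 (λ a d p → a :* (d :* p) := d :* (a :* p)) refl _ _ _)))) ⟩
    sumF (λ t → q * sumF (λ u → δ (t -F cub u) * ((A t * (conj η t * f t)) * ψ (3F *F u))))
      ≈⟨ trans (Σ-*ˡ q _) (*-congˡ (trans (Σ-swap _) (Σ-cong λ u → Σ-δ (cub u) _))) ⟩
    q * sumF (λ u → (A (cub u) * (conj η (cub u) * f (cub u))) * ψ (3F *F u))
      ≈⟨ *-congˡ (Σ-nonzero (trans (*-congʳ (trans (*-congʳ (trans (at-cub cA 0F) (at-0 cM))) (zeroˡ _)))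
           (trans (zeroˡ _) (sym (trans (*-congʳ (at-0 cM)) (zeroˡ _)))))
           (λ u n → trans (*-congʳ (*-cong (at-cub cA u) (trans (*-congʳ (η̄-cub n)) (*-identityˡ _))))
             (trans (*-assoc _ _ _) (*-congˡ (*-comm _ _))))) ⟩
    q * W (cube A) (λ u → ψ (3F *F u) * f (cub u)) ∎
    where
    cη̄ = conj-character η-char
    cM = cube-character cA
    W-*ʳ : ∀ χ (h : F → K) k → W χ (λ x → h x * k) ≈ W χ h * k
    W-*ʳ χ h k = trans (Σ-cong λ x → sym (*-assoc _ _ _)) (Σ-*ʳ k _)
    -- The substitution z = t/(xy) makes the product t a variable: A(x)A(y)A(z) = A(t), so A leaves
    -- the sums over x and y.
    inner : ∀ x → x ≢ 0F →
      A x * W (A · η) (λ y → W A (λ z → ψ (x +F (y +F z)) * f ((x *F y) *F z)))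
      ≈ W η (λ y → W A (λ t → ψ (x +F (y +F invF (x *F y) *F t)) * f t))
    inner x x≢0 = trans (sym (W-*ˡ (A · η) (A x) _))
      (W-cong (at-0 (·-character cA η-char)) (at-0 η-char) λ y n → begin
        (A y * η y) * (A x * W A (λ z → ψ (x +F (y +F z)) * f ((x *F y) *F z)))
          ≈⟨ *-congˡ (*-congˡ (W-scale cA (invF≢0 (*F≢0 x≢0 n)) _)) ⟩
        (A y * η y) * (A x * (conj A (x *F y) * W A (λ t → ψ (x +F (y +F invF (x *F y) *F t)) * f ((x *F y) *F (invF (x *F y) *F t)))))
          ≈⟨ solve 5 (λ a e b c w → (a :* e) :* (b :* (c :* w)) := ((b :* a) :* c) :* (e :* w)) refl _ _ _ _ _ ⟩
        ((A x * A y) * conj A (x *F y)) * (η y * W A (λ t → ψ (x +F (y +F invF (x *F y) *F t)) * f ((x *F y) *F (invF (x *F y) *F t))))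
          ≈⟨ *-congʳ (trans (*-congʳ (sym (at-* cA x y))) (*-conj cA (*F≢0 x≢0 n))) ⟩
        1# * (η y * W A (λ t → ψ (x +F (y +F invF (x *F y) *F t)) * f ((x *F y) *F (invF (x *F y) *F t))))
          ≈⟨ trans (*-identityˡ _) (*-congˡ (Σ-cong λ t → *-congˡ (*-congˡ (≡⇒≈ (≡.cong f
               (modulo t (invF-inverse _ (*F≢0 x≢0 n))
                 (solveF 3 (λ p i t → p ⊗ (i ⊗ t) ≋ t ⊕ (p ⊗ i ⊖ num (+ 1)) ⊗ t) ≡.refl (x *F y) (invF (x *F y)) t))))))) ⟩
        η y * W A (λ t → ψ (x +F (y +F invF (x *F y) *F t)) * f t) ∎)

-- The additive character built from ζ and the trace

module AdditiveCharacter (𝔽 : FiniteField) (𝕂 : CoeffField) (p r : ℕ) (p-prime : Prime p)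
  (order≡p^r : FiniteField.order 𝔽 ≡ p ^ r) (ζ : CoeffField.Carrier 𝕂)
  (ζ^p≈1 : CoeffField._≈_ 𝕂 (Ops.powK 𝔽 𝕂 ζ p) (CoeffField.1# 𝕂))
  (ζ≉1 : ¬ (CoeffField._≈_ 𝕂 ζ (CoeffField.1# 𝕂))) where
  open Ops 𝔽 𝕂
  open FieldFacts 𝔽 𝕂
  open CharacteristicP 𝔽 𝕂 p r p-prime order≡p^r
  open CoefficientFacts 𝔽 𝕂
  open import Relation.Binary.Reasoning.Setoid setoid

  ψ : F → K
  ψ = addChar ζ p r

  powK-+ : ∀ m n → powK ζ (m ℕ.+ n) ≈ powK ζ m * powK ζ n
  powK-+ zero    n = sym (*-identityˡ _)
  powK-+ (suc m) n = trans (*-congˡ (powK-+ m n)) (sym (*-assoc _ _ _))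

  powK-∣ : ∀ {n} → p ∣ n → powK ζ n ≈ 1#
  powK-∣ (divides k ≡.refl) = go k
    where
    go : ∀ k → powK ζ (k ℕ.* p) ≈ 1#
    go zero    = refl
    go (suc k) = trans (powK-+ p (k ℕ.* p)) (trans (*-cong ζ^p≈1 (go k)) (*-identityˡ 1#))

  powK-natF-≤ : ∀ {m n} → m ℕ.≤ n → natF n ≡ natF m → powK ζ n ≈ powK ζ m
  powK-natF-≤ {m} {n} m≤n e = begin
    powK ζ n                          ≡⟨ ≡.cong (powK ζ) (≡.sym (ℕₚ.m∸n+n≡m m≤n)) ⟩
    powK ζ (n ℕ.∸ m ℕ.+ m)            ≈⟨ powK-+ (n ℕ.∸ m) m ⟩
    powK ζ (n ℕ.∸ m) * powK ζ m       ≈⟨ *-congʳ (powK-∣ (natF≡0⇒∣ (n ℕ.∸ m) difference)) ⟩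
    1# * powK ζ m                     ≈⟨ *-identityˡ _ ⟩
    powK ζ m                          ∎
    where
    difference : natF (n ℕ.∸ m) ≡ 0F
    difference = ≡.trans (solveF 2 (λ a b → a ≋ (a ⊕ b) ⊖ b) ≡.refl (natF (n ℕ.∸ m)) (natF m))
      (x-x≡0 (≡.trans (≡.sym (natF-+ (n ℕ.∸ m) m)) (≡.trans (≡.cong natF (ℕₚ.m∸n+n≡m m≤n)) e)))

  -- Numbers with the same image in F differ by a multiple of p, and ζ^p = 1.
  powK-natF : ∀ m n → natF m ≡ natF n → powK ζ m ≈ powK ζ n
  powK-natF m n e with ℕₚ.≤-total m n
  ... | inj₁ m≤n = sym (powK-natF-≤ m≤n (≡.sym e))
  ... | inj₂ n≤m = powK-natF-≤ n≤m e

  ψ-0 : ψ 0F ≈ 1#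
  ψ-0 = powK-natF (traceIndex 0F) 0 (≡.trans (natF-traceIndex 0F) trace-0)
    where
    trace-0 : trace p r 0F ≡ 0F
    trace-0 = ≡.trans (solveF 1 (λ t → t ≋ (t ⊕ t) ⊖ t) ≡.refl _)
      (x-x≡0 (≡.trans (≡.sym (trace-+ 0F 0F)) (≡.cong (trace p r) (RF.+-identityˡ 0F))))

  ψ-+ : ∀ x y → ψ (x +F y) ≈ ψ x * ψ y
  ψ-+ x y = trans (powK-natF (traceIndex (x +F y)) (traceIndex x ℕ.+ traceIndex y) traces)
    (powK-+ (traceIndex x) (traceIndex y))
    where
    traces : natF (traceIndex (x +F y)) ≡ natF (traceIndex x ℕ.+ traceIndex y)
    traces = ≡.trans (natF-traceIndex _) (≡.trans (trace-+ x y) (≡.sym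
      (≡.trans (natF-+ (traceIndex x) (traceIndex y)) (≡.cong₂ _+F_ (natF-traceIndex x) (natF-traceIndex y)))))

  -- Translation by an element of trace 1 multiplies the sum by ζ, which is not 1.
  Σψ≈0 : sumF ψ ≈ 0#
  Σψ≈0 with trace-one
  ... | a , tr≡1 = cancel-0 {ζ - 1#} (λ e → ζ≉1 (-≈0⇒≈ e)) (begin
    (ζ - 1#) * sumF ψ         ≈⟨ solve 2 (λ z s → (z :- con (+ 1)) :* s := z :* s :- s) refl ζ _ ⟩
    ζ * sumF ψ - sumF ψ       ≈⟨ +-congʳ (trans (sym (Σ-*ˡ ζ ψ)) (Σ-cong shifted)) ⟩
    sumF (λ x → ψ (x +F a)) - sumF ψ   ≈⟨ +-congʳ (Σ-shift a ψ) ⟩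
    sumF ψ - sumF ψ           ≈⟨ -‿inverseʳ _ ⟩
    0#                        ∎)
    where
    ψa : ψ a ≈ ζ
    ψa = trans (powK-natF (traceIndex a) 1 (≡.trans (natF-traceIndex a) (≡.trans tr≡1 (≡.sym (RF.+-identityʳ 1F)))))
      (*-identityʳ ζ)
    shifted : ∀ x → ζ * ψ x ≈ ψ (x +F a)
    shifted x = sym (trans (ψ-+ x a) (trans (*-comm _ _) (*-congʳ ψa)))

  ψ-orthogonal : ∀ c → sumF (λ x → ψ (c *F x)) ≈ δ c * q
  ψ-orthogonal c with c ≟F 0F
  ... | yes ≡.refl = trans (Σ-cong λ x → trans (≡⇒≈ (≡.cong ψ (RF.zeroˡ x))) ψ-0) (sym (*-identityˡ q))
  ... | no n       = trans (Σ-scale n ψ) (trans Σψ≈0 (sym (zeroˡ q)))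

-- Extracting known characters from a list

module CharacterLists (𝔽 : FiniteField) (𝕂 : CoeffField) where
  open Ops 𝔽 𝕂

  -- `≐` is not decidable, so a list cannot be filtered; a membership proof points at the entry to
  -- take out. `others` and `keeps` allow several removals in a row.
  record Removal (f : (F → K) → K) (c : F → K) (L : List (F → K)) : Set₁ where
    field
      remaining : List (F → K)
      sum-split : sumList L f ≈ f c + sumList remaining f
      others    : All (λ d → ¬ (c ≐ d)) remaining
      sublist   : ∀ {P : (F → K) → Set} → All P L → All P remaining
      distinct′ : AllPairs (λ χ χ′ → ¬ (χ ≐ χ′)) remaining
      keeps     : ∀ {d} → Any (d ≐_) L → ¬ (d ≐ c) → Any (d ≐_) remaining

  remove : ∀ {f} → (∀ {χ χ′} → χ ≐ χ′ → f χ ≈ f χ′) → ∀ {c L} → Any (c ≐_) L →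
           AllPairs (λ χ χ′ → ¬ (χ ≐ χ′)) L → Removal f c L
  remove resp {c} {d ∷ L} (here c≐d) (n ∷ ns) = record
    { remaining = L
    ; sum-split = +-congʳ (resp λ x → sym (c≐d x))
    ; others    = All.map (λ d≢e c≐e → d≢e λ x → trans (sym (c≐d x)) (c≐e x)) n
    ; sublist   = λ { (_ ∷ ps) → ps }
    ; distinct′ = ns
    ; keeps     = λ { (here e≐d) e≢c → ⊥-elim (e≢c λ x → trans (e≐d x) (sym (c≐d x))) ; (there a) _ → a } }
  remove {f} resp {c} {d ∷ L} (there a) (n ∷ ns) = record
    { remaining = d ∷ R.remaining
    ; sum-split = trans (+-congˡ R.sum-split) (trans (sym (+-assoc _ _ _)) (trans (+-congʳ (+-comm _ _)) (+-assoc _ _ _)))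
    ; others    = c≢d ∷ R.others
    ; sublist   = λ { (p ∷ ps) → p ∷ R.sublist ps }
    ; distinct′ = R.sublist n ∷ R.distinct′
    ; keeps     = λ { (here e≐d) _ → here e≐d ; (there b) e≢c → there (R.keeps b e≢c) } }
    where
    module R = Removal (remove {f} resp {c} {L} a ns)
    c≢d : ¬ (c ≐ d)
    c≢d c≐d with All.lookupAny n a
    ... | d≢e , c≐e = d≢e λ x → trans (sym (c≐d x)) (c≐e x)

-- The characters of the theorem

module Transformation (𝔽 : FiniteField) (𝕂 : CoeffField) (setting : AdditiveSetting 𝔽 𝕂)
  (cubicCharacter : CubicCharacter 𝔽 𝕂) (parameters : Parameters 𝔽 𝕂) where
  open Ops 𝔽 𝕂
  open FieldFacts 𝔽 𝕂
  open CoefficientFacts 𝔽 𝕂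
  open Characters 𝔽 𝕂
  open AdditiveSetting setting
  open CubicCharacter cubicCharacter
  open Parameters parameters
  open GaussSums 𝔽 𝕂 setting
  open Cubic 𝔽 𝕂 setting cubicCharacter
  open import Relation.Binary.Reasoning.Setoid setoid

  -- M = A³ and C = φA³B̄, so that M = φBC and the lower parameters on the right are the squares B²
  -- and `B₂` = C².
  M C B₂ M̄ B̄ C̄ η̄ Aη Aη̄ : F → K
  M  = cube A
  M̄  = conj M
  B̄  = conj B
  η̄  = conj η
  C  = φ · M · B̄
  C̄  = conj C
  B₂ = M · M · B̄ · B̄
  Aη = A · η
  Aη̄ = A · η̄

  M₁ : K
  M₁ = M (-F 1F)

  cM : IsCharacter M
  cM = cube-character cA
  cB̄ : IsCharacter B̄
  cB̄ = conj-character cB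
  cM̄ : IsCharacter M̄
  cM̄ = conj-character cM
  cη̄ : IsCharacter η̄
  cη̄ = conj-character η-char
  cC : IsCharacter C
  cC = ·-character (·-character φ-char cM) cB̄
  cB₂ : IsCharacter B₂
  cB₂ = ·-character (·-character (·-character cM cM) cB̄) cB̄

  everywhere : ∀ {χ θ : F → K} → χ 0F ≈ 0# → θ 0F ≈ 0# → (∀ x → x ≢ 0F → χ x ≈ θ x) → ∀ x → χ x ≈ θ x
  everywhere z z′ h x with x ≟F 0F
  ... | yes ≡.refl = trans z (sym z′)
  ... | no n       = h x n

  M≈φBC : ∀ x → M x ≈ φ x * (B x * C x)
  M≈φBC = everywhere (at-0 cM) (trans (*-congʳ φ-0) (zeroˡ _)) λ x n → sym (begin
    φ x * (B x * (φ x * M x * B̄ x))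
      ≈⟨ solve 4 (λ f b m c → f :* (b :* (f :* m :* c)) := m :* ((f :* f) :* (b :* c))) refl _ _ _ _ ⟩
    M x * ((φ x * φ x) * (B x * B̄ x))   ≈⟨ *-congˡ (*-cong (φ² n) (*-conj cB n)) ⟩
    M x * (1# * 1#)                          ≈⟨ solve 1 (λ m → m :* (con (+ 1) :* con (+ 1)) := m) refl _ ⟩
    M x                                      ∎)

  nBC : Nontrivial (B̄ · φ · C)
  nBC t = n₁ λ x n → trans (begin
    M x * B̄ x * B̄ x
      ≈⟨ solve 2 (λ m b → m :* b :* b := con (+ 1) :* (m :* b :* b)) refl _ _ ⟩
    1# * (M x * B̄ x * B̄ x)
      ≈⟨ *-congʳ (sym (φ² n)) ⟩
    (φ x * φ x) * (M x * B̄ x * B̄ x)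
      ≈⟨ solve 3 (λ f m b → (f :* f) :* (m :* b :* b) := (b :* f) :* (f :* m :* b)) refl _ _ _ ⟩
    (B̄ x * φ x) * (φ x * M x * B̄ x) ∎) (t x n)

  cC̄ : IsCharacter C̄
  cC̄ = conj-character cC

  conj-nontrivial : ∀ {χ} → Nontrivial χ → Nontrivial (conj χ)
  conj-nontrivial {χ} nt t = nt λ x n → trans (sym (conj-conj χ x)) (t (invF x) (invF≢0 n))

  -- Right side: reduction to a quadratic polynomial in r and s

  h : F
  h = invF 2F

  2h≡1 : 2F *F h ≡ 1F
  2h≡1 = invF-inverse 2F 2≢0

  h≢0 : h ≢ 0F
  h≢0 = invF≢0 2≢0

  twist-conj : ∀ {χ} → IsCharacter χ → Nontrivial χ → ∀ u →
    χ u * g (conj χ) ≈ W (conj χ) (λ w → ψ (u *F w))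
  twist-conj {χ} c n u = sym (trans (twist (conj-character c) (conj-nontrivial n) u) (*-congʳ (conj-conj χ u)))

  -- The exponent of `P-gauss` divided by z, after v and w are replaced by -4zv and -4zw and 2r, 2s
  -- are renamed r, s. The factor -4 fits because -4r(1 - r) = (2r)² - 2(2r).
  form : F → F → F → F → F → F
  form x w v r s = ((v *F (r *F r) +F w *F (s *F s)) -F (x *F r *F s)) -F ((2F *F v *F r +F 2F *F w *F s) -F 1F)

  T : F → F → F → K
  T x w v = W φ λ z → sumF λ r → sumF λ s → ψ (z *F form x w v r s)

  -- The ₃P₂ of the right side: as its lower parameters are squares of the upper ones, C̄C² and B̄B²
  -- reduce to C and B.
  P : F → K
  P x = sumF λ r → sumF λ s → (C r * C (1F -F r)) * ((B s * B (1F -F s)) * M̄ (1F -F (4F *F x *F r *F s)))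

  W-product : ∀ χ θ f k → W χ f * W θ k ≈ W χ (λ a → W θ (λ b → f a * k b))
  W-product χ θ f k = trans (sym (Σ-*ʳ _ _)) (Σ-cong λ a → trans (*-assoc _ _ _) (*-congˡ (sym (W-*ˡ θ (f a) k))))

  P-gauss : ∀ x → (g B̄ * g C̄ * g M) * P x
    ≈ W M (λ z → W₂ C̄ B̄ (λ v w → sumF (λ r → sumF (λ s →
        ψ (((r *F (1F -F r)) *F v +F (s *F (1F -F s)) *F w) +F (1F -F (4F *F x *F r *F s)) *F z)))))
  P-gauss x = begin
    (g B̄ * g C̄ * g M) * P x
      ≈⟨ trans (sym (Σ-*ˡ _ _)) (Σ-cong λ r → trans (sym (Σ-*ˡ _ _)) (Σ-cong λ s → term r s)) ⟩
    sumF (λ r → sumF (λ s → W M (λ z → W₂ C̄ B̄ (λ v w → e r s z v w))))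
      ≈⟨ Σ-cong (λ r → trans (sym (W-Σ M _)) (Σ-cong λ z → *-congˡ (trans (sym (W-Σ C̄ _))
           (Σ-cong λ v → *-congˡ (sym (W-Σ B̄ _)))))) ⟩
    sumF (λ r → W M (λ z → W₂ C̄ B̄ (λ v w → sumF (λ s → e r s z v w))))
      ≈⟨ trans (sym (W-Σ M _)) (Σ-cong λ z → *-congˡ (trans (sym (W-Σ C̄ _))
           (Σ-cong λ v → *-congˡ (sym (W-Σ B̄ _))))) ⟩
    W M (λ z → W₂ C̄ B̄ (λ v w → sumF (λ r → sumF (λ s → e r s z v w)))) ∎
    where
    e : F → F → F → F → F → K
    e r s z v w = ψ (((r *F (1F -F r)) *F v +F (s *F (1F -F s)) *F w) +F (1F -F (4F *F x *F r *F s)) *F z)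
    term : ∀ r s → (g B̄ * g C̄ * g M) *
        ((C r * C (1F -F r)) * ((B s * B (1F -F s)) * M̄ (1F -F (4F *F x *F r *F s))))
      ≈ W M (λ z → W₂ C̄ B̄ (λ v w → e r s z v w))
    term r s = begin
      (g B̄ * g C̄ * g M) *
        ((C r * C (1F -F r)) * ((B s * B (1F -F s)) * M̄ (1F -F (4F *F x *F r *F s))))
        ≈⟨ solve 6 (λ a b c d e f → (a :* b :* c) :* (d :* (e :* f)) := (f :* c) :* ((d :* b) :* (e :* a))) refl _ _ _ _ _ _ ⟩
      (M̄ (1F -F (4F *F x *F r *F s)) * g M) *
        (((C r * C (1F -F r)) * g C̄) * ((B s * B (1F -F s)) * g B̄))
        ≈⟨ *-cong (sym (twist cM nM _)) (*-cong
             (trans (*-congʳ (sym (at-* cC r _))) (twist-conj cC nC _))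
             (trans (*-congʳ (sym (at-* cB s _))) (twist-conj cB nB _))) ⟩
      W M (λ z → ψ ((1F -F (4F *F x *F r *F s)) *F z)) *
        (W C̄ (λ v → ψ ((r *F (1F -F r)) *F v)) * W B̄ (λ w → ψ ((s *F (1F -F s)) *F w)))
        ≈⟨ *-congˡ (W-product C̄ B̄ _ _) ⟩
      W M (λ z → ψ ((1F -F (4F *F x *F r *F s)) *F z)) *
        W₂ C̄ B̄ (λ v w → ψ ((r *F (1F -F r)) *F v) * ψ ((s *F (1F -F s)) *F w))
        ≈⟨ W-product M C̄ _ _ ⟩
      W M (λ z → W C̄ (λ v → ψ ((1F -F (4F *F x *F r *F s)) *F z) *
        W B̄ (λ w → ψ ((r *F (1F -F r)) *F v) * ψ ((s *F (1F -F s)) *F w))))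
        ≈⟨ Σ-cong (λ z → *-congˡ (Σ-cong λ v → *-congˡ (trans (sym (W-*ˡ B̄ _ _)) (Σ-cong λ w → *-congˡ
             (trans (*-comm _ _) (sym (trans (ψ-+ _ _) (*-congʳ (ψ-+ _ _))))))))) ⟩
      W M (λ z → W₂ C̄ B̄ (λ v w → e r s z v w)) ∎

  -4F : F
  -4F = -F 4F

  -- Rescaling v and w by -4z produces C̄(-4z)B̄(-4z). Against M(z) = φ(z)B(z)C(z) this leaves φ(z),
  -- and the prefactor on the left clears the constant.
  P-form : ∀ x → (B · C) -4F * ((g B̄ * g C̄ * g M) * P x)
    ≈ W₂ C̄ B̄ (λ v w → T x w v)
  P-form x = begin
    (B · C) -4F * ((g B̄ * g C̄ * g M) * P x)
      ≈⟨ *-congˡ (P-gauss x) ⟩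
    (B · C) -4F * W M (λ z → W₂ C̄ B̄ (λ v w → S z v w))
      ≈⟨ sym (W-*ˡ M _ _) ⟩
    W M (λ z → (B · C) -4F * W₂ C̄ B̄ (λ v w → S z v w))
      ≈⟨ W-cong (at-0 cM) φ-0 rescale ⟩
    W φ (λ z → W₂ C̄ B̄ (λ v w → sumF (λ r → sumF (λ s → ψ (z *F form x w v r s)))))
      ≈⟨ W-W₂-swap φ C̄ B̄ _ ⟩
    W₂ C̄ B̄ (λ v w → T x w v) ∎
    where
    S : F → F → F → K
    S z v w = sumF (λ r → sumF (λ s →
        ψ (((r *F (1F -F r)) *F v +F (s *F (1F -F s)) *F w) +F (1F -F (4F *F x *F r *F s)) *F z)))
    S-scaled : ∀ z v w → S z (-4F *F z *F v) (-4F *F z *F w) ≈ sumF (λ r → sumF (λ s → ψ (z *F form x w v r s)))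
    S-scaled z v w = trans
      (Σ-cong λ r → trans (Σ-cong λ s → ψ-≡ (solveF 6 (λ z v w x r s →
          ((r ⊗ (num (+ 1) ⊖ r)) ⊗ ((⊝ num (+ 4)) ⊗ z ⊗ v) ⊕ (s ⊗ (num (+ 1) ⊖ s)) ⊗ ((⊝ num (+ 4)) ⊗ z ⊗ w))
            ⊕ (num (+ 1) ⊖ (num (+ 4) ⊗ x ⊗ r ⊗ s)) ⊗ z
          ≋ z ⊗ (((v ⊗ ((num (+ 2) ⊗ r) ⊗ (num (+ 2) ⊗ r)) ⊕ w ⊗ ((num (+ 2) ⊗ s) ⊗ (num (+ 2) ⊗ s)))
               ⊖ (x ⊗ (num (+ 2) ⊗ r) ⊗ (num (+ 2) ⊗ s)))
             ⊖ ((num (+ 2) ⊗ v ⊗ (num (+ 2) ⊗ r) ⊕ num (+ 2) ⊗ w ⊗ (num (+ 2) ⊗ s)) ⊖ num (+ 1)))) ≡.refl z v w x r s))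
        (Σ-scale 2≢0 (λ s → ψ (z *F form x w v (2F *F r) s))))
      (Σ-scale 2≢0 (λ r → sumF (λ s → ψ (z *F form x w v r s))))
    rescale : ∀ z → z ≢ 0F →
      M z * ((B · C) -4F * W₂ C̄ B̄ (λ v w → S z v w))
      ≈ φ z * W₂ C̄ B̄ (λ v w → sumF (λ r → sumF (λ s → ψ (z *F form x w v r s))))
    rescale z n = begin
      M z * ((B · C) -4F * W₂ C̄ B̄ (λ v w → S z v w))
        ≈⟨ *-congˡ (*-congˡ (trans (W-scale cC̄ a≢0 _) (*-congˡ (trans
             (Σ-cong λ v → *-congˡ (W-scale cB̄ a≢0 _)) (W-*ˡ C̄ _ _))))) ⟩
      M z * ((B · C) -4F * (C̄ a * (B̄ a * W₂ C̄ B̄ (λ v w → S z (a *F v) (a *F w)))))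
        ≈⟨ *-cong (M≈φBC z) (*-congˡ (*-congˡ (*-congˡ (W₂-cong _ _ λ v w → S-scaled z v w)))) ⟩
      (φ z * (B z * C z)) * ((B -4F * C -4F) * (C̄ a * (B̄ a * R)))
        ≈⟨ solve 8 (λ f b c b4 c4 ca ba r → (f :* (b :* c)) :* ((b4 :* c4) :* (ca :* (ba :* r)))
             := (f :* r) :* (((b4 :* b) :* ba) :* ((c4 :* c) :* ca))) refl _ _ _ _ _ _ _ _ ⟩
      (φ z * R) * (((B -4F * B z) * B̄ a) * ((C -4F * C z) * C̄ a))
        ≈⟨ *-congˡ (*-cong (unit cB) (unit cC)) ⟩
      (φ z * R) * (1# * 1#)
        ≈⟨ solve 1 (λ a → a :* (con (+ 1) :* con (+ 1)) := a) refl _ ⟩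
      φ z * R ∎
      where
      a = -4F *F z
      a≢0 : a ≢ 0F
      a≢0 = *F≢0 (-≢0 4≢0) n
      R = W₂ C̄ B̄ (λ v w → sumF (λ r → sumF (λ s → ψ (z *F form x w v r s))))
      unit : ∀ {χ} → IsCharacter χ → (χ -4F * χ z) * conj χ a ≈ 1#
      unit c = trans (*-congʳ (sym (at-* c -4F z))) (*-conj c a≢0)

  -- `Δ` is minus the discriminant of vr² - xrs + ws²; `D` is -4 times the determinant of the
  -- ternary form that homogenises `form`.
  Δ D : F → F → F → F
  Δ x w v = (4F *F w *F v) -F (x *F x)
  D x w v = x *F x +F 4F *F w *F v *F ((x -F 1F) +F (w +F v))

  quadratic-sum : ∀ {a z} → a ≢ 0F → z ≢ 0F → ∀ b c →
    sumF (λ s → ψ (z *F (((a *F (s *F s)) -F (b *F s)) +F c)))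
    ≈ (φ (z *F a) * g φ) * ψ (z *F (c -F (b *F b *F (h *F h *F invF a))))
  quadratic-sum {a} {z} a≢0 z≢0 b c = begin
    sumF (λ s → ψ (z *F (((a *F (s *F s)) -F (b *F s)) +F c)))
      ≈⟨ sym (Σ-shift m _) ⟩
    sumF (λ s → ψ (z *F (((a *F ((s +F m) *F (s +F m))) -F (b *F (s +F m))) +F c)))
      ≈⟨ Σ-cong (λ s → ψ-split (completed s)) ⟩
    sumF (λ s → ψ ((z *F a) *F (s *F s)) * ψ (z *F (c -F (b *F b *F (h *F h *F i)))))
      ≈⟨ Σ-*ʳ _ _ ⟩
    sumF (λ s → ψ ((z *F a) *F (s *F s))) * ψ (z *F (c -F (b *F b *F (h *F h *F i))))
      ≈⟨ *-congʳ (quadratic (*F≢0 z≢0 a≢0)) ⟩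
    (φ (z *F a) * g φ) * ψ (z *F (c -F (b *F b *F (h *F h *F i)))) ∎
    where
    i = invF a
    m = b *F h *F i
    completed : ∀ s → z *F (((a *F ((s +F m) *F (s +F m))) -F (b *F (s +F m))) +F c)
                      ≡ (z *F a) *F (s *F s) +F z *F (c -F (b *F b *F (h *F h *F i)))
    completed s = modulo (z *F (s *F b +F b *F b *F h *F i)) 2h≡1
      (modulo (z *F (2F *F h *F s *F b +F b *F b *F h *F h *F i)) (invF-inverse a a≢0)
        (solveF 7 (λ a b c z s h i →
          z ⊗ ((a ⊗ ((s ⊕ b ⊗ h ⊗ i) ⊗ (s ⊕ b ⊗ h ⊗ i)) ⊖ b ⊗ (s ⊕ b ⊗ h ⊗ i)) ⊕ c)
          ≋ (((z ⊗ a) ⊗ (s ⊗ s) ⊕ z ⊗ (c ⊖ b ⊗ b ⊗ (h ⊗ h ⊗ i)))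
              ⊕ (num (+ 2) ⊗ h ⊖ num (+ 1)) ⊗ (z ⊗ (s ⊗ b ⊕ b ⊗ b ⊗ h ⊗ i)))
            ⊕ (a ⊗ i ⊖ num (+ 1)) ⊗ (z ⊗ (num (+ 2) ⊗ h ⊗ s ⊗ b ⊕ b ⊗ b ⊗ h ⊗ h ⊗ i)))
          ≡.refl a b c z s h i))

  module _ (x w v : F) (w≢0 : w ≢ 0F) where
    -- After completing the square in s the exponent is αr² - kr + (1 - w), with 4wα = `Δ x w v`.
    i α k : F
    i = invF w
    α = v -F (x *F x *F (h *F h *F i))
    k = 2F *F v +F x

    wi≡1 : w *F i ≡ 1F
    wi≡1 = invF-inverse w w≢0

    Δ≡4wα : Δ x w v ≡ 4F *F w *F α
    Δ≡4wα = modulo (x *F x *F (2F *F h +F 1F)) 2h≡1 (modulo (x *F x *F (4F *F h *F h)) wi≡1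
      (solveF 5 (λ x w v h i → num (+ 4) ⊗ w ⊗ v ⊖ x ⊗ x
        ≋ (num (+ 4) ⊗ w ⊗ (v ⊖ x ⊗ x ⊗ (h ⊗ h ⊗ i)) ⊕ (num (+ 2) ⊗ h ⊖ num (+ 1)) ⊗ (x ⊗ x ⊗ (num (+ 2) ⊗ h ⊕ num (+ 1))))
          ⊕ (w ⊗ i ⊖ num (+ 1)) ⊗ (x ⊗ x ⊗ (num (+ 4) ⊗ h ⊗ h))) ≡.refl x w v h i))

    Δ≡0⇒α≡0 : Δ x w v ≡ 0F → α ≡ 0F
    Δ≡0⇒α≡0 e = zero-factor (*F≢0 4≢0 w≢0) (≡.trans (≡.sym Δ≡4wα) e)

    α≡0⇒Δ≡0 : α ≡ 0F → Δ x w v ≡ 0F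
    α≡0⇒Δ≡0 e = ≡.trans Δ≡4wα (≡.trans (≡.cong ((4F *F w) *F_) e) (RF.zeroʳ _))

    sum-s : ∀ {z} → z ≢ 0F → ∀ r → sumF (λ s → ψ (z *F form x w v r s))
      ≈ (φ (z *F w) * g φ) * ψ (z *F (((α *F (r *F r)) -F (k *F r)) +F (1F -F w)))
    sum-s {z} z≢0 r = begin
      sumF (λ s → ψ (z *F form x w v r s))
        ≈⟨ Σ-cong (λ s → ψ-≡ (≡.cong (z *F_) (solveF 5 (λ x w v r s →
             ((v ⊗ (r ⊗ r) ⊕ w ⊗ (s ⊗ s)) ⊖ (x ⊗ r ⊗ s)) ⊖ ((num (+ 2) ⊗ v ⊗ r ⊕ num (+ 2) ⊗ w ⊗ s) ⊖ num (+ 1))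
             ≋ ((w ⊗ (s ⊗ s)) ⊖ ((x ⊗ r ⊕ num (+ 2) ⊗ w) ⊗ s)) ⊕ (v ⊗ (r ⊗ r) ⊖ num (+ 2) ⊗ v ⊗ r ⊕ num (+ 1)))
             ≡.refl x w v r s))) ⟩
      sumF (λ s → ψ (z *F (((w *F (s *F s)) -F ((x *F r +F 2F *F w) *F s)) +F c₀)))
        ≈⟨ quadratic-sum w≢0 z≢0 _ _ ⟩
      (φ (z *F w) * g φ) * ψ (z *F (c₀ -F ((x *F r +F 2F *F w) *F (x *F r +F 2F *F w) *F (h *F h *F i))))
        ≈⟨ *-congˡ (ψ-≡ (≡.cong (z *F_) rearrange)) ⟩
      (φ (z *F w) * g φ) * ψ (z *F (((α *F (r *F r)) -F (k *F r)) +F (1F -F w))) ∎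
      where
      c₀ = (v *F (r *F r) +F (-F (2F *F v *F r))) +F 1F
      rearrange : c₀ -F ((x *F r +F 2F *F w) *F (x *F r +F 2F *F w) *F (h *F h *F i))
                  ≡ ((α *F (r *F r)) -F (k *F r)) +F (1F -F w)
      rearrange = modulo (-F ((x *F r +F w) *F (2F *F h +F 1F))) 2h≡1
        (modulo (-F ((x *F r +F w) *F (4F *F h *F h))) wi≡1
          (solveF 6 (λ x w v r h i →
            ((v ⊗ (r ⊗ r) ⊕ (⊝ (num (+ 2) ⊗ v ⊗ r))) ⊕ num (+ 1))
              ⊖ ((x ⊗ r ⊕ num (+ 2) ⊗ w) ⊗ (x ⊗ r ⊕ num (+ 2) ⊗ w) ⊗ (h ⊗ h ⊗ i))
            ≋ (((((v ⊖ x ⊗ x ⊗ (h ⊗ h ⊗ i)) ⊗ (r ⊗ r)) ⊖ ((num (+ 2) ⊗ v ⊕ x) ⊗ r)) ⊕ (num (+ 1) ⊖ w))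
                ⊕ (num (+ 2) ⊗ h ⊖ num (+ 1)) ⊗ (⊝ ((x ⊗ r ⊕ w) ⊗ (num (+ 2) ⊗ h ⊕ num (+ 1)))))
              ⊕ (w ⊗ i ⊖ num (+ 1)) ⊗ (⊝ ((x ⊗ r ⊕ w) ⊗ (num (+ 4) ⊗ h ⊗ h)))) ≡.refl x w v r h i))

    -- Completing the square in r as well leaves the constant c with wαc = -D/4. The two Gauss sums
    -- contribute φ(z)² = 1, so the sum over z is the quadratic Gauss sum at c.
    T-nondegenerate : α ≢ 0F → T x w v ≈ (q * g φ) * φ (D x w v)
    T-nondegenerate α≢0 = begin
      T x w v
        ≈⟨ W-congʳ φ-0 (λ z n → trans (Σ-cong λ r → sum-s n r) (trans (Σ-*ˡ _ _) (*-congˡ (quadratic-sum α≢0 n _ _)))) ⟩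
      W φ (λ z → (φ (z *F w) * g φ) * ((φ (z *F α) * g φ) * ψ (z *F c)))
        ≈⟨ W-congʳ φ-0 (λ z n → trans (*-cong (*-congʳ (at-* φ-char z w)) (*-cong (*-congʳ (at-* φ-char z α)) (ψ-≡ (RF.*-comm z c))))
             (trans (solve 5 (λ z w a g p → ((z :* w) :* g) :* (((z :* a) :* g) :* p) := ((z :* z) :* ((w :* a) :* (g :* g))) :* p) refl _ _ _ _ _)
               (*-congʳ (trans (*-congʳ (φ² n)) (*-identityˡ _))))) ⟩
      W φ (λ z → ((φ w * φ α) * (g φ * g φ)) * ψ (c *F z))
        ≈⟨ W-*ˡ φ _ _ ⟩
      ((φ w * φ α) * (g φ * g φ)) * W φ (λ z → ψ (c *F z))
        ≈⟨ *-cong (*-congˡ gφ²) (trans (twist φ-char φ-nontrivial c) (*-congʳ (φ-inv c))) ⟩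
      ((φ w * φ α) * (φ (-F 1F) * q)) * (φ c * g φ)
        ≈⟨ solve 6 (λ w a m q c g → ((w :* a) :* (m :* q)) :* (c :* g) := (q :* g) :* (m :* ((w :* a) :* c))) refl _ _ _ _ _ _ ⟩
      (q * g φ) * (φ (-F 1F) * ((φ w * φ α) * φ c))
        ≈⟨ *-congˡ (*-congˡ (trans (*-congʳ (sym (at-* φ-char w α))) (sym (at-* φ-char _ c)))) ⟩
      (q * g φ) * (φ (-F 1F) * φ (w *F α *F c))
        ≈⟨ *-congˡ (*-congˡ (trans (≡⇒≈ (≡.cong φ determinant)) (φ-square-* h≢0 _))) ⟩
      (q * g φ) * (φ (-F 1F) * φ (-F D x w v))
        ≈⟨ *-congˡ (trans (sym (at-minus φ-char _)) (≡⇒≈ (≡.cong φ (solveF 1 (λ d → ⊝ (⊝ d) ≋ d) ≡.refl (D x w v))))) ⟩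
      (q * g φ) * φ (D x w v) ∎
      where
      j = invF α
      c = (1F -F w) -F (k *F k *F (h *F h *F j))
      determinant : w *F α *F c ≡ (h *F h) *F (-F D x w v)
      determinant = ≡.trans
        (modulo (-F (k *F k *F (h *F h) *F w)) (invF-inverse α α≢0)
          (solveF 5 (λ w a k h j → w ⊗ a ⊗ ((num (+ 1) ⊖ w) ⊖ k ⊗ k ⊗ (h ⊗ h ⊗ j))
            ≋ (w ⊗ a ⊗ (num (+ 1) ⊖ w) ⊖ k ⊗ k ⊗ (h ⊗ h) ⊗ w) ⊕ (a ⊗ j ⊖ num (+ 1)) ⊗ (⊝ (k ⊗ k ⊗ (h ⊗ h) ⊗ w))) ≡.refl w α k h j))
        (modulo (-F ((2F *F h +F 1F) *F (w *F v *F (1F -F w)))) 2h≡1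
          (modulo (-F (x *F x *F (h *F h) *F (1F -F w))) wi≡1
            (solveF 5 (λ x w v h i →
              w ⊗ (v ⊖ x ⊗ x ⊗ (h ⊗ h ⊗ i)) ⊗ (num (+ 1) ⊖ w) ⊖ (num (+ 2) ⊗ v ⊕ x) ⊗ (num (+ 2) ⊗ v ⊕ x) ⊗ (h ⊗ h) ⊗ w
              ≋ (((h ⊗ h) ⊗ (⊝ (x ⊗ x ⊕ num (+ 4) ⊗ w ⊗ v ⊗ ((x ⊖ num (+ 1)) ⊕ (w ⊕ v)))))
                  ⊕ (num (+ 2) ⊗ h ⊖ num (+ 1)) ⊗ (⊝ ((num (+ 2) ⊗ h ⊕ num (+ 1)) ⊗ (w ⊗ v ⊗ (num (+ 1) ⊖ w)))))
                ⊕ (w ⊗ i ⊖ num (+ 1)) ⊗ (⊝ (x ⊗ x ⊗ (h ⊗ h) ⊗ (num (+ 1) ⊖ w)))) ≡.refl x w v h i)))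

    -- The exponent is now linear in r, so the sum over r forces k = 0. Only one factor φ(z) arises;
    -- it cancels the weight φ(z), and z runs over the nonzero elements without a character.
    T-degenerate : α ≡ 0F → T x w v ≈ (q * g φ) * (φ w * (δ k * (δ (1F -F w) * q - 1#)))
    T-degenerate α≡0 = begin
      T x w v
        ≈⟨ W-cong φ-0 ε-0 (λ z n → term z n) ⟩
      W ε (λ z → ((q * g φ) * (φ w * δ k)) * ψ ((1F -F w) *F z))
        ≈⟨ trans (W-*ˡ ε _ _) (*-congˡ (Wε-ψ _)) ⟩
      ((q * g φ) * (φ w * δ k)) * (δ (1F -F w) * q - 1#)
        ≈⟨ solve 4 (λ a b c d → (a :* (b :* c)) :* d := a :* (b :* (c :* d))) refl _ _ _ _ ⟩
      (q * g φ) * (φ w * (δ k * (δ (1F -F w) * q - 1#))) ∎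
      where
      term : ∀ z → z ≢ 0F → φ z * sumF (λ r → sumF (λ s → ψ (z *F form x w v r s)))
           ≈ ε z * (((q * g φ) * (φ w * δ k)) * ψ ((1F -F w) *F z))
      term z n = begin
        φ z * sumF (λ r → sumF (λ s → ψ (z *F form x w v r s)))
          ≈⟨ *-congˡ (trans (Σ-cong λ r → sum-s n r) (Σ-*ˡ _ _)) ⟩
        φ z * ((φ (z *F w) * g φ) * sumF (λ r → ψ (z *F (((α *F (r *F r)) -F (k *F r)) +F (1F -F w)))))
          ≈⟨ *-congˡ (*-cong (*-congʳ (at-* φ-char z w)) (Σ-cong λ r → ψ-split (≡.trans
               (≡.cong (λ a → z *F (((a *F (r *F r)) -F (k *F r)) +F (1F -F w))) α≡0)
               (solveF 4 (λ z r k w → z ⊗ ((num (+ 0) ⊗ (r ⊗ r) ⊖ k ⊗ r) ⊕ (num (+ 1) ⊖ w))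
                 ≋ (num (+ 1) ⊖ w) ⊗ z ⊕ (⊝ (z ⊗ k)) ⊗ r) ≡.refl z r k w)))) ⟩
        φ z * (((φ z * φ w) * g φ) * sumF (λ r → ψ ((1F -F w) *F z) * ψ ((-F (z *F k)) *F r)))
          ≈⟨ *-congˡ (*-congˡ (trans (Σ-*ˡ _ _) (*-congˡ (trans (ψ-orthogonal _) (*-congʳ (δ-⇔ to from)))))) ⟩
        φ z * (((φ z * φ w) * g φ) * (ψ ((1F -F w) *F z) * (δ k * q)))
          ≈⟨ solve 6 (λ z w g p d q → z :* (((z :* w) :* g) :* (p :* (d :* q))) := (z :* z) :* (((q :* g) :* (w :* d)) :* p))
               refl _ _ _ _ _ _ ⟩
        (φ z * φ z) * (((q * g φ) * (φ w * δ k)) * ψ ((1F -F w) *F z))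
          ≈⟨ *-congʳ (trans (φ² n) (sym (ε-≢0 n))) ⟩
        ε z * (((q * g φ) * (φ w * δ k)) * ψ ((1F -F w) *F z)) ∎
        where
        to : -F (z *F k) ≡ 0F → k ≡ 0F
        to e with k ≟F 0F
        ... | yes e′ = e′
        ... | no n′  = ⊥-elim (-≢0 (*F≢0 n n′) e)
        from : k ≡ 0F → -F (z *F k) ≡ 0F
        from e = ≡.trans (≡.cong (λ t → -F (z *F t)) e) (solveF 1 (λ z → ⊝ (z ⊗ num (+ 0)) ≋ num (+ 0)) ≡.refl z)

    -- What is added to φ(D) on the curve 4wv = x² so that one formula covers both cases. At points
    -- with 2w + x ≠ 0 it cancels φ(D); its q-term survives only at w = 1, x = -2.
    correction : K
    correction = φ w * (q * (δ (2F *F w +F x) * δ (1F -F w)) - 1#)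

    -- On the degenerate curve 4wD = (x(2w + x))², so φ(D) is φ(w) or 0. There 2w + x and 2v + x
    -- vanish together, which lets the condition k = 0 be stated through w.
    T-value : v ≢ 0F → T x w v ≈ (q * g φ) * (φ (D x w v) + δ (Δ x w v) * correction)
    T-value v≢0 with Δ x w v ≟F 0F
    ... | no n = trans (T-nondegenerate (λ e → n (α≡0⇒Δ≡0 e)))
      (*-congˡ (solve 2 (λ a b → a := a :+ con (+ 0) :* b) refl _ _))
    ... | yes Δ≡0 = trans (T-degenerate (Δ≡0⇒α≡0 Δ≡0)) (*-congˡ (degenerate ((2F *F w +F x) ≟F 0F)))
      where
      4wv : 4F *F w *F v ≡ x *F x
      4wv = sub≡0 Δ≡0
      x≢0 : x ≢ 0F
      x≢0 ≡.refl = *F≢0 (*F≢0 4≢0 w≢0) v≢0 (≡.trans 4wv (RF.zeroˡ _))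
      other-root : ∀ {a b} → a ≢ 0F → 4F *F a *F b ≡ x *F x → 2F *F a +F x ≡ 0F → 2F *F b +F x ≡ 0F
      other-root {a} {b} a≢0 4ab e = zero-factor (*F≢0 2≢0 a≢0)
        (modulo x e (modulo 1F 4ab (solveF 3 (λ a b x → num (+ 2) ⊗ a ⊗ (num (+ 2) ⊗ b ⊕ x)
          ≋ (num (+ 0) ⊕ ((num (+ 2) ⊗ a ⊕ x) ⊖ num (+ 0)) ⊗ x) ⊕ (num (+ 4) ⊗ a ⊗ b ⊖ x ⊗ x) ⊗ num (+ 1)) ≡.refl a b x)))
      4wD : 4F *F w *F D x w v ≡ (x *F (2F *F w +F x)) *F (x *F (2F *F w +F x))
      4wD = modulo (x *F x +F 4F *F w *F ((x -F 1F) +F (w +F v))) 4wv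
        (solveF 3 (λ x w v → num (+ 4) ⊗ w ⊗ (x ⊗ x ⊕ num (+ 4) ⊗ w ⊗ v ⊗ ((x ⊖ num (+ 1)) ⊕ (w ⊕ v)))
          ≋ (x ⊗ (num (+ 2) ⊗ w ⊕ x)) ⊗ (x ⊗ (num (+ 2) ⊗ w ⊕ x))
            ⊕ (num (+ 4) ⊗ w ⊗ v ⊖ x ⊗ x) ⊗ (x ⊗ x ⊕ num (+ 4) ⊗ w ⊗ ((x ⊖ num (+ 1)) ⊕ (w ⊕ v)))) ≡.refl x w v)
      degenerate : Dec (2F *F w +F x ≡ 0F) →
        φ w * (δ k * (δ (1F -F w) * q - 1#)) ≈ φ (D x w v) + 1# * correction
      degenerate (yes e) = begin
        φ w * (δ k * (δ (1F -F w) * q - 1#))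
          ≈⟨ *-congˡ (*-congʳ (δ-≡0 (other-root w≢0 4wv e))) ⟩
        φ w * (1# * (δ (1F -F w) * q - 1#))
          ≈⟨ solve 3 (λ f d q → f :* (con (+ 1) :* (d :* q :- con (+ 1)))
               := con (+ 0) :+ con (+ 1) :* (f :* (q :* (con (+ 1) :* d) :- con (+ 1)))) refl _ _ q ⟩
        0# + 1# * (φ w * (q * (1# * δ (1F -F w)) - 1#))
          ≈⟨ +-cong (sym (trans (≡⇒≈ (≡.cong φ D≡0)) φ-0)) (*-congˡ (*-congˡ (+-congʳ (*-congˡ (*-congʳ (sym (δ-≡0 e))))))) ⟩
        φ (D x w v) + 1# * correction ∎
        where
        D≡0 : D x w v ≡ 0F
        D≡0 = zero-factor (*F≢0 4≢0 w≢0) (≡.trans 4wD (≡.trans (≡.cong (λ t → (x *F t) *F (x *F t)) e)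
          (solveF 1 (λ x → (x ⊗ num (+ 0)) ⊗ (x ⊗ num (+ 0)) ≋ num (+ 0)) ≡.refl x)))
      degenerate (no n) = begin
        φ w * (δ k * (δ (1F -F w) * q - 1#))
          ≈⟨ *-congˡ (*-congʳ (δ-≢0 λ e → n (other-root v≢0 (≡.trans
               (solveF 2 (λ w v → num (+ 4) ⊗ v ⊗ w ≋ num (+ 4) ⊗ w ⊗ v) ≡.refl w v) 4wv) e))) ⟩
        φ w * (0# * (δ (1F -F w) * q - 1#))
          ≈⟨ solve 3 (λ f d q → f :* (con (+ 0) :* (d :* q :- con (+ 1)))
               := f :+ con (+ 1) :* (f :* (q :* (con (+ 0) :* d) :- con (+ 1)))) refl _ _ q ⟩
        φ w + 1# * (φ w * (q * (0# * δ (1F -F w)) - 1#))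
          ≈⟨ +-cong (sym φD) (*-congˡ (*-congˡ (+-congʳ (*-congˡ (*-congʳ (sym (δ-≢0 n))))))) ⟩
        φ (D x w v) + 1# * correction ∎
        where
        φwD : φ w * φ (D x w v) ≈ 1#
        φwD = begin
          φ w * φ (D x w v)                  ≈⟨ sym (at-* φ-char _ _) ⟩
          φ (w *F D x w v)                   ≈⟨ sym (φ-square-* 2≢0 _) ⟩
          φ ((2F *F 2F) *F (w *F D x w v))   ≈⟨ ≡⇒≈ (≡.cong φ (≡.trans
            (solveF 2 (λ w d → (num (+ 2) ⊗ num (+ 2)) ⊗ (w ⊗ d) ≋ num (+ 4) ⊗ w ⊗ d) ≡.refl w (D x w v)) 4wD)) ⟩
          φ ((x *F (2F *F w +F x)) *F (x *F (2F *F w +F x)))   ≈⟨ φ-square (*F≢0 x≢0 n) ⟩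
          1#                                 ∎
        φD : φ (D x w v) ≈ φ w
        φD = begin
          φ (D x w v)                  ≈⟨ sym (*-identityˡ _) ⟩
          1# * φ (D x w v)             ≈⟨ *-congʳ (sym (φ² w≢0)) ⟩
          (φ w * φ w) * φ (D x w v)    ≈⟨ *-assoc _ _ _ ⟩
          φ w * (φ w * φ (D x w v))    ≈⟨ *-congˡ φwD ⟩
          φ w * 1#                     ≈⟨ *-identityʳ _ ⟩
          φ w                          ∎

  H : F → K
  H x = W₂ C̄ B̄ (λ v w → φ (D x w v))

  -- The conditions leave the single point v = w = 1, present only for x = -2, and all characters
  -- are 1 there.
  point-sum : ∀ x → W₂ C̄ B̄ (λ v w → δ (Δ x w v) * (φ w * (δ (2F *F w +F x) * δ (1F -F w)))) ≈ δ (x +F 2F)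
  point-sum x = begin
    W₂ C̄ B̄ (λ v w → δ (Δ x w v) * (φ w * (δ (2F *F w +F x) * δ (1F -F w))))
      ≈⟨ Σ-cong (λ v → *-congˡ (trans (Σ-cong λ w →
           solve 5 (λ b d f a e → b :* (d :* (f :* (a :* e))) := e :* ((b :* f) :* (a :* d))) refl _ _ _ _ _) (Σ-δ′ 1F _))) ⟩
    W C̄ (λ v → (B̄ 1F * φ 1F) * (δ (2F *F 1F +F x) * δ (Δ x 1F v)))
      ≈⟨ Σ-cong (λ v → trans (*-congˡ (trans (*-congʳ (trans (*-cong (at-1 cB̄) φ-1) (*-identityˡ 1#)))
           (trans (*-identityˡ _) (*-congʳ (δ-⇔ (λ e → ≡.trans (twice x) e) (λ e → ≡.trans (≡.sym (twice x)) e))))))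
           (solve 3 (λ a b c → a :* (b :* c) := b :* (a :* c)) refl _ _ _)) ⟩
    sumF (λ v → δ (x +F 2F) * (C̄ v * δ (Δ x 1F v)))
      ≈⟨ Σ-*ˡ _ _ ⟩
    δ (x +F 2F) * sumF (λ v → C̄ v * δ (Δ x 1F v))
      ≈⟨ δ-*-cong collapse ⟩
    δ (x +F 2F) * 1#
      ≈⟨ *-identityʳ _ ⟩
    δ (x +F 2F) ∎
    where
    twice : ∀ x → x +F 2F ≡ 2F *F 1F +F x
    twice x = solveF 1 (λ x → x ⊕ num (+ 2) ≋ num (+ 2) ⊗ num (+ 1) ⊕ x) ≡.refl x
    Δ-at : x +F 2F ≡ 0F → ∀ v → Δ x 1F v ≡ 4F *F (v -F 1F)
    Δ-at e v = modulo (2F -F x) e (solveF 2 (λ x v → num (+ 4) ⊗ num (+ 1) ⊗ v ⊖ x ⊗ x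
      ≋ num (+ 4) ⊗ (v ⊖ num (+ 1)) ⊕ ((x ⊕ num (+ 2)) ⊖ num (+ 0)) ⊗ (num (+ 2) ⊖ x)) ≡.refl x v)
    collapse : x +F 2F ≡ 0F → sumF (λ v → C̄ v * δ (Δ x 1F v)) ≈ 1#
    collapse e = trans (Σ-cong λ v → trans (*-comm _ _) (*-congʳ (δ-⇔ (to v) (from v))))
      (trans (Σ-δ 1F C̄) (at-1 cC̄))
      where
      to : ∀ v → Δ x 1F v ≡ 0F → v -F 1F ≡ 0F
      to v z = zero-factor 4≢0 (≡.trans (≡.sym (Δ-at e v)) z)
      from : ∀ v → v -F 1F ≡ 0F → Δ x 1F v ≡ 0F
      from v z = ≡.trans (Δ-at e v) (≡.trans (≡.cong (4F *F_) z) (RF.zeroʳ _))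

  -- Each nonzero w has the single v = x²/(4w). What remains is the full sum of B̄φC = A³B̄², a
  -- nontrivial character.
  curve-sum : ∀ x → W₂ C̄ B̄ (λ v w → δ (Δ x w v) * φ w) ≈ 0#
  curve-sum x = begin
    W₂ C̄ B̄ (λ v w → δ (Δ x w v) * φ w)
      ≈⟨ W-swap C̄ B̄ _ ⟩
    W B̄ (λ w → W C̄ (λ v → δ (Δ x w v) * φ w))
      ≈⟨ W-congʳ (at-0 cB̄) (λ w n → trans (Σ-cong λ v → trans
           (solve 3 (λ c d f → c :* (d :* f) := d :* (c :* f)) refl _ _ _)
           (*-congʳ (δ-⇔ (Δ≡0⇒α≡0 x w v n) (α≡0⇒Δ≡0 x w v n)))) (trans (Σ-δ _ _) (*-congʳ (split w)))) ⟩
    W B̄ (λ w → (C̄ (x *F x *F (h *F h)) * C w) * φ w)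
      ≈⟨ trans (Σ-cong λ w → solve 4 (λ b k c f → b :* ((k :* c) :* f) := k :* ((b :* f) :* c)) refl _ _ _ _) (Σ-*ˡ _ _) ⟩
    C̄ (x *F x *F (h *F h)) * sumF (B̄ · φ · C)
      ≈⟨ *-congˡ (Σ-nontrivial (·-character (·-character cB̄ φ-char) cC) nBC) ⟩
    C̄ (x *F x *F (h *F h)) * 0#
      ≈⟨ zeroʳ _ ⟩
    0# ∎
    where
    split : ∀ w → C̄ (x *F x *F (h *F h *F invF w)) ≈ C̄ (x *F x *F (h *F h)) * C w
    split w = trans (≡⇒≈ (≡.cong C̄ (≡.sym (RF.*-assoc _ _ _))))
      (trans (at-* cC̄ _ _) (*-congˡ (conj-conj C w)))

  P-value : ∀ x → (B · C) -4F * ((g B̄ * g C̄ * g M) * P x)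
    ≈ (q * g φ) * H x + (q * g φ) * (q * δ (x +F 2F))
  P-value x = begin
    (B · C) -4F * ((g B̄ * g C̄ * g M) * P x)
      ≈⟨ P-form x ⟩
    W₂ C̄ B̄ (λ v w → T x w v)
      ≈⟨ W-congʳ (at-0 cC̄) (λ v n → W-congʳ (at-0 cB̄) (λ w n′ → trans (T-value x w v n′ n)
           (solve 6 (λ k f d w q e → k :* (f :+ d :* (w :* (q :* e :- con (+ 1)))) := (k :* f :+ (k :* q) :* (d :* (w :* e))) :- k :* (d :* w))
             refl _ _ _ _ q _))) ⟩
    W₂ C̄ B̄ (λ v w → (κ * a v w + (κ * q) * b v w) - κ * c v w)
      ≈⟨ trans (Σ-cong λ v → *-congˡ (linear B̄ _ _ _)) (linear C̄ _ _ _) ⟩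
    (κ * H x + (κ * q) * W C̄ (λ v → W B̄ (b v))) - κ * W C̄ (λ v → W B̄ (c v))
      ≈⟨ +-cong (+-congˡ (*-congˡ (point-sum x))) (-‿cong (*-congˡ (curve-sum x))) ⟩
    (κ * H x + (κ * q) * δ (x +F 2F)) - κ * 0#
      ≈⟨ solve 4 (λ k h q d → (k :* h :+ (k :* q) :* d) :- k :* con (+ 0) := k :* h :+ k :* (q :* d)) refl κ _ q _ ⟩
    κ * H x + κ * (q * δ (x +F 2F)) ∎
    where
    κ = q * g φ
    a b c : F → F → K
    a v w = φ (D x w v)
    b v w = δ (Δ x w v) * (φ w * (δ (2F *F w +F x) * δ (1F -F w)))
    c v w = δ (Δ x w v) * φ w
    linear : ∀ χ (f f′ f″ : F → K) → W χ (λ w → (κ * f w + (κ * q) * f′ w) - κ * f″ w)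
      ≈ (κ * W χ f + (κ * q) * W χ f′) - κ * W χ f″
    linear χ f f′ f″ = trans (W-- χ _ _) (+-cong
      (trans (trans (Σ-cong λ w → distribˡ _ _ _) (Σ-+ _ _)) (+-cong (W-*ˡ χ κ f) (W-*ˡ χ (κ * q) f′)))
      (-‿cong (W-*ˡ χ κ f″)))

  -- Nontriviality on the left and Jacobi sums on the right

  nA : Nontrivial A
  nA t = nM λ x n → trans (*-cong (*-cong (t x n) (t x n)) (t x n))
    (solve 0 (con (+ 1) :* con (+ 1) :* con (+ 1) := con (+ 1)) refl)

  -- If this character were trivial, so would be its cube φA³B̄³, as η³ = 1 and φ³ = φ.
  nAη : Nontrivial (A · η · conj (φ · B))
  nAη t = n₄ λ x n → begin
    φ x * M x * conj (cube B) x
      ≈⟨ solve 1 (λ a → a := a :* (con (+ 1) :* con (+ 1))) refl _ ⟩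
    (φ x * M x * conj (cube B) x) * (1# * 1#)
      ≈⟨ *-congˡ (*-cong (sym (η³-trivial x n)) (sym (φ² n))) ⟩
    (φ x * M x * conj (cube B) x) * ((η x * η x * η x) * (φ x * φ x))
      ≈⟨ solve 4 (λ f a b e → (f :* (a :* a :* a) :* (b :* b :* b)) :* ((e :* e :* e) :* (f :* f))
           := ((a :* e) :* (f :* b)) :* ((a :* e) :* (f :* b)) :* ((a :* e) :* (f :* b))) refl _ _ _ _ ⟩
    cubed ((A x * η x) * (φ x * B̄ x))
      ≈⟨ *-cong (*-cong (one x n) (one x n)) (one x n) ⟩
    1# * 1# * 1#
      ≈⟨ solve 0 (con (+ 1) :* con (+ 1) :* con (+ 1) := con (+ 1)) refl ⟩
    1# ∎
    where
    cubed : K → K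
    cubed a = a * a * a
    one : ∀ x → x ≢ 0F → (A x * η x) * (φ x * B̄ x) ≈ 1#
    one x n = trans (*-congˡ (*-congʳ (sym (φ-inv x)))) (t x n)

  -- Cubing removes η̄ and gives Ā⁶B³, the inverse of a nontrivial character.
  nAη̄ : Nontrivial (A · η̄ · conj (M · B̄))
  nAη̄ t = n₂ λ x n → begin
    M x * M x * conj (cube B) x
      ≈⟨ solve 1 (λ a → a := a :* (con (+ 1) :* con (+ 1) :* con (+ 1))) refl _ ⟩
    (M x * M x * conj (cube B) x) * (1# * 1# * 1#)
      ≈⟨ *-congˡ (*-cong (*-cong (one x n) (one x n)) (one x n)) ⟩
    (M x * M x * conj (cube B) x) * cubed ((A x * η̄ x) * (M̄ x * B x))
      ≈⟨ solve 5 (λ a c e b d →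
           ((a :* a :* a) :* (a :* a :* a) :* (d :* d :* d)) :* (((a :* e) :* ((c :* c :* c) :* b)) :* ((a :* e) :* ((c :* c :* c) :* b)) :* ((a :* e) :* ((c :* c :* c) :* b)))
           := (((a :* c) :* (a :* c) :* (a :* c)) :* ((a :* c) :* (a :* c) :* (a :* c)) :* ((a :* c) :* (a :* c) :* (a :* c)))
             :* ((e :* e :* e) :* ((b :* d) :* (b :* d) :* (b :* d)))) refl (A x) (conj A x) (η̄ x) (B x) (B̄ x) ⟩
    (cubed (A x * conj A x) * cubed (A x * conj A x) * cubed (A x * conj A x))
      * (cubed (η̄ x) * cubed (B x * B̄ x))
      ≈⟨ *-cong (*-cong (*-cong (cubed-1 (*-conj cA n)) (cubed-1 (*-conj cA n))) (cubed-1 (*-conj cA n)))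
           (*-cong (η³-trivial (invF x) (invF≢0 n)) (cubed-1 (*-conj cB n))) ⟩
    (1# * 1# * 1#) * (1# * 1#)
      ≈⟨ solve 0 ((con (+ 1) :* con (+ 1) :* con (+ 1)) :* (con (+ 1) :* con (+ 1)) := con (+ 1)) refl ⟩
    1# ∎
    where
    cubed : K → K
    cubed a = a * a * a
    cubed-1 : ∀ {a} → a ≈ 1# → cubed a ≈ 1#
    cubed-1 e = trans (*-cong (*-cong e e) e) (solve 0 (con (+ 1) :* con (+ 1) :* con (+ 1) := con (+ 1)) refl)
    one : ∀ x → x ≢ 0F → 1# ≈ (A x * η̄ x) * (M̄ x * B x)
    one x n = trans (sym (t x n)) (*-congˡ (*-congˡ (conj-conj B x)))

  B₂≈CC : ∀ x → B₂ x ≈ C x * C x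
  B₂≈CC = everywhere (at-0 cB₂) (trans (*-congʳ (at-0 cC)) (zeroˡ _)) λ x n → begin
    M x * M x * B̄ x * B̄ x
      ≈⟨ solve 2 (λ m b → m :* m :* b :* b := con (+ 1) :* (m :* m :* b :* b)) refl _ _ ⟩
    1# * (M x * M x * B̄ x * B̄ x)
      ≈⟨ *-congʳ (sym (φ² n)) ⟩
    (φ x * φ x) * (M x * M x * B̄ x * B̄ x)
      ≈⟨ solve 3 (λ f m b → (f :* f) :* (m :* m :* b :* b) := (f :* m :* b) :* (f :* m :* b)) refl _ _ _ ⟩
    C x * C x ∎

  conj-*-square : ∀ {χ} → IsCharacter χ → ∀ x → conj χ x * (χ x * χ x) ≈ χ x
  conj-*-square c = everywhere (trans (*-congʳ (at-0 (conj-character c))) (zeroˡ _)) (at-0 c) λ x n →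
    trans (solve 2 (λ a b → b :* (a :* a) := a :* (a :* b)) refl _ _) (trans (*-congˡ (*-conj c n)) (*-identityʳ _))

  ₃P₂≈P : ∀ x → ₃P₂ M B C (B · B) B₂ (4F *F x) ≈ P x
  ₃P₂≈P x = Σ-cong λ r → Σ-cong λ s → trans
    (*-congʳ (*-cong (*-congʳ (*-congˡ (trans (*-congˡ (B₂≈CC _)) (conj-*-square cC _)))) (conj-*-square cB _)))
    (solve 5 (λ a b c d e → (((a :* b) :* c) :* d) :* e := (a :* b) :* ((c :* d) :* e)) refl _ _ _ _ _)

  φB̄ M̄B : F → K
  φB̄ = φ · B̄
  M̄B = M̄ · B

  cφB̄ : IsCharacter φB̄
  cφB̄ = ·-character φ-char cB̄
  cM̄B : IsCharacter M̄B
  cM̄B = ·-character cM̄ cB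

  G : K
  G = g φB̄ * g M̄B

  φC̄≈M̄B : ∀ x → φ x * C̄ x ≈ M̄B x
  φC̄≈M̄B = everywhere (trans (*-congʳ φ-0) (zeroˡ _)) (at-0 cM̄B) λ x n → begin
    φ x * (φ (invF x) * M̄ x * conj B̄ x)
      ≈⟨ *-congˡ (*-cong (*-congʳ (φ-inv x)) (conj-conj B x)) ⟩
    φ x * (φ x * M̄ x * B x)
      ≈⟨ solve 3 (λ f m b → f :* (f :* m :* b) := (f :* f) :* (m :* b)) refl _ _ _ ⟩
    (φ x * φ x) * (M̄ x * B x)
      ≈⟨ trans (*-congʳ (φ² n)) (*-identityˡ _) ⟩
    M̄ x * B x ∎

  m₁ b₁ c₁ : K
  m₁ = φ (-F 1F)
  b₁ = B (-F 1F)
  c₁ = C (-F 1F)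

  J₂ J₃ : K
  J₂ = J B ((B · B) · B̄)
  J₃ = J C (B₂ · C̄)

  B·conjBB : ∀ x → (B · conj (B · B)) x ≈ B̄ x
  B·conjBB = everywhere (trans (*-congʳ (at-0 cB)) (zeroˡ _)) (at-0 cB̄) λ x n →
    trans (sym (*-assoc _ _ _)) (trans (*-congʳ (*-conj cB n)) (*-identityˡ _))

  C·conjB₂ : ∀ x → (C · conj B₂) x ≈ C̄ x
  C·conjB₂ = everywhere (trans (*-congʳ (at-0 cC)) (zeroˡ _)) (at-0 (conj-character cC)) λ x n →
    trans (*-congˡ (B₂≈CC _)) (trans (sym (*-assoc _ _ _)) (trans (*-congʳ (*-conj cC n)) (*-identityˡ _)))

  nBB : Nontrivial (B · conj (B · B))
  nBB t = conj-nontrivial nB λ x n → trans (sym (B·conjBB x)) (t x n)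

  nCC : Nontrivial (C · conj B₂)
  nCC t = conj-nontrivial nC λ x n → trans (sym (C·conjB₂ x)) (t x n)

  J₂-gauss : g B̄ * J₂ ≈ b₁ * (g B * g (B̄ · B̄))
  J₂-gauss = trans (*-congʳ (sym (W-weight ψ B·conjBB))) (jacobi cB (·-character cB cB) nBB)

  J₃-gauss : g C̄ * J₃ ≈ c₁ * (g C * g (C̄ · C̄))
  J₃-gauss = trans (*-congʳ (sym (W-weight ψ C·conjB₂))) (trans (jacobi cC cB₂ nCC)
    (*-congˡ (*-congˡ (W-weight ψ λ x → B₂≈CC (invF x)))))

  JJ≉0 : ¬ (J₂ * J₃ ≈ 0#)
  JJ≉0 = *≉0 (jacobi≉0 cB (·-character cB cB) nBB) (jacobi≉0 cC cB₂ nCC)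

  minus-one² : ∀ {χ} → IsCharacter χ → χ (-F 1F) * χ (-F 1F) ≈ 1#
  minus-one² c = at-square-unit c -1²≡1

  M₁≈ : M₁ ≈ m₁ * (b₁ * c₁)
  M₁≈ = M≈φBC (-F 1F)

  HD-B : (m₁ * g φ) * (g B̄ * g φB̄) ≈ q * (B 4F * g (B̄ · B̄))
  HD-B = trans (hasse-davenport-2 cB̄) (*-congˡ (*-congʳ (conj-conj B _)))

  HD-C : (m₁ * g φ) * (g C̄ * g M̄B) ≈ q * (C 4F * g (C̄ · C̄))
  HD-C = trans (*-congˡ (*-congˡ (W-weight ψ λ x → sym (φC̄≈M̄B x))))
    (trans (hasse-davenport-2 (conj-character cC)) (*-congˡ (*-congʳ (conj-conj C _))))

  -- The Jacobi sums contain g(B̄²) and g(C̄²), which Hasse-Davenport for squares exchanges for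
  -- g(B̄)g(φB̄) and g(C̄)g(φC̄), where φC̄ = Ā³B. The remaining pairs of conjugate Gauss sums and
  -- g(φ)² are signs times q.
  jacobi-product : ((B 4F * C 4F) * (J₂ * J₃)) * (g B̄ * g C̄) ≈ (m₁ * q) * G
  jacobi-product = cancel (*≉0 q≉0 q≉0) (begin
    (q * q) * (((B 4F * C 4F) * (J₂ * J₃)) * (g B̄ * g C̄))
      ≈⟨ solve 7 (λ q b c i j x y → (q :* q) :* (((b :* c) :* (i :* j)) :* (x :* y))
           := ((q :* q) :* (b :* c)) :* ((x :* i) :* (y :* j))) refl q _ _ _ _ _ _ ⟩
    ((q * q) * (B 4F * C 4F)) * ((g B̄ * J₂) * (g C̄ * J₃))
      ≈⟨ *-congˡ (*-cong J₂-gauss J₃-gauss) ⟩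
    ((q * q) * (B 4F * C 4F)) * ((b₁ * (g B * g (B̄ · B̄))) * (c₁ * (g C * g (C̄ · C̄))))
      ≈⟨ solve 9 (λ q b c β u v γ s t → ((q :* q) :* (b :* c)) :* ((β :* (u :* v)) :* (γ :* (s :* t)))
           := ((β :* γ) :* (u :* s)) :* ((q :* (b :* v)) :* (q :* (c :* t)))) refl q _ _ _ _ _ _ _ _ ⟩
    ((b₁ * c₁) * (g B * g C)) * ((q * (B 4F * g (B̄ · B̄))) * (q * (C 4F * g (C̄ · C̄))))
      ≈⟨ *-congˡ (*-cong (sym HD-B) (sym HD-C)) ⟩
    ((b₁ * c₁) * (g B * g C)) * (((m₁ * g φ) * (g B̄ * g φB̄)) * ((m₁ * g φ) * (g C̄ * g M̄B)))
      ≈⟨ solve 10 (λ β γ u s m f v x t y → ((β :* γ) :* (u :* s)) :* (((m :* f) :* (v :* x)) :* ((m :* f) :* (t :* y)))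
           := ((β :* γ) :* (m :* m)) :* (((f :* f) :* ((u :* v) :* (s :* t))) :* (x :* y))) refl _ _ _ _ _ _ _ _ _ _ ⟩
    ((b₁ * c₁) * (m₁ * m₁)) * (((g φ * g φ) * ((g B * g B̄) * (g C * g C̄))) * G)
      ≈⟨ *-cong (*-congˡ (minus-one² φ-char)) (*-congʳ (*-cong gφ² (*-cong (g-conj cB nB) (g-conj cC nC)))) ⟩
    ((b₁ * c₁) * 1#) * (((m₁ * q) * ((b₁ * q) * (c₁ * q))) * G)
      ≈⟨ solve 5 (λ β γ m q g → ((β :* γ) :* con (+ 1)) :* (((m :* q) :* ((β :* q) :* (γ :* q))) :* g)
           := ((β :* β) :* (γ :* γ)) :* ((q :* q) :* ((m :* q) :* g))) refl _ _ _ q G ⟩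
    ((b₁ * b₁) * (c₁ * c₁)) * ((q * q) * ((m₁ * q) * G))
      ≈⟨ trans (*-congʳ (trans (*-cong (minus-one² cB) (minus-one² cC)) (*-identityˡ 1#))) (*-identityˡ _) ⟩
    (q * q) * ((m₁ * q) * G) ∎)

  -- Clears the denominators of both ₃F₂ and of both correction terms at once.
  κ : K
  κ = q * (g M * G)

  κ≉0 : ¬ (κ ≈ 0#)
  κ≉0 = *≉0 q≉0 (*≉0 (g≉0 cM) (*≉0 (g≉0 cφB̄) (g≉0 cM̄B)))

  right-side : ∀ x → κ * ₃F₂ M B C (B · B) B₂ (4F *F x)
    ≈ M₁ * ((q * g φ) * H x + (q * g φ) * (q * δ (x +F 2F)))
  right-side x = begin
    (q * (g M * G)) * (₃P₂ M B C (B · B) B₂ (4F *F x) * inv (J₂ * J₃))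
      ≈⟨ *-congˡ (*-congʳ (₃P₂≈P x)) ⟩
    (q * (g M * G)) * (P x * inv (J₂ * J₃))
      ≈⟨ solve 5 (λ q m g p i → (q :* (m :* g)) :* (p :* i) := con (+ 1) :* ((q :* g) :* (m :* (p :* i)))) refl _ _ _ _ _ ⟩
    1# * ((q * G) * (g M * (P x * inv (J₂ * J₃))))
      -- 1 = φ(-1)² is inserted because `jacobi-product` involves φ(-1)q.
      ≈⟨ *-congʳ (sym (minus-one² φ-char)) ⟩
    (m₁ * m₁) * ((q * G) * (g M * (P x * inv (J₂ * J₃))))
      ≈⟨ solve 4 (λ m q g a → (m :* m) :* ((q :* g) :* a) := m :* (((m :* q) :* g) :* a)) refl m₁ q G _ ⟩
    m₁ * (((m₁ * q) * G) * (g M * (P x * inv (J₂ * J₃))))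
      ≈⟨ *-congˡ (*-congʳ (sym jacobi-product)) ⟩
    m₁ * ((((B 4F * C 4F) * (J₂ * J₃)) * (g B̄ * g C̄)) * (g M * (P x * inv (J₂ * J₃))))
      ≈⟨ solve 7 (λ m b c j v w u → m :* ((((b :* c) :* j) :* (v :* w)) :* u) := m :* (((b :* c) :* (v :* w)) :* (u :* j))) refl _ _ _ _ _ _ _ ⟩
    m₁ * (((B 4F * C 4F) * (g B̄ * g C̄)) * ((g M * (P x * inv (J₂ * J₃))) * (J₂ * J₃)))
      ≈⟨ *-congˡ (*-congˡ (trans (solve 4 (λ g p i j → (g :* (p :* i)) :* j := (g :* p) :* (j :* i)) refl _ _ _ _)
           (trans (*-congˡ (inv-inverse _ JJ≉0)) (*-identityʳ _)))) ⟩
    m₁ * (((B 4F * C 4F) * (g B̄ * g C̄)) * (g M * P x))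
      -- 1 = B(-1)²C(-1)² is inserted: one B(-1)C(-1) turns (BC)(4) into the (BC)(-4) of `P-value`,
      -- the other joins φ(-1) to form M(-1).
      ≈⟨ *-congˡ (*-congʳ (*-congʳ (trans (sym (*-identityˡ _)) (*-congʳ (sym (trans (*-cong (minus-one² cB) (minus-one² cC)) (*-identityˡ 1#))))))) ⟩
    m₁ * (((((b₁ * b₁) * (c₁ * c₁)) * (B 4F * C 4F)) * (g B̄ * g C̄)) * (g M * P x))
      ≈⟨ solve 9 (λ m β γ b c v w u p → m :* (((((β :* β) :* (γ :* γ)) :* (b :* c)) :* (v :* w)) :* (u :* p))
           := (m :* (β :* γ)) :* (((β :* b) :* (γ :* c)) :* ((v :* w :* u) :* p))) refl _ _ _ _ _ _ _ _ _ ⟩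
    (m₁ * (b₁ * c₁)) * (((b₁ * B 4F) * (c₁ * C 4F)) * ((g B̄ * g C̄ * g M) * P x))
      ≈⟨ *-cong (sym M₁≈) (*-congʳ (*-cong (sym (at-minus cB 4F)) (sym (at-minus cC 4F)))) ⟩
    M₁ * ((B · C) (-F 4F) * ((g B̄ * g C̄ * g M) * P x))
      ≈⟨ *-congˡ (P-value x) ⟩
    M₁ * ((q * g φ) * H x + (q * g φ) * (q * δ (x +F 2F))) ∎

  -- Left side: merging A, Aη, Aη̄ and rescaling

  exponent : F → F → F → F → F
  exponent x v w k = ((v +F w) +F (x -F 1F) *F k) +F (x *F x *F (h *F h *F (invF v *F invF w))) *F cub k

  -- The left kernel up to constants: v and w come from the Gauss sums of the lower parameters, k
  -- from merging the three upper ones.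
  Q : F → K
  Q x = W₂ M̄B φB̄ (λ v w → W M (λ k → ψ (exponent x v w k)))

  conj-φB : ∀ x → conj (φ · B) x ≈ φB̄ x
  conj-φB x = *-congʳ (φ-inv x)

  conj-MB̄ : ∀ x → conj (M · B̄) x ≈ M̄B x
  conj-MB̄ x = *-congˡ (conj-conj B x)

  -- Once regrouped, x, y and z enter the kernel only through their sum and product, the shape that
  -- `hasse-davenport-3` collapses to a single u.
  kernel-value : ∀ λ′ → kernel A Aη Aη̄ (φ · B) (M · B̄) λ′
    ≈ q * W₂ M̄B φB̄ (λ v w → W M (λ u →
        ψ (v +F w) * (ψ (3F *F u) * ψ ((-F (λ′ *F (invF v *F invF w))) *F cub u))))
  kernel-value λ′ = begin
    kernel A Aη Aη̄ (φ · B) (M · B̄) λ′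
      ≈⟨ trans (W-weight _ conj-MB̄) (Σ-cong λ v → *-congˡ (Σ-cong λ x → *-congˡ (*-congˡ (W-weight _ conj-φB)))) ⟩
    W M̄B (λ v → W Aη̄ (λ x → ψ (v +F x) * W φB̄ (λ w → W Aη (λ y → ψ (w +F y) * W A (λ z → ψ (e v w x y z))))))
      ≈⟨ Σ-cong (λ v → *-congˡ (trans (Σ-cong λ x → *-congˡ (sym (W-*ˡ φB̄ _ _))) (W-swap Aη̄ φB̄ _))) ⟩
    W₂ M̄B φB̄ (λ v w → W Aη̄ (λ x → ψ (v +F x) * W Aη (λ y → ψ (w +F y) * W A (λ z → ψ (e v w x y z)))))
      ≈⟨ W₂-cong _ _ (λ v w → Σ-cong λ x → *-congˡ (collect v w x)) ⟩
    W₂ M̄B φB̄ (λ v w → W Aη̄ (λ x → ψ (v +F w) * W Aη (λ y → W A (λ z → ψ (x +F (y +F z)) * f v w ((x *F y) *F z)))))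
      ≈⟨ W₂-cong _ _ (λ v w → trans (W-*ˡ _ _ _) (*-congˡ (hasse-davenport-3 cA (f v w)))) ⟩
    W₂ M̄B φB̄ (λ v w → ψ (v +F w) * (q * W M (λ u → ψ (3F *F u) * f v w (cub u))))
      ≈⟨ trans (W₂-cong M̄B φB̄ λ v w → trans (solve 3 (λ a q b → a :* (q :* b) := q :* (a :* b)) refl _ q _)
           (*-congˡ (sym (W-*ˡ M _ _)))) (W₂-*ˡ M̄B φB̄ q _) ⟩
    q * W₂ M̄B φB̄ (λ v w → W M (λ u → ψ (v +F w) * (ψ (3F *F u) * f v w (cub u)))) ∎
    where
    e : F → F → F → F → F → F
    e v w x y z = (1F -F (λ′ *F (-F (invF v *F x)) *F (-F (invF w *F y)))) *F z
    f : F → F → F → K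
    f v w t = ψ ((-F (λ′ *F (invF v *F invF w))) *F t)
    collect : ∀ v w x → ψ (v +F x) * W Aη (λ y → ψ (w +F y) * W A (λ z → ψ (e v w x y z)))
      ≈ ψ (v +F w) * W Aη (λ y → W A (λ z → ψ (x +F (y +F z)) * f v w ((x *F y) *F z)))
    collect v w x = begin
      ψ (v +F x) * W Aη (λ y → ψ (w +F y) * W A (λ z → ψ (e v w x y z)))
        ≈⟨ trans (sym (W-*ˡ _ _ _)) (Σ-cong λ y → *-congˡ (trans (sym (*-assoc _ _ _)) (sym (W-*ˡ A _ _)))) ⟩
      W Aη (λ y → W A (λ z → (ψ (v +F x) * ψ (w +F y)) * ψ (e v w x y z)))
        ≈⟨ Σ-cong (λ y → *-congˡ (Σ-cong λ z → *-congˡ (begin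
             (ψ (v +F x) * ψ (w +F y)) * ψ (e v w x y z)
               ≈⟨ sym (trans (ψ-+ _ _) (*-congʳ (ψ-+ _ _))) ⟩
             ψ (((v +F x) +F (w +F y)) +F e v w x y z)
               ≈⟨ ψ-≡ (solveF 8 (λ v w x y z l i j →
                    ((v ⊕ x) ⊕ (w ⊕ y)) ⊕ (num (+ 1) ⊖ l ⊗ (⊝ (i ⊗ x)) ⊗ (⊝ (j ⊗ y))) ⊗ z
                    ≋ (v ⊕ w) ⊕ ((x ⊕ (y ⊕ z)) ⊕ (⊝ (l ⊗ (i ⊗ j))) ⊗ ((x ⊗ y) ⊗ z))) ≡.refl v w x y z λ′ (invF v) (invF w)) ⟩
             ψ ((v +F w) +F ((x +F (y +F z)) +F (-F (λ′ *F (invF v *F invF w))) *F ((x *F y) *F z)))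
               ≈⟨ trans (ψ-+ _ _) (*-congˡ (ψ-+ _ _)) ⟩
             ψ (v +F w) * (ψ (x +F (y +F z)) * f v w ((x *F y) *F z)) ∎))) ⟩
      W Aη (λ y → W A (λ z → ψ (v +F w) * (ψ (x +F (y +F z)) * f v w ((x *F y) *F z))))
        ≈⟨ trans (Σ-cong λ y → *-congˡ (W-*ˡ A _ _)) (W-*ˡ Aη _ _) ⟩
      ψ (v +F w) * W Aη (λ y → W A (λ z → ψ (x +F (y +F z)) * f v w ((x *F y) *F z))) ∎

  argument : F → F
  argument x = (natF 27 *F (x *F x)) /F (4F *F powF (1F -F x) 3)

  Φ : F → K
  Φ x = ₃F₂ A Aη Aη̄ (φ · B) (M · B̄) (argument x)

  -- Put u = ak with a = -(1 - x)/3. Then 3u = (x - 1)k, and -λu³ = x²k³/4 precisely for λ =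
  -- 27x²/(4(1 - x)³). The value M(a) cancels the prefactor Ā³(1 - x) and M(3), leaving the sign
  -- M(-1).
  left-kernel : ∀ x → 1F -F x ≢ 0F →
    (M 3F * M̄ (1F -F x)) * kernel A Aη Aη̄ (φ · B) (M · B̄) (argument x)
    ≈ M₁ * (q * Q x)
  left-kernel x y≢0 = begin
    (M 3F * M̄ y) * kernel A Aη Aη̄ (φ · B) (M · B̄) ℓ
      ≈⟨ *-congˡ (trans (kernel-value ℓ) (*-congˡ (trans (W₂-cong M̄B φB̄ substitute) (W₂-*ˡ M̄B φB̄ (M a) _)))) ⟩
    (M 3F * M̄ y) * (q * (M a * Q x))
      ≈⟨ *-congˡ (*-congˡ (*-congʳ (trans (at-* cM _ _) (*-congʳ (at-minus cM y))))) ⟩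
    (M 3F * M̄ y) * (q * (((M₁ * M y) * M̄ 3F) * Q x))
      ≈⟨ solve 7 (λ t y′ q m y t′ s → (t :* y′) :* (q :* (((m :* y) :* t′) :* s)) := ((t :* t′) :* (y :* y′)) :* (m :* (q :* s)))
           refl _ _ _ _ _ _ _ ⟩
    ((M 3F * M̄ 3F) * (M y * M̄ y)) * (M₁ * (q * Q x))
      ≈⟨ trans (*-congʳ (trans (*-cong (*-conj cM 3≢0) (*-conj cM y≢0)) (*-identityˡ 1#))) (*-identityˡ _) ⟩
    M₁ * (q * Q x) ∎
    where
    y = 1F -F x
    t = invF 3F
    ℓ = argument x
    a = (-F y) *F t
    3t≡1 : 3F *F t ≡ 1F
    3t≡1 = invF-inverse 3F 3≢0
    denominator = 4F *F powF y 3
    ℓ-equation : ℓ *F denominator ≡ natF 27 *F (x *F x)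
    ℓ-equation = modulo (natF 27 *F (x *F x)) (invF-inverse denominator (*F≢0 4≢0 (*F≢0 y≢0 (*F≢0 y≢0 (*F≢0 y≢0 (λ e → 0≢1F (≡.sym e)))))))
      (solveF 3 (λ n d i → (n ⊗ i) ⊗ d ≋ n ⊕ (d ⊗ i ⊖ num (+ 1)) ⊗ n) ≡.refl (natF 27 *F (x *F x)) denominator (invF denominator))
    ℓ-cub : ℓ *F cub a ≡ -F (x *F x *F (h *F h))
    ℓ-cub = modulo (-F (cub t *F (h *F h))) ℓ-equation (modulo (cub t *F (ℓ *F cub y) *F (2F *F h +F 1F)) 2h≡1
      (modulo (-F (x *F x *F (h *F h) *F (natF 9 *F t *F t +F 3F *F t +F 1F))) 3t≡1
        (solveF 5 (λ l x y t h →
          l ⊗ (((⊝ y) ⊗ t) ⊗ ((⊝ y) ⊗ t) ⊗ ((⊝ y) ⊗ t))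
          ≋ (((⊝ (x ⊗ x ⊗ (h ⊗ h)))
              ⊕ (l ⊗ (num (+ 4) ⊗ (y ⊗ (y ⊗ (y ⊗ num (+ 1))))) ⊖ num (+ 27) ⊗ (x ⊗ x)) ⊗ (⊝ ((t ⊗ t ⊗ t) ⊗ (h ⊗ h))))
              ⊕ (num (+ 2) ⊗ h ⊖ num (+ 1)) ⊗ ((t ⊗ t ⊗ t) ⊗ (l ⊗ (y ⊗ y ⊗ y)) ⊗ (num (+ 2) ⊗ h ⊕ num (+ 1))))
            ⊕ (num (+ 3) ⊗ t ⊖ num (+ 1)) ⊗ (⊝ (x ⊗ x ⊗ (h ⊗ h) ⊗ (num (+ 9) ⊗ t ⊗ t ⊕ num (+ 3) ⊗ t ⊕ num (+ 1)))))
          ≡.refl ℓ x y t h)))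
    substitute : ∀ v w → W M (λ u → ψ (v +F w) * (ψ (3F *F u) * ψ ((-F (ℓ *F (invF v *F invF w))) *F cub u)))
      ≈ M a * W M (λ k → ψ (exponent x v w k))
    substitute v w = trans (W-scale cM (*F≢0 (-≢0 y≢0) (invF≢0 3≢0)) _) (*-congˡ (Σ-cong λ k → *-congˡ (begin
      ψ (v +F w) * (ψ (3F *F (a *F k)) * ψ ((-F (ℓ *F (invF v *F invF w))) *F cub (a *F k)))
        ≈⟨ trans (sym (*-assoc _ _ _)) (*-cong (sym (ψ-+ _ _)) (ψ-≡ (cubic-part k))) ⟩
      ψ ((v +F w) +F 3F *F (a *F k)) * ψ ((x *F x *F (h *F h *F (invF v *F invF w))) *F cub k)
        ≈⟨ trans (*-congʳ (ψ-≡ (≡.cong ((v +F w) +F_) (linear-part k)))) (sym (ψ-+ _ _)) ⟩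
      ψ (exponent x v w k) ∎)))
      where
      linear-part : ∀ k → 3F *F (a *F k) ≡ (x -F 1F) *F k
      linear-part k = modulo ((x -F 1F) *F k) 3t≡1 (solveF 3 (λ x t k →
        num (+ 3) ⊗ (((⊝ (num (+ 1) ⊖ x)) ⊗ t) ⊗ k) ≋ (x ⊖ num (+ 1)) ⊗ k ⊕ (num (+ 3) ⊗ t ⊖ num (+ 1)) ⊗ ((x ⊖ num (+ 1)) ⊗ k))
        ≡.refl x t k)
      cubic-part : ∀ k → (-F (ℓ *F (invF v *F invF w))) *F cub (a *F k) ≡ (x *F x *F (h *F h *F (invF v *F invF w))) *F cub k
      cubic-part k = modulo (-F ((invF v *F invF w) *F cub k)) ℓ-cub
        (solveF 6 (λ l a k x h i → (⊝ (l ⊗ i)) ⊗ ((a ⊗ k) ⊗ (a ⊗ k) ⊗ (a ⊗ k))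
          ≋ (x ⊗ x ⊗ (h ⊗ h ⊗ i)) ⊗ (k ⊗ k ⊗ k) ⊕ (l ⊗ (a ⊗ a ⊗ a) ⊖ (⊝ (x ⊗ x ⊗ (h ⊗ h)))) ⊗ (⊝ (i ⊗ (k ⊗ k ⊗ k))))
          ≡.refl ℓ a k x h (invF v *F invF w))

  -- With v and w rescaled by k the exponent is linear in k, and the characters of k multiply to φ.
  -- The sum over k is then g(φ) times φ of the coefficient D/(4vw). The point x = 1 is included.
  Q-value : ∀ x → Q x ≈ g φ * H x
  Q-value x = begin
    Q x
      ≈⟨ sym (W-W₂-swap M M̄B φB̄ _) ⟩
    W M (λ k → W₂ M̄B φB̄ (λ v w → ψ (exponent x v w k)))
      ≈⟨ W-cong (at-0 cM) φ-0 rescale ⟩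
    W φ (λ k → W₂ M̄B φB̄ (λ v w → ψ (E v w *F k)))
      ≈⟨ W-W₂-swap φ M̄B φB̄ _ ⟩
    W₂ M̄B φB̄ (λ v w → W φ (λ k → ψ (E v w *F k)))
      ≈⟨ W₂-cong _ _ (λ v w → trans (twist φ-char φ-nontrivial _) (*-congʳ (φ-inv _))) ⟩
    W₂ M̄B φB̄ (λ v w → φ (E v w) * g φ)
      ≈⟨ W-cong (at-0 cM̄B) (at-0 (conj-character cC)) (λ v n → trans (*-congʳ (sym (φC̄≈M̄B v))) (trans
           (solve 3 (λ a b c → (a :* b) :* c := b :* (a :* c)) refl _ _ _)
           (*-congˡ (trans (sym (W-*ˡ φB̄ _ _)) (W-cong (at-0 cφB̄) (at-0 cB̄) (discriminant v n)))))) ⟩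
    W₂ C̄ B̄ (λ v w → g φ * φ (D x w v))
      ≈⟨ W₂-*ˡ C̄ B̄ (g φ) _ ⟩
    g φ * H x ∎
    where
    E : F → F → F
    E v w = ((v +F w) +F (x -F 1F)) +F x *F x *F (h *F h *F (invF v *F invF w))
    discriminant : ∀ v → v ≢ 0F → ∀ w → w ≢ 0F → φB̄ w * (φ v * (φ (E v w) * g φ)) ≈ B̄ w * (g φ * φ (D x w v))
    discriminant v n w n′ = begin
      (φ w * B̄ w) * (φ v * (φ (E v w) * g φ))
        ≈⟨ solve 5 (λ w b v e g → (w :* b) :* (v :* (e :* g)) := b :* (g :* ((v :* w) :* e))) refl _ _ _ _ _ ⟩
      B̄ w * (g φ * ((φ v * φ w) * φ (E v w)))
        ≈⟨ *-congˡ (*-congˡ (trans (*-congʳ (sym (at-* φ-char v w))) (sym (at-* φ-char _ _)))) ⟩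
      B̄ w * (g φ * φ ((v *F w) *F E v w))
        ≈⟨ *-congˡ (*-congˡ (trans (sym (φ-square-* 2≢0 _)) (≡⇒≈ (≡.cong φ identity)))) ⟩
      B̄ w * (g φ * φ (D x w v)) ∎
      where
      identity : (2F *F 2F) *F ((v *F w) *F E v w) ≡ D x w v
      identity = modulo (x *F x *F (4F *F h *F h *F (w *F invF w))) (invF-inverse v n)
        (modulo (x *F x *F (4F *F h *F h)) (invF-inverse w n′) (modulo (x *F x *F (2F *F h +F 1F)) 2h≡1
          (solveF 6 (λ x v w i j h → (num (+ 2) ⊗ num (+ 2)) ⊗ ((v ⊗ w) ⊗ (((v ⊕ w) ⊕ (x ⊖ num (+ 1))) ⊕ x ⊗ x ⊗ (h ⊗ h ⊗ (i ⊗ j))))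
            ≋ (((x ⊗ x ⊕ num (+ 4) ⊗ w ⊗ v ⊗ ((x ⊖ num (+ 1)) ⊕ (w ⊕ v)))
                ⊕ (v ⊗ i ⊖ num (+ 1)) ⊗ (x ⊗ x ⊗ (num (+ 4) ⊗ h ⊗ h ⊗ (w ⊗ j))))
                ⊕ (w ⊗ j ⊖ num (+ 1)) ⊗ (x ⊗ x ⊗ (num (+ 4) ⊗ h ⊗ h)))
              ⊕ (num (+ 2) ⊗ h ⊖ num (+ 1)) ⊗ (x ⊗ x ⊗ (num (+ 2) ⊗ h ⊕ num (+ 1)))) ≡.refl x v w (invF v) (invF w) h)))
    rescale : ∀ k → k ≢ 0F → M k * W₂ M̄B φB̄ (λ v w → ψ (exponent x v w k))
      ≈ φ k * W₂ M̄B φB̄ (λ v w → ψ (E v w *F k))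
    rescale k n = begin
      M k * W₂ M̄B φB̄ (λ v w → ψ (exponent x v w k))
        ≈⟨ *-congˡ (trans (W-scale cM̄B n _) (*-congˡ (trans (Σ-cong λ v → *-congˡ (W-scale cφB̄ n _)) (W-*ˡ M̄B _ _)))) ⟩
      M k * (M̄B k * (φB̄ k * W₂ M̄B φB̄ (λ v w → ψ (exponent x (k *F v) (k *F w) k))))
        ≈⟨ *-congˡ (*-congˡ (*-congˡ (W₂-cong _ _ λ v w → ψ-≡ (scaled v w)))) ⟩
      M k * ((M̄ k * B k) * ((φ k * B̄ k) * W₂ M̄B φB̄ (λ v w → ψ (E v w *F k))))
        ≈⟨ solve 6 (λ m m′ b f b′ r → m :* ((m′ :* b) :* ((f :* b′) :* r)) := ((m :* m′) :* (b :* b′)) :* (f :* r)) refl _ _ _ _ _ _ ⟩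
      ((M k * M̄ k) * (B k * B̄ k)) * (φ k * W₂ M̄B φB̄ (λ v w → ψ (E v w *F k)))
        ≈⟨ trans (*-congʳ (trans (*-cong (*-conj cM n) (*-conj cB n)) (*-identityˡ 1#))) (*-identityˡ _) ⟩
      φ k * W₂ M̄B φB̄ (λ v w → ψ (E v w *F k)) ∎
      where
      scaled : ∀ v w → exponent x (k *F v) (k *F w) k ≡ E v w *F k
      scaled v w = ≡.trans
        (≡.cong₂ (λ s t → ((k *F v +F k *F w) +F (x -F 1F) *F k) +F (x *F x *F (h *F h *F (s *F t))) *F cub k) (invF-* k v) (invF-* k w))
        (modulo (x *F x *F (h *F h *F (invF v *F invF w)) *F k *F (k *F invF k +F 1F)) (invF-inverse k n)
          (solveF 8 (λ x v w i j h k l →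
            ((k ⊗ v ⊕ k ⊗ w) ⊕ (x ⊖ num (+ 1)) ⊗ k) ⊕ (x ⊗ x ⊗ (h ⊗ h ⊗ ((l ⊗ i) ⊗ (l ⊗ j)))) ⊗ (k ⊗ k ⊗ k)
            ≋ (((v ⊕ w) ⊕ (x ⊖ num (+ 1))) ⊕ x ⊗ x ⊗ (h ⊗ h ⊗ (i ⊗ j))) ⊗ k
              ⊕ (k ⊗ l ⊖ num (+ 1)) ⊗ (x ⊗ x ⊗ (h ⊗ h ⊗ (i ⊗ j)) ⊗ k ⊗ (k ⊗ l ⊕ num (+ 1))))
            ≡.refl x v w (invF v) (invF w) h k (invF k)))

  -- The case f = 1 of `hasse-davenport-3`; the 3 comes from the exponent 3u.
  gauss-product-3 : M 3F * (g Aη̄ * (g Aη * g A)) ≈ q * g M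
  gauss-product-3 = begin
    M 3F * (g Aη̄ * (g Aη * g A))
      ≈⟨ *-congˡ (sym product) ⟩
    M 3F * W Aη̄ (λ x → W Aη (λ y → W A (λ z → ψ (x +F (y +F z)) * 1#)))
      ≈⟨ *-congˡ (hasse-davenport-3 cA (λ _ → 1#)) ⟩
    M 3F * (q * W M (λ u → ψ (3F *F u) * 1#))
      ≈⟨ *-congˡ (*-congˡ (trans (Σ-cong λ u → *-congˡ (*-identityʳ _)) (twist-≢0 cM 3≢0))) ⟩
    M 3F * (q * (M̄ 3F * g M))
      ≈⟨ solve 4 (λ a q b g → a :* (q :* (b :* g)) := (a :* b) :* (q :* g)) refl _ _ _ _ ⟩
    (M 3F * M̄ 3F) * (q * g M)
      ≈⟨ trans (*-congʳ (*-conj cM 3≢0)) (*-identityˡ _) ⟩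
    q * g M ∎
    where
    product : W Aη̄ (λ x → W Aη (λ y → W A (λ z → ψ (x +F (y +F z)) * 1#))) ≈ g Aη̄ * (g Aη * g A)
    product = begin
      W Aη̄ (λ x → W Aη (λ y → W A (λ z → ψ (x +F (y +F z)) * 1#)))
        ≈⟨ Σ-cong (λ x → *-congˡ (Σ-cong λ y → *-congˡ (Σ-cong λ z → *-congˡ (trans (*-identityʳ _)
             (trans (ψ-+ _ _) (*-congˡ (ψ-+ _ _))))))) ⟩
      W Aη̄ (λ x → W Aη (λ y → W A (λ z → ψ x * (ψ y * ψ z))))
        ≈⟨ Σ-cong (λ x → *-congˡ (trans (Σ-cong λ y → *-congˡ (W-*ˡ A _ _)) (W-*ˡ Aη _ _))) ⟩
      W Aη̄ (λ x → ψ x * W Aη (λ y → W A (λ z → ψ y * ψ z)))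
        ≈⟨ trans (Σ-cong λ x → sym (*-assoc _ _ _)) (Σ-*ʳ _ _) ⟩
      g Aη̄ * W Aη (λ y → W A (λ z → ψ y * ψ z))
        ≈⟨ *-congˡ (trans (Σ-cong λ y → trans (*-congˡ (W-*ˡ A _ _)) (sym (*-assoc _ _ _))) (Σ-*ʳ _ _)) ⟩
      g Aη̄ * (g Aη * g A) ∎

  left-side : ∀ x → 1F -F x ≢ 0F →
    κ * (M̄ (1F -F x) * Φ x)
    ≈ M₁ * ((q * g φ) * H x)
  left-side x n = begin
    (q * (g M * G)) * (M̄ (1F -F x) * Φ x)
      ≈⟨ solve 5 (λ q m g c f → (q :* (m :* g)) :* (c :* f) := (q :* m) :* (g :* (c :* f))) refl q _ G _ (Φ x) ⟩
    (q * g M) * (G * (M̄ (1F -F x) * Φ x))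
      ≈⟨ *-congʳ (sym gauss-product-3) ⟩
    (M 3F * (g Aη̄ * (g Aη * g A))) * ((g φB̄ * g M̄B) * (M̄ (1F -F x) * Φ x))
      ≈⟨ solve 8 (λ t a b c u v m f → (t :* (a :* (b :* c))) :* ((u :* v) :* (m :* f)) := (t :* m) :* ((c :* ((b :* u) :* (a :* v))) :* f))
           refl _ _ _ _ _ _ _ (Φ x) ⟩
    (M 3F * M̄ (1F -F x)) * ((g A * ((g Aη * g φB̄) * (g Aη̄ * g M̄B))) * Φ x)
      ≈⟨ *-congˡ (*-congʳ (*-congˡ (*-cong (*-congˡ (W-weight ψ λ y → sym (conj-φB y))) (*-congˡ (W-weight ψ λ y → sym (conj-MB̄ y)))))) ⟩
    (M 3F * M̄ (1F -F x)) * ((g A * ((g Aη * g (conj (φ · B))) * (g Aη̄ * g (conj (M · B̄))))) * Φ x)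
      ≈⟨ *-congˡ (₃F₂-kernel cA (·-character cA η-char) (·-character cA cη̄) (·-character φ-char cB) (·-character cM cB̄)
           nA nAη nAη̄ (argument x)) ⟩
    (M 3F * M̄ (1F -F x)) * kernel A Aη Aη̄ (φ · B) (M · B̄) (argument x)
      ≈⟨ left-kernel x n ⟩
    M₁ * (q * Q x)
      ≈⟨ *-congˡ (trans (*-congˡ (Q-value x)) (sym (*-assoc _ _ _))) ⟩
    M₁ * ((q * g φ) * H x) ∎

  -- The value at x = 1 and the sum over the cube roots of Ā³

  term : (F → K) → K
  term χ = ((g (conj χ) * g (φ · conj (B · χ)) * g (B · conj (M · χ))) / (g φB̄ * g M̄B * g M)) * conj χ (-F 4F)

  term-cong : ∀ {χ χ′} → χ ≐ χ′ → term χ ≈ term χ′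
  term-cong e = *-cong (*-congʳ (*-cong (*-cong
      (W-weight ψ λ x → e (invF x))
      (W-weight ψ λ x → *-congˡ (*-congˡ (e (invF x)))))
      (W-weight ψ λ x → *-congˡ (*-congˡ (e (invF x))))))
    (e _)

  -- The summand for χ = θ̄ without sign and denominator, in the form in which it occurs in Q(1).
  weight : (F → K) → K
  weight θ = θ 4F * (g θ * (g (φB̄ · θ) * g (M̄B · θ)))

  -- κ clears the denominator and θ(-4) splits as M(-1)θ(4). The condition on θ(-1) holds for every
  -- cube root of M, since θ(-1)³ = θ(-1).
  term-value : ∀ {θ} → IsCharacter θ → θ (-F 1F) ≈ M₁ →
    κ * term (conj θ) ≈ M₁ * (q * weight θ)
  term-value {θ} cθ e = begin
    (q * (g M * G)) * (((g (conj (conj θ)) * g (φ · conj (B · conj θ)) * g (B · conj (M · conj θ))) * inv (G * g M)) * conj (conj θ) (-F 4F))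
      ≈⟨ *-congˡ (*-cong (*-congʳ (*-cong (*-cong
           (W-weight ψ (conj-conj θ))
           (W-weight ψ λ x → trans (*-congˡ (*-congˡ (conj-conj θ x))) (sym (*-assoc _ _ _))))
           (W-weight ψ λ x → trans (*-congˡ (*-congˡ (conj-conj θ x)))
             (solve 3 (λ b m t → b :* (m :* t) := (m :* b) :* t) refl _ _ _))))
           (trans (conj-conj θ _) (trans (at-minus cθ 4F) (*-congʳ e)))) ⟩
    (q * (g M * G)) * (((g θ * g (φB̄ · θ) * g (M̄B · θ)) * inv (G * g M)) * (M₁ * θ 4F))
      ≈⟨ solve 9 (λ q m g a b c i s t → (q :* (m :* g)) :* (((a :* b :* c) :* i) :* (s :* t))
           := ((g :* m) :* i) :* (s :* (q :* (t :* (a :* (b :* c)))))) refl q (g M) G _ _ _ _ _ _ ⟩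
    ((G * g M) * inv (G * g M)) * (M₁ * (q * weight θ))
      ≈⟨ trans (*-congʳ (inv-inverse _ (*≉0 (*≉0 (g≉0 cφB̄) (g≉0 cM̄B)) (g≉0 cM)))) (*-identityˡ _) ⟩
    M₁ * (q * weight θ) ∎

  -- At x = 1 the linear term (x - 1)k disappears, and M(k) = A(k³), so everything depends on t =
  -- k³. `Σ-cubes` yields the characters A, Aη, Aη̄ of t, and the sums over v, w and t separate into
  -- Gauss sums.
  Q-at-1 : Q 1F ≈ weight A + (weight Aη + weight Aη̄)
  Q-at-1 = begin
    Q 1F
      ≈⟨ W-congʳ (at-0 cM̄B) (λ v n → W-congʳ (at-0 cφB̄) (λ w n′ → inner v n w n′)) ⟩
    W₂ M̄B φB̄ (λ v w → piece A v w + (piece Aη v w + piece Aη̄ v w))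
      ≈⟨ trans (Σ-cong λ v → *-congˡ (trans (W-+ φB̄ _ _) (+-congˡ (W-+ φB̄ _ _)))) (trans (W-+ M̄B _ _) (+-congˡ (W-+ M̄B _ _))) ⟩
    total A + (total Aη + total Aη̄)
      ≈⟨ +-cong (total-weight A) (+-cong (total-weight Aη) (total-weight Aη̄)) ⟩
    weight A + (weight Aη + weight Aη̄) ∎
    where
    W-+ : ∀ χ f k → W χ (λ x → f x + k x) ≈ W χ f + W χ k
    W-+ χ f k = trans (Σ-cong λ x → distribˡ _ _ _) (Σ-+ _ _)
    piece : (F → K) → F → F → K
    piece θ v w = (θ 4F * g θ) * ((θ v * ψ v) * (θ w * ψ w))
    total : (F → K) → K
    total θ = W M̄B (λ v → W φB̄ (piece θ v))
    total-weight : ∀ θ → total θ ≈ weight θ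
    total-weight θ = begin
      W₂ M̄B φB̄ (λ v w → (θ 4F * g θ) * ((θ v * ψ v) * (θ w * ψ w)))
        ≈⟨ trans (Σ-cong λ v → *-congˡ (trans (W-*ˡ φB̄ _ _) (*-congˡ (trans (W-*ˡ φB̄ _ _)
             (*-congˡ (Σ-cong λ w → sym (*-assoc _ _ _))))))) (W-*ˡ M̄B _ _) ⟩
      (θ 4F * g θ) * W M̄B (λ v → (θ v * ψ v) * g (φB̄ · θ))
        ≈⟨ *-congˡ (trans (Σ-cong λ v → solve 4 (λ m t p k → m :* ((t :* p) :* k) := ((m :* t) :* p) :* k) refl _ _ _ _) (Σ-*ʳ _ _)) ⟩
      (θ 4F * g θ) * (g (M̄B · θ) * g (φB̄ · θ))
        ≈⟨ solve 4 (λ t a b c → (t :* a) :* (b :* c) := t :* (a :* (c :* b))) refl _ _ _ _ ⟩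
      weight θ ∎
    inner : ∀ v → v ≢ 0F → ∀ w → w ≢ 0F →
      W M (λ k → ψ (exponent 1F v w k)) ≈ piece A v w + (piece Aη v w + piece Aη̄ v w)
    inner v n w n′ = begin
      W M (λ k → ψ (exponent 1F v w k))
        ≈⟨ W-cong (at-0 cM) ε-0 (λ k nk → trans (*-cong (sym (at-cub cA k)) (ψ-split (exponent-1 k)))
             (trans (solve 3 (λ a b d → a :* (b :* d) := con (+ 1) :* (b :* (a :* d))) refl _ _ _) (*-congʳ (sym (ε-≢0 nk))))) ⟩
      W ε (λ k → ψ (v +F w) * (A (cub k) * ψ (c *F cub k)))
        ≈⟨ trans (W-*ˡ ε _ _) (*-congˡ (Σ-cubes (λ t → A t * ψ (c *F t)))) ⟩
      ψ (v +F w) * (W ε (λ t → A t * ψ (c *F t)) + (W η (λ t → A t * ψ (c *F t)) + W η̄ (λ t → A t * ψ (c *F t))))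
        ≈⟨ *-congˡ (+-cong
             (W-cong ε-0 (at-0 cA) λ t nt → trans (*-congʳ (ε-≢0 nt)) (*-identityˡ _))
             (+-cong (Σ-cong λ t → regroup) (Σ-cong λ t → regroup))) ⟩
      ψ (v +F w) * (W A (λ t → ψ (c *F t)) + (W Aη (λ t → ψ (c *F t)) + W Aη̄ (λ t → ψ (c *F t))))
        ≈⟨ trans (distribˡ _ _ _) (+-congˡ (distribˡ _ _ _)) ⟩
      ψ (v +F w) * W A (λ t → ψ (c *F t)) + (ψ (v +F w) * W Aη (λ t → ψ (c *F t)) + ψ (v +F w) * W Aη̄ (λ t → ψ (c *F t)))
        ≈⟨ +-cong (each cA) (+-cong (each (·-character cA η-char)) (each (·-character cA cη̄))) ⟩
      piece A v w + (piece Aη v w + piece Aη̄ v w) ∎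
      where
      c = h *F h *F (invF v *F invF w)
      c≢0 : c ≢ 0F
      c≢0 = *F≢0 (*F≢0 h≢0 h≢0) (*F≢0 (invF≢0 n) (invF≢0 n′))
      exponent-1 : ∀ k → exponent 1F v w k ≡ (v +F w) +F c *F cub k
      exponent-1 k = solveF 4 (λ s c k t → (s ⊕ (num (+ 1) ⊖ num (+ 1)) ⊗ k) ⊕ (num (+ 1) ⊗ num (+ 1) ⊗ c) ⊗ t ≋ s ⊕ c ⊗ t) ≡.refl (v +F w) c k (cub k)
      regroup : ∀ {a b p} → a * (b * p) ≈ (b * a) * p
      regroup = solve 3 (λ a b p → a :* (b :* p) := (b :* a) :* p) refl _ _ _
      inv-c : invF c ≡ 4F *F (v *F w)
      inv-c = ≡.trans (invF-* (h *F h) (invF v *F invF w)) (≡.cong₂ _*F_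
        (≡.trans (invF-* h h) (≡.trans (≡.cong (λ t → t *F t) (invF-involutive 2F)) (solveF 0 (num (+ 2) ⊗ num (+ 2) ≋ num (+ 4)) ≡.refl)))
        (≡.trans (invF-* _ _) (≡.cong₂ _*F_ (invF-involutive v) (invF-involutive w))))
      each : ∀ {θ} → IsCharacter θ → ψ (v +F w) * W θ (λ t → ψ (c *F t)) ≈ piece θ v w
      each {θ} cθ = trans (*-cong (ψ-+ v w) (trans (twist-≢0 cθ c≢0) (*-congʳ
          (trans (≡⇒≈ (≡.cong θ inv-c)) (trans (at-* cθ _ _) (*-congˡ (at-* cθ v w)))))))
        (solve 6 (λ p r f a b g → (p :* r) :* ((f :* (a :* b)) :* g) := (f :* g) :* ((a :* p) :* (b :* r))) refl _ _ _ _ _ _)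

  cube-of-minus-one : cub (-F 1F) ≡ -F 1F
  cube-of-minus-one = solveF 0 (num -[1+ 0 ] ⊗ num -[1+ 0 ] ⊗ num -[1+ 0 ] ≋ num -[1+ 0 ]) ≡.refl

  A₁ : A (-F 1F) ≈ M₁
  A₁ = sym (trans (*-congʳ (minus-one² cA)) (*-identityˡ _))

  η₁ : η (-F 1F) ≈ 1#
  η₁ = trans (≡⇒≈ (≡.cong η (≡.sym cube-of-minus-one))) (η-cub -1≢0)

  η̄₁ : η̄ (-F 1F) ≈ 1#
  η̄₁ = trans (≡⇒≈ (≡.cong η̄ (≡.sym cube-of-minus-one))) (η̄-cub -1≢0)

  -- Three pairwise distinct cubic characters exhaust them: the number of cube
  -- roots has the expansion ε + η + η̄, so it is orthogonal to any fourth one.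
  no-fourth : ∀ {χ} → IsCharacter χ → cube χ ≐ M̄ →
    ¬ (conj A ≐ χ) → ¬ (conj Aη ≐ χ) → ¬ (conj Aη̄ ≐ χ) → ⊥
  no-fourth {χ} cχ χ³ d₀ d₁ d₂ = Σε≉0 (begin
    sumF ε
      ≈⟨ Σ-cong (λ k → sym (*-identityʳ _)) ⟩
    W ε (λ _ → 1#)
      ≈⟨ W-congʳ ε-0 (λ k n → sym (trans (at-cub cθ k) (θ³ k n))) ⟩
    W ε (λ k → θ (cub k))
      ≈⟨ Σ-cubes θ ⟩
    W ε θ + (W η θ + W η̄ θ)
      ≈⟨ +-cong
           (trans (Σ-nonzero (trans (*-congʳ ε-0) (trans (zeroˡ _) (sym (at-0 cθ)))) λ k n → trans (*-congʳ (ε-≢0 n)) (*-identityˡ _))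
             (Σ-nontrivial cθ λ t → d₀ (unique cA λ x n → t x n)))
           (+-cong
             (Σ-nontrivial (·-character η-char cθ) λ t → d₁ (unique (·-character cA η-char) λ x n → trans (regroup η x) (t x n)))
             (Σ-nontrivial (·-character cη̄ cθ) λ t → d₂ (unique (·-character cA cη̄) λ x n → trans (regroup η̄ x) (t x n)))) ⟩
    0# + (0# + 0#)
      ≈⟨ solve 0 (con (+ 0) :+ (con (+ 0) :+ con (+ 0)) := con (+ 0)) refl ⟩
    0# ∎)
    where
    θ = χ · A
    cθ = ·-character cχ cA
    regroup : ∀ ρ x → (χ · (A · ρ)) x ≈ (ρ · θ) x
    regroup ρ x = solve 3 (λ a b c → a :* (b :* c) := c :* (a :* b)) refl _ _ _
    θ³ : ∀ k → k ≢ 0F → cube θ k ≈ 1#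
    θ³ k n = trans (solve 2 (λ c a → (c :* a) :* (c :* a) :* (c :* a) := (a :* a :* a) :* (c :* c :* c)) refl (χ k) (A k))
      (trans (*-congˡ (χ³ k)) (*-conj cM n))
    unique : ∀ {ρ} → IsCharacter ρ → IsTrivial (χ · ρ) → conj ρ ≐ χ
    unique {ρ} cρ t = everywhere (at-0 (conj-character cρ)) (at-0 cχ) λ x n → begin
      conj ρ x                    ≈⟨ sym (*-identityˡ _) ⟩
      1# * conj ρ x               ≈⟨ *-congʳ (sym (t x n)) ⟩
      (χ x * ρ x) * conj ρ x      ≈⟨ *-assoc _ _ _ ⟩
      χ x * (ρ x * conj ρ x)      ≈⟨ *-congˡ (*-conj cρ n) ⟩
      χ x * 1#                    ≈⟨ *-identityʳ _ ⟩
      χ x                         ∎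

  conj-injective : ∀ {ρ σ} → conj ρ ≐ conj σ → ρ ≐ σ
  conj-injective {ρ} {σ} e x = trans (sym (conj-conj ρ x)) (trans (e (invF x)) (conj-conj σ x))

  cancel-A : ∀ {x a b} → x ≢ 0F → A x * a ≈ A x * b → a ≈ b
  cancel-A n = cancel (at-≉0 cA n)

  distinct₁₀ : ¬ (conj Aη ≐ conj A)
  distinct₁₀ e = η-nontrivial λ x n → cancel-A n (trans (conj-injective {A · η} {A} e x) (sym (*-identityʳ _)))

  distinct₂₀ : ¬ (conj Aη̄ ≐ conj A)
  distinct₂₀ e = conj-nontrivial η-nontrivial λ x n → cancel-A n (trans (conj-injective {A · conj η} {A} e x) (sym (*-identityʳ _)))

  distinct₂₁ : ¬ (conj Aη̄ ≐ conj Aη)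
  distinct₂₁ e = η-nontrivial λ x n → cancel (at-≉0 η-char n) (begin
    η x * η x    ≈⟨ sym (conj-η n) ⟩
    η̄ x     ≈⟨ cancel-A n (conj-injective {A · conj η} {A · η} e x) ⟩
    η x          ≈⟨ sym (*-identityʳ _) ⟩
    η x * 1#     ∎)

  module _ (L : List (F → K)) (L-characters : All IsCharacter L)
    (L-cubes : All (λ χ → cube χ ≐ M̄) L)
    (L-complete : ∀ χ → IsCharacter χ → cube χ ≐ M̄ → Any (χ ≐_) L)
    (L-distinct : AllPairs (λ χ χ′ → ¬ (χ ≐ χ′)) L) where
    open CharacterLists 𝔽 𝕂

    private
      cube-twist : ∀ {ρ} → IsCharacter ρ → IsTrivial (cube ρ) → cube (conj (A · ρ)) ≐ M̄
      cube-twist {ρ} cρ t = everywhere (at-0 (cube-character (conj-character (·-character cA cρ)))) (at-0 cM̄) λ x n → trans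
        (solve 2 (λ a r → (a :* r) :* (a :* r) :* (a :* r) := (a :* a :* a) :* (r :* r :* r)) refl _ _)
        (trans (*-congˡ (t (invF x) (invF≢0 n))) (*-identityʳ _))

      R₀ : Removal term (conj A) L
      R₀ = remove term-cong (L-complete _ (conj-character cA) λ _ → refl) L-distinct
      module R₀ = Removal R₀
      R₁ : Removal term (conj Aη) R₀.remaining
      R₁ = remove term-cong (R₀.keeps (L-complete _ (conj-character (·-character cA η-char)) (cube-twist η-char η³-trivial))
        distinct₁₀) R₀.distinct′
      module R₁ = Removal R₁
      R₂ : Removal term (conj Aη̄) R₁.remaining
      R₂ = remove term-cong (R₁.keeps (R₀.keeps (L-complete _ (conj-character (·-character cA cη̄))
        (cube-twist cη̄ λ x n → η³-trivial (invF x) (invF≢0 n))) distinct₂₀) distinct₂₁) R₁.distinct′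
      module R₂ = Removal R₂

      empty-sum : ∀ l → All IsCharacter l → All (λ χ → cube χ ≐ M̄) l → All (λ d → ¬ (conj A ≐ d)) l →
        All (λ d → ¬ (conj Aη ≐ d)) l → All (λ d → ¬ (conj Aη̄ ≐ d)) l → sumList l term ≈ 0#
      empty-sum []      _       _       _        _        _        = refl
      empty-sum (χ ∷ _) (c ∷ _) (e ∷ _) (d₀ ∷ _) (d₁ ∷ _) (d₂ ∷ _) = ⊥-elim (no-fourth c e d₀ d₁ d₂)

    -- After the three known characters are removed, a first entry of the rest would be a fourth
    -- cube root of Ā³, so the rest is empty.
    L-sum : sumList L term ≈ term (conj A) + (term (conj Aη) + (term (conj Aη̄) + 0#))
    L-sum = trans R₀.sum-split (+-congˡ (trans R₁.sum-split (+-congˡ (trans R₂.sum-split (+-congˡ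
      (empty-sum R₂.remaining
        (R₂.sublist (R₁.sublist (R₀.sublist L-characters)))
        (R₂.sublist (R₁.sublist (R₀.sublist L-cubes)))
        (R₂.sublist (R₁.sublist R₀.others)) (R₂.sublist R₁.others) R₂.others))))))

    -- The last correction is thus the value that the formula of `left-side` would give at x = 1.
    L-value : κ * sumList L term ≈ M₁ * ((q * g φ) * H 1F)
    L-value = begin
      κ * sumList L term
        ≈⟨ *-congˡ L-sum ⟩
      κ * (term (conj A) + (term (conj Aη) + (term (conj Aη̄) + 0#)))
        ≈⟨ solve 4 (λ k a b c → k :* (a :+ (b :+ (c :+ con (+ 0)))) := k :* a :+ (k :* b :+ k :* c)) refl κ _ _ _ ⟩
      κ * term (conj A) + (κ * term (conj Aη) + κ * term (conj Aη̄))
        ≈⟨ +-cong (term-value cA A₁) (+-cong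
             (term-value (·-character cA η-char) (trans (*-cong A₁ η₁) (*-identityʳ _)))
             (term-value (·-character cA cη̄) (trans (*-cong A₁ η̄₁) (*-identityʳ _)))) ⟩
      M₁ * (q * weight A) + (M₁ * (q * weight Aη) + M₁ * (q * weight Aη̄))
        ≈⟨ solve 5 (λ m q a b c → m :* (q :* a) :+ (m :* (q :* b) :+ m :* (q :* c)) := m :* (q :* (a :+ (b :+ c)))) refl _ q _ _ _ ⟩
      M₁ * (q * (weight A + (weight Aη + weight Aη̄)))
        ≈⟨ *-congˡ (*-congˡ (sym Q-at-1)) ⟩
      M₁ * (q * Q 1F)
        ≈⟨ *-congˡ (trans (*-congˡ (Q-value 1F)) (sym (*-assoc _ _ _))) ⟩
      M₁ * ((q * g φ) * H 1F) ∎

    -- After multiplication by κ every term is M(-1)q g(φ) times H(x), H(1) or q, with the δ factors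
    -- in front, and the identity is linear algebra.
    transformation : ∀ x →
      M̄ (1F -F x) * Φ x
      ≈ (₃F₂ M B C (B · B) B₂ (4F *F x) - δ (x +F 2F) * ((g φ * g M̄) / (g φB̄ * g M̄B)))
        - δ (1F -F x) * sumList L term
    transformation x = cancel κ≉0 (begin
      κ * left
        ≈⟨ left-value ⟩
      M₁ * (t * H x) - δ (1F -F x) * (M₁ * (t * H 1F))
        ≈⟨ solve 6 (λ m t a q e b → m :* (t :* a) :- b := (m :* (t :* a :+ t :* (q :* e)) :- e :* (m :* (q :* t))) :- b)
             refl (M₁) t (H x) q (δ (x +F 2F)) _ ⟩
      (M₁ * (t * H x + t * (q * δ (x +F 2F))) - δ (x +F 2F) * (M₁ * (q * t))) - δ (1F -F x) * (M₁ * (t * H 1F))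
        ≈⟨ +-cong (+-cong (sym (right-side x)) (-‿cong (*-congˡ (sym correction-value)))) (-‿cong (*-congˡ (sym L-value))) ⟩
      (κ * R - δ (x +F 2F) * (κ * E)) - δ (1F -F x) * (κ * sumList L term)
        ≈⟨ solve 6 (λ k r d e d′ l → (k :* r :- d :* (k :* e)) :- d′ :* (k :* l) := k :* ((r :- d :* e) :- d′ :* l)) refl κ R _ E _ _ ⟩
      κ * ((R - δ (x +F 2F) * E) - δ (1F -F x) * sumList L term) ∎)
      where
      left = M̄ (1F -F x) * Φ x
      R = ₃F₂ M B C (B · B) B₂ (4F *F x)
      E = (g φ * g M̄) / (g φB̄ * g M̄B)
      t = q * g φ
      correction-value : κ * E ≈ M₁ * (q * t)
      correction-value = begin
        (q * (g M * G)) * ((g φ * g M̄) * inv G)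
          ≈⟨ solve 6 (λ q m g f m′ i → (q :* (m :* g)) :* ((f :* m′) :* i) := (g :* i) :* ((q :* f) :* (m :* m′))) refl _ _ G _ _ _ ⟩
        (G * inv G) * (t * (g M * g M̄))
          ≈⟨ *-cong (inv-inverse G (*≉0 (g≉0 cφB̄) (g≉0 cM̄B))) (*-congˡ (g-conj cM nM)) ⟩
        1# * (t * (M₁ * q))
          ≈⟨ solve 3 (λ t m q → con (+ 1) :* (t :* (m :* q)) := m :* (q :* t)) refl t _ q ⟩
        M₁ * (q * t) ∎
      left-value : κ * left ≈ M₁ * (t * H x) - δ (1F -F x) * (M₁ * (t * H 1F))
      left-value with (1F -F x) ≟F 0F
      ... | no n  = trans (left-side x n) (solve 2 (λ a b → a := a :- con (+ 0) :* b) refl _ _)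
      -- The prefactor is M̄(0) = 0, whatever value `Φ` has at the default argument produced by the
      -- inverse of 0; on the other side H(x) = H(1) cancels.
      ... | yes e = begin
        κ * left
          ≈⟨ *-congˡ (trans (*-congʳ (trans (≡⇒≈ (≡.cong M̄ e)) (at-0 cM̄))) (zeroˡ _)) ⟩
        κ * 0#
          ≈⟨ solve 2 (λ k a → k :* con (+ 0) := a :- con (+ 1) :* a) refl κ (M₁ * (t * H 1F)) ⟩
        M₁ * (t * H 1F) - 1# * (M₁ * (t * H 1F))
          ≈⟨ +-congʳ (*-congˡ (*-congˡ (≡⇒≈ (≡.cong H (sub≡0 e))))) ⟩
        M₁ * (t * H x) - 1# * (M₁ * (t * H 1F)) ∎

theorem9p10 :
  (𝔽 : FiniteField) (𝕂 : CoeffField) →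
  let open Ops 𝔽 𝕂 in
  -- q = |F| = p^r is a prime power with q ≡ 1 (mod 6)
  (p r : ℕ) → Prime p → order ≡ p ^ r → order % 6 ≡ 1 →
  -- ζ a primitive p-th root of unity
  (ζ : K) → powK ζ p ≈ 1# → ¬ (ζ ≈ 1#) →
  -- η a character of order exactly 3
  (η : F → K) → IsCharacter η → Nontrivial η → IsTrivial (cube η) →
  (A B : F → K) → IsCharacter A → IsCharacter B →
  Nontrivial (cube A) →
  Nontrivial B →
  Nontrivial (cube A · conj B · conj B) →
  Nontrivial (cube A · cube A · conj (cube B)) →
  Nontrivial (φ · cube A · conj B) →
  Nontrivial (φ · cube A · conj (cube B)) →
  -- L enumerates (without repetition) the characters χ with χ³ = Ā³
  (L : List (F → K)) →
  All IsCharacter L →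
  All (λ χ → cube χ ≐ conj (cube A)) L →
  (∀ χ → IsCharacter χ → cube χ ≐ conj (cube A) → Any (χ ≐_) L) →
  AllPairs (λ χ χ′ → ¬ (χ ≐ χ′)) L →
  (x : F) →
  conj (cube A) (1F -F x)
    * ₃F₂ A (A · η) (A · conj η) (φ · B) (cube A · conj B)
          ((natF 27 *F (x *F x)) /F (natF 4 *F powF (1F -F x) 3))
  ≈
  (₃F₂ (cube A) B (φ · cube A · conj B) (B · B)
        (cube A · cube A · conj B · conj B) (natF 4 *F x)
   - δ (x +F natF 2)
       * ((gauss ζ p r φ * gauss ζ p r (conj (cube A)))
          / (gauss ζ p r (φ · conj B) * gauss ζ p r (conj (cube A) · B))))
   - δ (1F -F x)
       * sumList L (λ χ →
           ((gauss ζ p r (conj χ) * gauss ζ p r (φ · conj (B · χ))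
               * gauss ζ p r (B · conj (cube A · χ)))
            / (gauss ζ p r (φ · conj B) * gauss ζ p r (conj (cube A) · B)
               * gauss ζ p r (cube A)))
           * conj χ (-F natF 4))
theorem9p10 𝔽 𝕂 p r p-prime order≡p^r order%6≡1 ζ ζ^p≈1 ζ≉1 η η-char η-nontrivial η³-trivial
  A B cA cB nM nB n₁ n₂ nC n₄ L L-characters L-cubes L-complete L-distinct =
  transformation L L-characters L-cubes L-complete L-distinct
  where
  open FieldFacts 𝔽 𝕂 using (numeral≢0)
  open AdditiveCharacter 𝔽 𝕂 p r p-prime order≡p^r ζ ζ^p≈1 ζ≉1
  setting : AdditiveSetting 𝔽 𝕂
  setting = record
    { 2≢0 = numeral≢0 2 3 ≡.refl order%6≡1 ; 3≢0 = numeral≢0 3 2 ≡.refl order%6≡1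
    ; ψ = ψ ; ψ-+ = ψ-+ ; ψ-0 = ψ-0 ; ψ-orthogonal = ψ-orthogonal }
  cubic-character : CubicCharacter 𝔽 𝕂
  cubic-character = record { η = η ; η-char = η-char ; η-nontrivial = η-nontrivial ; η³-trivial = η³-trivial }
  parameters : Parameters 𝔽 𝕂
  parameters = record { A = A ; B = B ; cA = cA ; cB = cB ; nM = nM ; nB = nB ; n₁ = n₁ ; n₂ = n₂ ; nC = nC ; n₄ = n₄ }
  open Transformation 𝔽 𝕂 setting cubic-character parameters using (transformation)
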